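{- Let $n,q\ge 1$ and let $f:\mathbb{R}^n\to\mathbb{R}^q$ be a partially defined function with domain $\mathrm{dom}(f)\subseteq\mathbb{R}^n$. Then $f$ is definable in $\mathrm{FO}(\mathbb{R},\mathbb{Z},+,\leq)$ if and only if $f$ is piecewise-simple.
   Context: Functions are partial: $f:X\to Y$ is defined on a set $\mathrm{dom}(f)\subseteq X$, and its graph is $G_f=\{(x,y)\in X\times Y\mid x\in\mathrm{dom}(f),\ y=f(x)\}$. The restriction of $f$ to $D\subseteq\mathrm{dom}(f)$ is denoted $f|_D$. The mixed additive theory $\mathrm{FO}(\mathbb{R},\mathbb{Z},+,\leq)$ is the first-order logic over the real numbers with addition, the order $\leq$, and a unary predicate for membership in $\mathbb{Z}$ (equivalently, with quantification over both reals and integers). A set $S\subseteq\mathbb{R}^m$ is definable in this logic if it is the set of tuples satisfying some formula (without parameters); a partial function $f:\mathbb{R}^n\to\mathbb{R}^q$ is definable in it if its graph $G_f\subseteq\mathbb{R}^{n+q}$ is. A polyhedral convex set of $\mathbb{R}^n$ is a set of the form $C=\{c\in\mathbb{R}^n\mid \forall j\in\{1,\dots,k\}\ \sum_{i=1}^n\alpha_j[i]\,c[i]\ \#_j\ \beta_j\}$ for some finite (possibly empty) sequence of tuples $(\alpha_j,\#_j,\beta_j)\in\mathbb{Q}^n\times\{<,\leq,=,\geq,>\}\times\mathbb{Q}$. A finitely generated monoid is a subset $M\subseteq\mathbb{Z}^n$ of the form $M=P^*=\{0\}\cup\{p_1+\cdots+p_k\mid k\ge 1,\ p_i\in P\}$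 with $P\subseteq\mathbb{Z}^n$ finite. A polinear set is a subset of $\mathbb{R}^n$ of the form $C+b+M=\{c+z\mid c\in C,\ z\in b+M\}$, where $b\in\mathbb{Z}^n$, $M\subseteq\mathbb{Z}^n$ is a finitely generated monoid, and $C\subseteq[0,1)^n$ is a non-empty polyhedral convex set. A semi-polinear set is a finite (possibly empty) union of polinear sets. A scalar partial function $f:\mathbb{R}^n\to\mathbb{R}$ whose domain is a semi-polinear set $D\subseteq\mathbb{R}^n$ is simple if there exist $\alpha\in\mathbb{Q}$ and $a,b\in\mathbb{Q}^n$ such that $f(c+z)=\alpha+\sum_{i=1}^n (a_ic_i+b_iz_i)$ for all $c\in[0,1)^n$ and $z\in\mathbb{Z}^n$ with $c+z\in D$. A partial function $f:\mathbb{R}^n\to\mathbb{R}^q$ with semi-polinear domain is simple if each of its $q$ coordinate functions is simple. A partial function $f:\mathbb{R}^n\to\mathbb{R}^q$ is piecewise-simple if $\mathrm{dom}(f)$ admits a finite partition into semi-polinear sets $D_1,\dots,D_k$ such that $f|_{D_j}$ is simple for each $j$. -}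

module Defs where

open import Algebra.Bundles using (RawMonoid)
open import Data.Fin.Base using (Fin; zero)
open import Data.Integer.Base as ℤ using (ℤ; 0ℤ)
open import Data.List.Base as List using (List)
open import Data.List.Membership.Propositional using () renaming (_∈_ to _∈ˡ_)
open import Data.List.Relation.Unary.All as All using (All)
open import Data.List.Relation.Unary.Any as Any using (Any)
open import Data.Nat.Base as ℕ using (ℕ; suc)
import Data.Nat.Properties as ℕ
open import Data.Product using (∃-syntax; Σ-syntax; _×_; _,_)
open import Data.Rational.Base as ℚ using (ℚ; 0ℚ; 1ℚ; ½; ∣_∣)
import Data.Rational.Properties as ℚ
open import Data.Rational.Solver using (module +-*-Solver)
open import Data.Sum.Base using (_⊎_)
open import Data.Vec.Functional using (Vector; zipWith; map; replicate; take; drop)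
  renaming (_∷_ to _◂_)
import Data.Vec.Functional.Relation.Binary.Equality.Setoid as VectorEquality
open import Function.Bundles using (_⇔_; module Equivalence)
open import Level using (0ℓ)
open import Relation.Binary.Bundles using (Setoid)
open import Relation.Binary.Definitions using (_Respects_)
open import Relation.Binary.PropositionalEquality
  using (_≡_; refl; sym; trans; cong; subst; subst₂)
open import Relation.Nullary.Negation using (¬_)
open import Relation.Unary using (Pred; _⊆_)

-- Real numbers: Cauchy sequences of rationals, up to null sequences.
-- Only the structure of an ordered ℚ-vector space is needed.  The proofs are abstract:
-- otherwise the positivity checker would unfold them in every type about reals.

Eventually : Pred ℕ 0ℓ → Set
Eventually P = ∃[ N ] (∀ n → N ℕ.≤ n → P n)

IsCauchy : (ℕ → ℚ) → Set
IsCauchy s = ∀ ε → 0ℚ ℚ.< ε →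
  ∃[ N ] (∀ m n → N ℕ.≤ m → N ℕ.≤ n → ∣ s m ℚ.- s n ∣ ℚ.< ε)

record ℝ : Set where
  constructor mkℝ
  field
    seq    : ℕ → ℚ
    cauchy : IsCauchy seq

open ℝ public

infix 4 _≈_ _≤_ _<_

record _≈_ (x y : ℝ) : Set where
  constructor mk≈
  field
    close : ∀ ε → 0ℚ ℚ.< ε → Eventually λ n → ∣ seq x n ℚ.- seq y n ∣ ℚ.< ε

record _≤_ (x y : ℝ) : Set where
  constructor mk≤
  field
    bounded : ∀ ε → 0ℚ ℚ.< ε → Eventually λ n → seq x n ℚ.< seq y n ℚ.+ ε

record _<_ (x y : ℝ) : Set where
  constructor mk<
  field
    gap       : ℚ
    gap>0     : 0ℚ ℚ.< gap
    separated : Eventually λ n → seq x n ℚ.+ gap ℚ.< seq y n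

private
  open +-*-Solver using (solve; con; _:*_; _:+_; _:-_; :-_; _:=_)

  half-pos : ∀ {ε} → 0ℚ ℚ.< ε → 0ℚ ℚ.< ½ ℚ.* ε
  half-pos {ε} ε>0 =
    subst (ℚ._< ½ ℚ.* ε) (ℚ.*-zeroʳ ½) (ℚ.*-monoʳ-<-pos ½ ε>0)

  halves : ∀ ε → ½ ℚ.* ε ℚ.+ ½ ℚ.* ε ≡ ε
  halves = solve 1 (λ ε → con ½ :* ε :+ con ½ :* ε := ε) refl

  ∣p-p∣<ε : ∀ p {ε} → 0ℚ ℚ.< ε → ∣ p ℚ.- p ∣ ℚ.< ε
  ∣p-p∣<ε p ε>0 = subst (λ d → ∣ d ∣ ℚ.< _) (sym (ℚ.+-inverseʳ p)) ε>0

  ∣p-q∣≡∣q-p∣ : ∀ p q → ∣ p ℚ.- q ∣ ≡ ∣ q ℚ.- p ∣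
  ∣p-q∣≡∣q-p∣ p q rewrite sym (ℚ.∣-p∣≡∣p∣ (p ℚ.- q)) =
    cong ∣_∣ (solve 2 (λ p q → :- (p :- q) := q :- p) refl p q)

  ∣d+e∣<ε : ∀ {d e ε} → ∣ d ∣ ℚ.< ½ ℚ.* ε → ∣ e ∣ ℚ.< ½ ℚ.* ε → ∣ d ℚ.+ e ∣ ℚ.< ε
  ∣d+e∣<ε {d} {e} {ε} d< e< = subst (_ ℚ.<_) (halves ε)
    (ℚ.≤-<-trans (ℚ.∣p+q∣≤∣p∣+∣q∣ d e) (ℚ.+-mono-< d< e<))

  telescope : ∀ p q r → (p ℚ.- q) ℚ.+ (q ℚ.- r) ≡ p ℚ.- r
  telescope = solve 3 (λ p q r → (p :- q) :+ (q :- r) := p :- r) refl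

  interchange : ∀ p q r s → (p ℚ.- r) ℚ.+ (q ℚ.- s) ≡ (p ℚ.+ q) ℚ.- (r ℚ.+ s)
  interchange = solve 4 (λ p q r s → (p :- r) :+ (q :- s) := (p :+ q) :- (r :+ s)) refl

abstract
  ≈-refl : ∀ {x} → x ≈ x
  ≈-refl {x} = mk≈ λ ε ε>0 → 0 , λ n _ → ∣p-p∣<ε (seq x n) ε>0

  ≈-sym : ∀ {x y} → x ≈ y → y ≈ x
  ≈-sym {x} {y} (mk≈ x≈y) = mk≈ λ ε ε>0 →
    let N , p = x≈y ε ε>0
    in N , λ n N≤n → subst (ℚ._< ε) (∣p-q∣≡∣q-p∣ (seq x n) (seq y n)) (p n N≤n)

  ≈-trans : ∀ {x y z} → x ≈ y → y ≈ z → x ≈ z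
  ≈-trans {x} {y} {z} (mk≈ x≈y) (mk≈ y≈z) = mk≈ λ ε ε>0 →
    let M , p = x≈y (½ ℚ.* ε) (half-pos ε>0)
        N , q = y≈z (½ ℚ.* ε) (half-pos ε>0)
    in M ℕ.⊔ N , λ n le →
       subst (λ d → ∣ d ∣ ℚ.< ε) (telescope (seq x n) (seq y n) (seq z n))
         (∣d+e∣<ε (p n (ℕ.m⊔n≤o⇒m≤o M N le)) (q n (ℕ.m⊔n≤o⇒n≤o M N le)))

ℝ-setoid : Setoid 0ℓ 0ℓ
ℝ-setoid = record
  { Carrier       = ℝ
  ; _≈_           = _≈_
  ; isEquivalence = record
    { refl  = ≈-refl
    ; sym   = ≈-sym
    ; trans = ≈-trans
    }
  }

private
  module Scaling (r : ℚ) where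
    K : ℚ
    K = 1ℚ ℚ.+ ∣ r ∣

    instance
      K-pos : ℚ.Positive K
      K-pos = ℚ.positive (ℚ.+-mono-<-≤ (ℚ.positive⁻¹ 1ℚ) (ℚ.0≤∣p∣ r))

      K-nonZero : ℚ.NonZero K
      K-nonZero = ℚ.pos⇒nonZero K

      1/K-pos : ℚ.Positive (ℚ.1/ K)
      1/K-pos = ℚ.1/pos⇒pos K

    δ : ℚ → ℚ
    δ ε = ℚ.1/ K ℚ.* ε

    δ-pos : ∀ {ε} → 0ℚ ℚ.< ε → 0ℚ ℚ.< δ ε
    δ-pos {ε} ε>0 =
      subst (ℚ._< δ ε) (ℚ.*-zeroʳ (ℚ.1/ K)) (ℚ.*-monoʳ-<-pos (ℚ.1/ K) ε>0)

    Kδ≡ε : ∀ ε → K ℚ.* δ ε ≡ ε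
    Kδ≡ε ε = trans (sym (ℚ.*-assoc K (ℚ.1/ K) ε))
      (trans (cong (ℚ._* ε) (ℚ.*-inverseʳ K)) (ℚ.*-identityˡ ε))

    ∣r∣≤K : ∣ r ∣ ℚ.≤ K
    ∣r∣≤K = subst (ℚ._≤ K) (ℚ.+-identityˡ ∣ r ∣)
      (ℚ.+-monoˡ-≤ ∣ r ∣ (ℚ.<⇒≤ (ℚ.positive⁻¹ 1ℚ)))

    factor : ∀ p q → r ℚ.* (p ℚ.- q) ≡ r ℚ.* p ℚ.- r ℚ.* q
    factor = solve 3 (λ r p q → r :* (p :- q) := r :* p :- r :* q) refl r

    scaled : ∀ {p q ε} → ∣ p ℚ.- q ∣ ℚ.< δ ε → ∣ r ℚ.* p ℚ.- r ℚ.* q ∣ ℚ.< ε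
    scaled {p} {q} {ε} d<δ = subst₂ ℚ._<_ (cong ∣_∣ (factor p q)) (Kδ≡ε ε)
      (subst (ℚ._< K ℚ.* δ ε) (sym (ℚ.∣p*q∣≡∣p∣*∣q∣ r (p ℚ.- q)))
        (ℚ.≤-<-trans
          (ℚ.*-monoʳ-≤-nonNeg ∣ p ℚ.- q ∣ {{ℚ.∣-∣-nonNeg (p ℚ.- q)}} ∣r∣≤K)
          (ℚ.*-monoʳ-<-pos K d<δ)))

abstract
  const-cauchy : ∀ r → IsCauchy (λ _ → r)
  const-cauchy r ε ε>0 = 0 , λ _ _ _ _ → ∣p-p∣<ε r ε>0

  +-cauchy : ∀ x y → IsCauchy (λ n → seq x n ℚ.+ seq y n)
  +-cauchy x y ε ε>0 =
    let M , p = cauchy x (½ ℚ.* ε) (half-pos ε>0)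
        N , q = cauchy y (½ ℚ.* ε) (half-pos ε>0)
    in M ℕ.⊔ N , λ m n N≤m N≤n →
       subst (λ d → ∣ d ∣ ℚ.< ε) (interchange (seq x m) (seq y m) (seq x n) (seq y n))
         (∣d+e∣<ε (p m n (ℕ.m⊔n≤o⇒m≤o M N N≤m) (ℕ.m⊔n≤o⇒m≤o M N N≤n))
                  (q m n (ℕ.m⊔n≤o⇒n≤o M N N≤m) (ℕ.m⊔n≤o⇒n≤o M N N≤n)))

  ·-cauchy : ∀ r x → IsCauchy (λ n → r ℚ.* seq x n)
  ·-cauchy r x ε ε>0 =
    let N , p = cauchy x (δ ε) (δ-pos ε>0)
    in N , λ m n N≤m N≤n → scaled (p m n N≤m N≤n)
    where open Scaling r

fromℚ : ℚ → ℝ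
fromℚ r = mkℝ (λ _ → r) (const-cauchy r)

fromℤ : ℤ → ℝ
fromℤ z = fromℚ (z ℚ./ 1)

0ℝ 1ℝ : ℝ
0ℝ = fromℚ 0ℚ
1ℝ = fromℚ 1ℚ

infixl 6 _+_
infixl 7 _·_

_+_ : ℝ → ℝ → ℝ
x + y = mkℝ (λ n → seq x n ℚ.+ seq y n) (+-cauchy x y)

_·_ : ℚ → ℝ → ℝ
r · x = mkℝ (λ n → r ℚ.* seq x n) (·-cauchy r x)

+-0-rawMonoid : RawMonoid 0ℓ 0ℓ
+-0-rawMonoid = record { Carrier = ℝ ; _≈_ = _≈_ ; _∙_ = _+_ ; ε = 0ℝ }

open import Algebra.Definitions.RawMonoid +-0-rawMonoid public using (sum)

open VectorEquality ℝ-setoid public using (_≋_; ≋-refl; ≋-sym; ≋-trans)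

infixl 6 _⊕_

_⊕_ : ∀ {n} → Vector ℝ n → Vector ℤ n → Vector ℝ n
c ⊕ z = zipWith _+_ c (map fromℤ z)

_·ᵛ_ : ∀ {n} → Vector ℚ n → Vector ℝ n → ℝ
α ·ᵛ c = sum (zipWith _·_ α c)

InUnitCube : ∀ {n} → Pred (Vector ℝ n) 0ℓ
InUnitCube c = ∀ i → 0ℝ ≤ c i × c i < 1ℝ

-- Vectors of reals are taken up to _≋_, so the domain respects _≋_, and the value
-- depends neither on the representative of the argument nor on the proof that it
-- lies in the domain.
record ℝ^_⇀ℝ^_ (n q : ℕ) : Set₁ where
  field
    dom      : Pred (Vector ℝ n) 0ℓ
    dom-resp : dom Respects _≋_
    app      : ∀ x → dom x → Vector ℝ q
    app-cong : ∀ {x y} (p : dom x) (p′ : dom y) → x ≋ y → app x p ≋ app y p′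

open ℝ^_⇀ℝ^_ public

graph : ∀ {n q} → ℝ^ n ⇀ℝ^ q → Pred (Vector ℝ (n ℕ.+ q)) 0ℓ
graph {n} f v = Σ[ p ∈ dom f (take n v) ] (drop n v ≋ app f (take n v) p)

restrict : ∀ {n q} (f : ℝ^ n ⇀ℝ^ q) (D : Pred (Vector ℝ n) 0ℓ) →
           D Respects _≋_ → D ⊆ dom f → ℝ^ n ⇀ℝ^ q
restrict f D D-resp D⊆dom = record
  { dom      = D
  ; dom-resp = D-resp
  ; app      = λ x p → app f x (D⊆dom p)
  ; app-cong = λ p p′ → app-cong f (D⊆dom p) (D⊆dom p′)
  }

coordinate : ∀ {n q} → ℝ^ n ⇀ℝ^ q → Fin q → ℝ^ n ⇀ℝ^ 1
coordinate f j = record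
  { dom      = dom f
  ; dom-resp = dom-resp f
  ; app      = λ x p _ → app f x p j
  ; app-cong = λ p p′ x≋y _ → app-cong f p p′ x≋y j
  }

infixl 6 _⊞_
infix  5 _≤ᶠ_ _≈ᶠ_
infixr 4 _∧ᶠ_
infixr 3 _∨ᶠ_

data Term (m : ℕ) : Set where
  var : Fin m → Term m
  _⊞_ : Term m → Term m → Term m

-- The signature is (+, ≤, ℤ) with equality; free variables are de Bruijn indices below m.
data Formula (m : ℕ) : Set where
  _≤ᶠ_ _≈ᶠ_ : Term m → Term m → Formula m
  isℤ       : Term m → Formula m
  ¬ᶠ_       : Formula m → Formula m
  _∧ᶠ_ _∨ᶠ_ : Formula m → Formula m → Formula m
  ∀ᶠ_ ∃ᶠ_   : Formula (suc m) → Formula m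

⟦_⟧ : ∀ {m} → Term m → Vector ℝ m → ℝ
⟦ var i ⟧ v = v i
⟦ s ⊞ t ⟧ v = ⟦ s ⟧ v + ⟦ t ⟧ v

infix 2 _⊨_

_⊨_ : ∀ {m} → Vector ℝ m → Formula m → Set
v ⊨ s ≤ᶠ t = ⟦ s ⟧ v ≤ ⟦ t ⟧ v
v ⊨ s ≈ᶠ t = ⟦ s ⟧ v ≈ ⟦ t ⟧ v
v ⊨ isℤ t  = ∃[ z ] (⟦ t ⟧ v ≈ fromℤ z)
v ⊨ ¬ᶠ φ   = ¬ (v ⊨ φ)
v ⊨ φ ∧ᶠ ψ = (v ⊨ φ) × (v ⊨ ψ)
v ⊨ φ ∨ᶠ ψ = (v ⊨ φ) ⊎ (v ⊨ ψ)
v ⊨ ∀ᶠ φ   = ∀ x → x ◂ v ⊨ φ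
v ⊨ ∃ᶠ φ   = ∃[ x ] (x ◂ v ⊨ φ)

DefinableSet : ∀ {m} → Pred (Vector ℝ m) 0ℓ → Set
DefinableSet S = ∃[ φ ] (∀ v → S v ⇔ (v ⊨ φ))

Definable : ∀ {n q} → ℝ^ n ⇀ℝ^ q → Set
Definable f = DefinableSet (graph f)

data Comparison : Set where
  lt le eq ge gt : Comparison

compare : Comparison → ℝ → ℝ → Set
compare lt x y = x < y
compare le x y = x ≤ y
compare eq x y = x ≈ y
compare ge x y = y ≤ x
compare gt x y = y < x

record Constraint (n : ℕ) : Set where
  constructor mkConstraint
  field
    α : Vector ℚ n
    # : Comparison
    β : ℚ

Satisfies : ∀ {n} → Vector ℝ n → Constraint n → Set
Satisfies c (mkConstraint α # β) = compare # (α ·ᵛ c) (fromℚ β)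

PolyhedralConvex : ℕ → Set
PolyhedralConvex n = List (Constraint n)

infix 4 _∈ᶜ_ _∈*_ _∈ᵖ_ _∈ˢ_

_∈ᶜ_ : ∀ {n} → Vector ℝ n → PolyhedralConvex n → Set
c ∈ᶜ C = All (Satisfies c) C

-- Membership in the monoid P*; the empty list of summands gives 0.
_∈*_ : ∀ {n} → Vector ℤ n → List (Vector ℤ n) → Set
m ∈* P = ∃[ ps ] (All (_∈ˡ P) ps ×
                  (∀ i → m i ≡ List.foldr (zipWith ℤ._+_) (replicate _ 0ℤ) ps i))

record Polinear (n : ℕ) : Set where
  field
    C        : PolyhedralConvex n
    C⊆cube   : ∀ c → c ∈ᶜ C → InUnitCube c
    nonEmpty : ∃[ c ] (c ∈ᶜ C)
    b        : Vector ℤ n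
    P        : List (Vector ℤ n)

_∈ᵖ_ : ∀ {n} → Vector ℝ n → Polinear n → Set
x ∈ᵖ S = ∃[ c ] ∃[ z ] (c ∈ᶜ C × (∃[ m ] (m ∈* P × (∀ i → z i ≡ b i ℤ.+ m i))) × x ≋ c ⊕ z)
  where open Polinear S

SemiPolinear : ℕ → Set
SemiPolinear n = List (Polinear n)

_∈ˢ_ : ∀ {n} → Vector ℝ n → SemiPolinear n → Set
x ∈ˢ D = Any (x ∈ᵖ_) D

IsSemiPolinear : ∀ {n} → Pred (Vector ℝ n) 0ℓ → Set
IsSemiPolinear S = ∃[ D ] (∀ x → S x ⇔ x ∈ˢ D)

∈ˢ-resp-≋ : ∀ {n} (D : SemiPolinear n) → (_∈ˢ D) Respects _≋_
∈ˢ-resp-≋ D x≋y = Any.map λ { (c , z , c∈C , z∈b+M , x≋c+z) →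
  c , z , c∈C , z∈b+M , ≋-trans (≋-sym x≋y) x≋c+z }

ScalarSimple : ∀ {n} → ℝ^ n ⇀ℝ^ 1 → Set
ScalarSimple {n} f =
  IsSemiPolinear (dom f) ×
  ∃[ α ] Σ[ a ∈ Vector ℚ n ] Σ[ b ∈ Vector ℚ n ]
    (∀ c z → InUnitCube c → (p : dom f (c ⊕ z)) →
      app f (c ⊕ z) p zero ≈ fromℚ α + sum (λ i → a i · c i + b i · fromℤ (z i)))

Simple : ∀ {n q} → ℝ^ n ⇀ℝ^ q → Set
Simple f = IsSemiPolinear (dom f) × (∀ j → ScalarSimple (coordinate f j))

record IsPartition {n k} (S : Pred (Vector ℝ n) 0ℓ) (D : Fin k → SemiPolinear n) : Set where
  field
    nonEmpty : ∀ j → ∃[ x ] (x ∈ˢ D j)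
    covers   : ∀ x → S x ⇔ (∃[ j ] (x ∈ˢ D j))
    disjoint : ∀ {i j x} → x ∈ˢ D i → x ∈ˢ D j → i ≡ j

  piece⊆ : ∀ j → (_∈ˢ D j) ⊆ S
  piece⊆ j {x} x∈Dⱼ = Equivalence.from (covers x) (j , x∈Dⱼ)

PiecewiseSimple : ∀ {n q} → ℝ^ n ⇀ℝ^ q → Set
PiecewiseSimple {n} f =
  ∃[ k ] Σ[ D ∈ (Fin k → SemiPolinear n) ] Σ[ part ∈ IsPartition (dom f) D ]
    (∀ j → Simple (restrict f (_∈ˢ D j) (∈ˢ-resp-≋ (D j)) (IsPartition.piece⊆ part j)))

{-# OPTIONS --safe #-}
module Submission where

-- Write a real number as c + z with c in [0,1) and z an integer.  For fractional parts c in the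
-- unit cube, a linear combination a · c with integer coefficients is bounded, so every atomic
-- formula about c + z is a Boolean combination of linear inequalities in c alone and linear
-- inequalities in z alone.  A quantified fractional part can be moved to the midpoint of the two
-- neighbouring roots of the inequalities containing it, and a quantified integer can be moved by
-- multiples of a common multiple N of the moduli until one of the inequalities containing it is tight up to a constant,
-- without changing the truth of any atom.  So it suffices to test finitely many affine terms, and
-- quantifiers can be eliminated.
--
-- In disjunctive normal form, the fractional parts range over polyhedra and the integer parts over
-- sets Z which are closed under adding the elements of the monoid M = { m ∣ A m ≤ 0, N ∣ m }.
-- Dickson's lemma provides finite sets F and P with Z = F + M and M = P*, hence definable sets are
-- semi-polinear.
--
-- A coordinate y of f (x) is the unique solution of a formula, so the terms that are tested for y
-- must include y itself.  Thus each coordinate of f takes the values of finitely many simple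
-- functions; the definable sets on which f coincides with a given tuple of them cover the domain
-- and can be made disjoint.  Conversely, semi-polinear sets and simple functions are defined by
-- explicit formulas.

open import Axiom.ExcludedMiddle using (ExcludedMiddle)
open import Data.Bool.Base using (Bool; true; false)
open import Data.Fin.Base using (Fin; zero; suc; splitAt; _↑ˡ_; _↑ʳ_)
open import Data.Fin.Properties using (splitAt-↑ˡ; splitAt-↑ʳ)
open import Data.Integer.Base as ℤ using (ℤ; +_; -[1+_])
open import Data.Integer.Divisibility.Signed using (_∣_; divides)
import Data.Integer.Divisibility.Signed as ∣
import Data.Integer.DivMod as ℤ
import Data.Integer.Properties as ℤ
open import Data.Integer.Tactic.RingSolver using () renaming (solve-∀ to ℤ-ring)
open import Data.List.Base as List
  using (List; []; _∷_; _++_; cartesianProduct; cartesianProductWith; concatMap; foldr)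
open import Data.List.Membership.Propositional using (_∈_; find; lose)
open import Data.List.Membership.Propositional.Properties
  using (∈-++⁺ˡ; ∈-++⁺ʳ; ∈-allFin; ∈-cartesianProduct⁺; ∈-cartesianProductWith⁺; ∈-concatMap⁺; ∈-map⁺; ∈-upTo⁺)
open import Data.List.Relation.Unary.All as All using (All; []; _∷_)
import Data.List.Relation.Unary.All.Properties as All
open import Data.List.Relation.Unary.Any as Any using (Any; here; there)
import Data.List.Relation.Unary.Any.Properties as Any
open import Data.Nat.Base as ℕ using (ℕ; zero; suc; _≥_)
open import Data.Nat.Induction using (<-wellFounded)
import Data.Nat.ListAction as ℕ
import Data.Nat.Properties as ℕ
open import Data.Product as Product using (∃-syntax; Σ-syntax; _×_; _,_; proj₁; proj₂; swap)
open import Data.Rational.Base as ℚ using (ℚ; 0ℚ; 1ℚ; ½)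
import Data.Rational.Properties as ℚ
open import Data.Rational.Solver using (module +-*-Solver)
import Data.Rational.Unnormalised.Base as ℚᵘ
import Data.Rational.Unnormalised.Properties as ℚᵘ
open import Data.Sum.Base as Sum using (_⊎_; inj₁; inj₂)
open import Data.Unit.Base using (⊤; tt)
open import Data.Vec.Functional using (Vector; drop; map; replicate; tail; take; zipWith)
  renaming (_∷_ to _◂_; _++_ to _⧺_)
open import Function.Base using (_∘_; flip; id)
open import Function.Bundles using (_⇔_; mk⇔; module Equivalence)
open import Induction.WellFounded using (Acc; acc)
open import Level using (0ℓ)
open import Relation.Binary.Definitions using (Total; Transitive)
open import Relation.Binary.PropositionalEquality
  using (_≡_; _≢_; refl; sym; trans; cong; cong₂; subst; subst₂)
open import Relation.Nullary using (¬_; Dec; yes; no; contradiction)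
open import Relation.Unary using (Pred)
open import Defs hiding (lt; le; eq; ge; gt)

-- One finite list of test points does two jobs: it makes the disjunction in `eliminate` exhaustive,
-- and it supplies the possible values of a definable function. Hence elimination works by
-- substituting test points, not by combining inequalities in pairs, and `select` keeps the point
-- that it finds. A test point is t(c) + τ(z) / (1 + k). Since t depends on c alone and τ on z
-- alone, its coefficients for c and z are independent of each other, as in a simple function.
--
-- Midpoints are tested because negated atoms are strict: the solutions in one variable may fill an
-- open interval that contains no root. If the given point is itself a root, both of its neighbours
-- are equal to it and so is their midpoint.
--
-- The order of Cauchy reals is undecidable. Excluded middle is used to compare reals, to take
-- floors, to apply Dickson's lemma to arbitrary sets, and to decide which cells and pieces are
-- empty.

-- The integers inside the rationals

module IntegerEmbedding where

  ι : ℤ → ℚ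
  ι z = z ℚ./ 1

  ι-+ : ∀ x y → ι (x ℤ.+ y) ≡ ι x ℚ.+ ι y
  ι-+ x y = ℚ.toℚᵘ-injective (ℚᵘ.≃-trans (ℚ.toℚᵘ-fromℚᵘ (ℚᵘ.mkℚᵘ (x ℤ.+ y) 0))
    (ℚᵘ.≃-trans (ℚᵘ.*≡* (cong (ℤ._* (+ 1)) (cong₂ ℤ._+_ (sym (ℤ.*-identityʳ x)) (sym (ℤ.*-identityʳ y)))))
    (ℚᵘ.≃-sym (ℚᵘ.≃-trans (ℚ.toℚᵘ-homo-+ (ι x) (ι y))
      (ℚᵘ.+-cong (ℚ.toℚᵘ-fromℚᵘ (ℚᵘ.mkℚᵘ x 0)) (ℚ.toℚᵘ-fromℚᵘ (ℚᵘ.mkℚᵘ y 0)))))))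

  ι-* : ∀ x y → ι (x ℤ.* y) ≡ ι x ℚ.* ι y
  ι-* x y = ℚ.toℚᵘ-injective (ℚᵘ.≃-trans (ℚ.toℚᵘ-fromℚᵘ (ℚᵘ.mkℚᵘ (x ℤ.* y) 0))
    (ℚᵘ.≃-sym (ℚᵘ.≃-trans (ℚ.toℚᵘ-homo-* (ι x) (ι y))
      (ℚᵘ.*-cong (ℚ.toℚᵘ-fromℚᵘ (ℚᵘ.mkℚᵘ x 0)) (ℚ.toℚᵘ-fromℚᵘ (ℚᵘ.mkℚᵘ y 0))))))

  ι-neg : ∀ x → ι (ℤ.- x) ≡ ℚ.- ι x
  ι-neg x = ℚ.toℚᵘ-injective (ℚᵘ.≃-trans (ℚ.toℚᵘ-fromℚᵘ (ℚᵘ.mkℚᵘ (ℤ.- x) 0))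
    (ℚᵘ.≃-sym (ℚᵘ.≃-trans (ℚ.toℚᵘ-homo‿- (ι x))
      (ℚᵘ.-‿cong (ℚ.toℚᵘ-fromℚᵘ (ℚᵘ.mkℚᵘ x 0))))))

  ι-mono : ∀ {x y} → x ℤ.≤ y → ι x ℚ.≤ ι y
  ι-mono {x} {y} x≤y = ℚ.toℚᵘ-cancel-≤
    (ℚᵘ.≤-respˡ-≃ (ℚᵘ.≃-sym (ℚ.toℚᵘ-fromℚᵘ (ℚᵘ.mkℚᵘ x 0)))
    (ℚᵘ.≤-respʳ-≃ (ℚᵘ.≃-sym (ℚ.toℚᵘ-fromℚᵘ (ℚᵘ.mkℚᵘ y 0)))
    (ℚᵘ.*≤* (ℤ.*-monoʳ-≤-nonNeg (+ 1) x≤y))))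

  ι-cancel : ∀ {x y} → ι x ℚ.≤ ι y → x ℤ.≤ y
  ι-cancel {x} {y} p = ℤ.*-cancelʳ-≤-pos x y (+ 1) (ℚᵘ.drop-*≤*
    (ℚᵘ.≤-respˡ-≃ (ℚ.toℚᵘ-fromℚᵘ (ℚᵘ.mkℚᵘ x 0))
    (ℚᵘ.≤-respʳ-≃ (ℚ.toℚᵘ-fromℚᵘ (ℚᵘ.mkℚᵘ y 0)) (ℚ.toℚᵘ-mono-≤ p))))

  -- A denominator is at least 1, so dropping it only enlarges the absolute value. The Archimedean
  -- property rests on this.
  ≤-ι∣numerator∣ : ∀ p → p ℚ.≤ ι (+ ℤ.∣ ℚ.↥ p ∣)
  ≤-ι∣numerator∣ p@(ℚ.mkℚ n d _) = ℚ.toℚᵘ-cancel-≤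
    (ℚᵘ.≤-respʳ-≃ (ℚᵘ.≃-sym (ℚ.toℚᵘ-fromℚᵘ (ℚᵘ.mkℚᵘ (+ ℤ.∣ n ∣) 0)))
    (ℚᵘ.*≤* (bound n)))
    where
    bound : ∀ n → n ℤ.* + 1 ℤ.≤ + ℤ.∣ n ∣ ℤ.* + suc d
    bound (+ n) = ℤ.*-monoˡ-≤-nonNeg (+ n) (ℤ.+≤+ (ℕ.s≤s ℕ.z≤n))
    bound -[1+ n ] = ℤ.≤-trans (ℤ.≤-reflexive (ℤ.*-identityʳ -[1+ n ])) ℤ.-≤+

open IntegerEmbedding public

-- Order and linear structure of the Cauchy reals, constructively

module RealOrder where

  open +-*-Solver using (solve; con; _:*_; _:+_; _:-_; :-_; _:=_)

  -- Reduces an identity between reals to a ring identity between rationals at each index, which the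
  -- solver can prove.
  pointwise : ∀ {x y} → (∀ n → seq x n ≡ seq y n) → x ≈ y
  pointwise {x} {y} e = mk≈ λ ε ε>0 → 0 , λ n _ →
    subst (λ d → ℚ.∣ d ∣ ℚ.< ε) (trans (sym (ℚ.+-inverseʳ (seq x n))) (cong (λ d → seq x n ℚ.- d) (e n))) ε>0

  both : ∀ {P Q : ℕ → Set} → Eventually P → Eventually Q → Eventually (λ n → P n × Q n)
  both (M , p) (N , q) = M ℕ.⊔ N , λ n le →
    p n (ℕ.m⊔n≤o⇒m≤o M N le) , q n (ℕ.m⊔n≤o⇒n≤o M N le)

  eventually-map : ∀ {P Q : ℕ → Set} → (∀ n → P n → Q n) → Eventually P → Eventually Q
  eventually-map f (N , p) = N , λ n le → f n (p n le)

  r*ε>0 : ∀ r {ε} .{{_ : ℚ.Positive r}} → 0ℚ ℚ.< ε → 0ℚ ℚ.< r ℚ.* ε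
  r*ε>0 r {ε} ε>0 = subst (ℚ._< r ℚ.* ε) (ℚ.*-zeroʳ r) (ℚ.*-monoʳ-<-pos r ε>0)

  p≤∣p∣ : ∀ p → p ℚ.≤ ℚ.∣ p ∣
  p≤∣p∣ p with ℚ.≤-total 0ℚ p
  ... | inj₁ 0≤p = ℚ.≤-reflexive (sym (ℚ.0≤p⇒∣p∣≡p 0≤p))
  ... | inj₂ p≤0 = ℚ.≤-trans p≤0 (ℚ.0≤∣p∣ p)

  ∣p-q∣<ε⇒p<q+ε : ∀ p q {ε} → ℚ.∣ p ℚ.- q ∣ ℚ.< ε → p ℚ.< q ℚ.+ ε
  ∣p-q∣<ε⇒p<q+ε p q {ε} lt = subst (ℚ._< q ℚ.+ ε)
    (solve 2 (λ p q → q :+ (p :- q) := p) refl p q)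
    (ℚ.+-monoʳ-< q (ℚ.≤-<-trans (p≤∣p∣ (p ℚ.- q)) lt))

  ∣p-q∣<ε : ∀ p q {ε} → p ℚ.< q ℚ.+ ε → q ℚ.< p ℚ.+ ε → ℚ.∣ p ℚ.- q ∣ ℚ.< ε
  ∣p-q∣<ε p q {ε} lt₁ lt₂ with ℚ.∣p∣≡p∨∣p∣≡-p (p ℚ.- q)
  ... | inj₁ e = subst₂ ℚ._<_ (trans (solve 2 (λ p q → (:- q) :+ p := p :- q) refl p q) (sym e))
                   (solve 2 (λ q ε → (:- q) :+ (q :+ ε) := ε) refl q ε) (ℚ.+-monoʳ-< (ℚ.- q) lt₁)
  ... | inj₂ e = subst₂ ℚ._<_ (trans (solve 2 (λ p q → (:- p) :+ q := :- (p :- q)) refl p q) (sym e))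
                   (solve 2 (λ q ε → (:- q) :+ (q :+ ε) := ε) refl p ε) (ℚ.+-monoʳ-< (ℚ.- p) lt₂)

  ε-splits : ∀ a ε → a ℚ.+ ½ ℚ.* ε ℚ.+ ½ ℚ.* ε ≡ a ℚ.+ ε
  ε-splits = solve 2 (λ a ε → a :+ con ½ :* ε :+ con ½ :* ε := a :+ ε) refl

  abstract
    ≈⇒≤ : ∀ {x y} → x ≈ y → x ≤ y
    ≈⇒≤ {x} {y} (mk≈ x≈y) = mk≤ λ ε ε>0 →
      eventually-map (λ n → ∣p-q∣<ε⇒p<q+ε (seq x n) (seq y n)) (x≈y ε ε>0)

    ≤-antisym : ∀ {x y} → x ≤ y → y ≤ x → x ≈ y
    ≤-antisym {x} {y} (mk≤ x≤y) (mk≤ y≤x) = mk≈ λ ε ε>0 →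
      eventually-map (λ n (p , q) → ∣p-q∣<ε (seq x n) (seq y n) p q) (both (x≤y ε ε>0) (y≤x ε ε>0))

    ≤-trans : ∀ {x y z} → x ≤ y → y ≤ z → x ≤ z
    ≤-trans {x} {y} {z} (mk≤ x≤y) (mk≤ y≤z) = mk≤ λ ε ε>0 →
      eventually-map (λ n (p , q) → ℚ.<-trans p
          (subst (seq y n ℚ.+ ½ ℚ.* ε ℚ.<_) (ε-splits (seq z n) ε) (ℚ.+-monoˡ-< (½ ℚ.* ε) q)))
        (both (x≤y (½ ℚ.* ε) (r*ε>0 ½ ε>0)) (y≤z (½ ℚ.* ε) (r*ε>0 ½ ε>0)))

    +-mono-≤ : ∀ {x y u v} → x ≤ y → u ≤ v → x + u ≤ y + v
    +-mono-≤ {x} {y} {u} {v} (mk≤ x≤y) (mk≤ u≤v) = mk≤ λ ε ε>0 →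
      eventually-map (λ n (p , q) → subst (seq x n ℚ.+ seq u n ℚ.<_)
          (solve 3 (λ a b ε → (a :+ con ½ :* ε) :+ (b :+ con ½ :* ε) := a :+ b :+ ε) refl (seq y n) (seq v n) ε)
          (ℚ.+-mono-< p q))
        (both (x≤y (½ ℚ.* ε) (r*ε>0 ½ ε>0)) (u≤v (½ ℚ.* ε) (r*ε>0 ½ ε>0)))

    ·-mono-≤-pos : ∀ r .{{_ : ℚ.Positive r}} {x y} → x ≤ y → r · x ≤ r · y
    ·-mono-≤-pos r {x} {y} (mk≤ x≤y) = mk≤ λ ε ε>0 →
      eventually-map (λ n p → subst (r ℚ.* seq x n ℚ.<_) (rescale (seq y n) ε) (ℚ.*-monoʳ-<-pos r p))
        (x≤y (ℚ.1/ r ℚ.* ε) (r*ε>0 (ℚ.1/ r) {{ℚ.1/pos⇒pos r}} ε>0))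
      where
      instance
        r≢0 : ℚ.NonZero r
        r≢0 = ℚ.pos⇒nonZero r
      rescale : ∀ a ε → r ℚ.* (a ℚ.+ ℚ.1/ r ℚ.* ε) ≡ r ℚ.* a ℚ.+ ε
      rescale a ε = trans (solve 4 (λ r a s ε → r :* (a :+ s :* ε) := r :* a :+ (r :* s) :* ε) refl r a (ℚ.1/ r) ε)
        (cong (r ℚ.* a ℚ.+_) (trans (cong (ℚ._* ε) (ℚ.*-inverseʳ r)) (ℚ.*-identityˡ ε)))

    fromℚ-mono-≤ : ∀ {p q} → p ℚ.≤ q → fromℚ p ≤ fromℚ q
    fromℚ-mono-≤ {p} {q} p≤q = mk≤ λ ε ε>0 → 0 , λ n _ →
      subst (ℚ._< q ℚ.+ ε) (ℚ.+-identityʳ p) (ℚ.+-mono-≤-< p≤q ε>0)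

    <⇒≱ : ∀ {x y} → x < y → ¬ y ≤ x
    <⇒≱ {x} {y} (mk< g g>0 sep) (mk≤ y≤x) with both sep (y≤x g g>0)
    ... | N , p = ℚ.<-asym (proj₁ (p N ℕ.≤-refl)) (proj₂ (p N ℕ.≤-refl))

    fromℚ-mono-< : ∀ {p q} → p ℚ.< q → fromℚ p < fromℚ q
    fromℚ-mono-< {p} {q} p<q = mk< (½ ℚ.* (q ℚ.- p)) (r*ε>0 ½ q-p>0) (0 , λ n _ →
      subst₂ ℚ._<_ (cong (p ℚ.+_) (ℚ.+-identityʳ (½ ℚ.* (q ℚ.- p))))
        (solve 2 (λ p q → p :+ (con ½ :* (q :- p) :+ con ½ :* (q :- p)) := q) refl p q)
        (ℚ.+-monoʳ-< p (ℚ.+-monoʳ-< (½ ℚ.* (q ℚ.- p)) (r*ε>0 ½ q-p>0))))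
      where
      q-p>0 : 0ℚ ℚ.< q ℚ.- p
      q-p>0 = subst (ℚ._< q ℚ.- p) (ℚ.+-inverseʳ p) (ℚ.+-monoˡ-< (ℚ.- p) p<q)

  fromℚ-cancel-≤ : ∀ {p q} → fromℚ p ≤ fromℚ q → p ℚ.≤ q
  fromℚ-cancel-≤ {p} {q} le with q ℚ.<? p
  ... | yes q<p = contradiction le (<⇒≱ (fromℚ-mono-< q<p))
  ... | no q≮p = ℚ.≮⇒≥ q≮p

  ≤-refl : ∀ {x} → x ≤ x
  ≤-refl = ≈⇒≤ ≈-refl

  +-cong : ∀ {x y u v} → x ≈ y → u ≈ v → x + u ≈ y + v
  +-cong x≈y u≈v = ≤-antisym (+-mono-≤ (≈⇒≤ x≈y) (≈⇒≤ u≈v)) (+-mono-≤ (≈⇒≤ (≈-sym x≈y)) (≈⇒≤ (≈-sym u≈v)))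

  ≤-resp : ∀ {x x′ y y′} → x ≈ x′ → y ≈ y′ → x ≤ y → x′ ≤ y′
  ≤-resp x≈ y≈ x≤y = ≤-trans (≈⇒≤ (≈-sym x≈)) (≤-trans x≤y (≈⇒≤ y≈))

  -- Obtained by adding `- x - y` to both sides, without going back to the sequences.
  neg-antimono : ∀ {x y} → x ≤ y → ℚ.- 1ℚ · y ≤ ℚ.- 1ℚ · x
  neg-antimono {x} {y} x≤y = ≤-resp
    (pointwise λ n → solve 2 (λ x y → x :+ (con (ℚ.- 1ℚ) :* x :+ con (ℚ.- 1ℚ) :* y) := con (ℚ.- 1ℚ) :* y) refl (seq x n) (seq y n))
    (pointwise λ n → solve 2 (λ x y → y :+ (con (ℚ.- 1ℚ) :* x :+ con (ℚ.- 1ℚ) :* y) := con (ℚ.- 1ℚ) :* x) refl (seq x n) (seq y n))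
    (+-mono-≤ x≤y (≤-refl {ℚ.- 1ℚ · x + ℚ.- 1ℚ · y}))

  ·-antimono-≤-neg : ∀ r .{{_ : ℚ.Negative r}} {x y} → x ≤ y → r · y ≤ r · x
  ·-antimono-≤-neg r@(ℚ.mkℚ -[1+ _ ] _ _) {x} {y} x≤y = ≤-resp (twice y) (twice x)
    (·-mono-≤-pos (ℚ.- r) (neg-antimono x≤y))
    where
    twice : ∀ w → (ℚ.- r) · (ℚ.- 1ℚ · w) ≈ r · w
    twice w = pointwise λ n → solve 2 (λ r w → (:- r) :* (con (ℚ.- 1ℚ) :* w) := r :* w) refl r (seq w n)

  -- Equality is a pair of inequalities, so the congruence is inherited from monotonicity or
  -- antitonicity, by the sign of `r`; for `r = 0` both sides vanish.
  ·-cong : ∀ r {x y} → x ≈ y → r · x ≈ r · y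
  ·-cong r@(ℚ.mkℚ (+ suc _) _ _) x≈y = ≤-antisym (·-mono-≤-pos r (≈⇒≤ x≈y)) (·-mono-≤-pos r (≈⇒≤ (≈-sym x≈y)))
  ·-cong r@(ℚ.mkℚ -[1+ _ ] _ _) x≈y = ≤-antisym (·-antimono-≤-neg r (≈⇒≤ (≈-sym x≈y))) (·-antimono-≤-neg r (≈⇒≤ x≈y))
  ·-cong r@(ℚ.mkℚ (+ zero) _ _) {x} {y} x≈y = pointwise λ n →
    trans (cong (ℚ._* seq x n) r≡0) (trans (trans (ℚ.*-zeroˡ (seq x n)) (sym (ℚ.*-zeroˡ (seq y n)))) (cong (ℚ._* seq y n) (sym r≡0)))
    where
    r≡0 : r ≡ 0ℚ
    r≡0 = ℚ.↥p≡0⇒p≡0 r refl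

  fromℤ-mono-≤ : ∀ x y → x ℤ.≤ y → fromℤ x ≤ fromℤ y
  fromℤ-mono-≤ x y = fromℚ-mono-≤ ∘ ι-mono {x} {y}

  fromℤ-cancel-≤ : ∀ x y → fromℤ x ≤ fromℤ y → x ℤ.≤ y
  fromℤ-cancel-≤ x y = ι-cancel {x} {y} ∘ fromℚ-cancel-≤

  fromℤ-+ : ∀ x y → fromℤ (x ℤ.+ y) ≈ fromℤ x + fromℤ y
  fromℤ-+ x y = pointwise λ _ → ι-+ x y

  fromℤ-neg : ∀ x → fromℤ (ℤ.- x) ≈ ℚ.- 1ℚ · fromℤ x
  fromℤ-neg x = pointwise λ _ → trans (ι-neg x) (neg≡ (ι x))
    where
    neg≡ : ∀ a → ℚ.- a ≡ ℚ.- 1ℚ ℚ.* a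
    neg≡ = solve 1 (λ a → :- a := con (ℚ.- 1ℚ) :* a) refl

  neg-involutive : ∀ x → ℚ.- 1ℚ · (ℚ.- 1ℚ · x) ≈ x
  neg-involutive x = pointwise λ n → solve 1 (λ x → con (ℚ.- 1ℚ) :* (con (ℚ.- 1ℚ) :* x) := x) refl (seq x n)

  +-neg : ∀ x → x + ℚ.- 1ℚ · x ≈ 0ℝ
  +-neg x = pointwise λ n → solve 1 (λ x → x :+ con (ℚ.- 1ℚ) :* x := con 0ℚ) refl (seq x n)

  +-cancel : ∀ x y → x + y + ℚ.- 1ℚ · x ≈ y
  +-cancel x y = pointwise λ n → solve 2 (λ x y → x :+ y :+ con (ℚ.- 1ℚ) :* x := y) refl (seq x n) (seq y n)

  -+-cancel : ∀ x y → x + ℚ.- 1ℚ · y + y ≈ x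
  -+-cancel x y = pointwise λ n → solve 2 (λ x y → x :+ con (ℚ.- 1ℚ) :* y :+ y := x) refl (seq x n) (seq y n)

open RealOrder public

-- Totality of the order, floors and fractional parts

module ClassicalOrder (em : ExcludedMiddle 0ℓ) where

  open +-*-Solver using (solve; con; _:*_; _:+_; _:-_; :-_; _:=_)

  ¬¬-elim : {P : Set} → ¬ ¬ P → P
  ¬¬-elim {P} ¬¬p with em {P}
  ... | yes p = p
  ... | no ¬p = contradiction ¬p ¬¬p

  ¬∀⇒∃¬ : {A : Set} {P : A → Set} → ¬ (∀ a → P a) → ∃[ a ] ¬ P a
  ¬∀⇒∃¬ ¬∀ = ¬¬-elim λ ¬∃ → ¬∀ λ a → ¬¬-elim λ ¬p → ¬∃ (a , ¬p)

  abstract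
    -- If `x ≤ y` fails for `ε`, some index past `N` has `x` at least `ε` above `y`. Past `N` each
    -- sequence varies by less than ε/4, so a gap of ε/2 remains at all of these indices.
    ≰⇒> : ∀ {x y} → ¬ x ≤ y → y < x
    ≰⇒> {x} {y} x≰y with ¬∀⇒∃¬ (x≰y ∘ mk≤)
    ... | ε , ¬lt with em {0ℚ ℚ.< ε}
    ...   | no ε≯0 = contradiction (λ ε>0 → contradiction ε>0 ε≯0) ¬lt
    ...   | yes ε>0 = mk< (½ ℚ.* ε) (r*ε>0 ½ ε>0) (N , separated-at)
      where
      η : ℚ
      η = ½ ℚ.* (½ ℚ.* ε)
      η>0 : 0ℚ ℚ.< η
      η>0 = r*ε>0 ½ (r*ε>0 ½ ε>0)
      Nx Ny N : ℕ
      Nx = proj₁ (cauchy x η η>0)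
      Ny = proj₁ (cauchy y η η>0)
      N = Nx ℕ.⊔ Ny
      far : ∃[ n ] (N ℕ.≤ n × ¬ seq x n ℚ.< seq y n ℚ.+ ε)
      far = ¬¬-elim λ ¬∃ → ¬lt λ _ → N , λ n le → ¬¬-elim λ ¬p → ¬∃ (n , le , ¬p)
      separated-at : ∀ m → N ℕ.≤ m → seq y m ℚ.+ ½ ℚ.* ε ℚ.< seq x m
      separated-at m N≤m with far
      ... | n , N≤n , ¬p = subst₂ ℚ._<_
          (solve 3 (λ a b ε → (a :+ (b :+ ε)) :+ ((:- b) :- con ½ :* ε) := a :+ con ½ :* ε) refl (seq y m) (seq y n) ε)
          (solve 4 (λ xm xn yn ε → ((yn :+ con ½ :* (con ½ :* ε)) :+ (xm :+ con ½ :* (con ½ :* ε))) :+ ((:- yn) :- con ½ :* ε) := xm)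
            refl (seq x m) (seq x n) (seq y n) ε)
          (ℚ.+-monoˡ-< (ℚ.- seq y n ℚ.- ½ ℚ.* ε)
            (ℚ.+-mono-< (∣p-q∣<ε⇒p<q+ε (seq y m) (seq y n) (proj₂ (cauchy y η η>0) m n (y≤ N≤m) (y≤ N≤n)))
              (ℚ.≤-<-trans (ℚ.≮⇒≥ ¬p)
                (∣p-q∣<ε⇒p<q+ε (seq x n) (seq x m) (proj₂ (cauchy x η η>0) n m (x≤ N≤n) (x≤ N≤m))))))
        where
        y≤ : ∀ {k} → N ℕ.≤ k → Ny ℕ.≤ k
        y≤ = ℕ.m⊔n≤o⇒n≤o Nx Ny
        x≤ : ∀ {k} → N ℕ.≤ k → Nx ℕ.≤ k
        x≤ = ℕ.m⊔n≤o⇒m≤o Nx Ny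

  ≤∨> : ∀ x y → x ≤ y ⊎ y < x
  ≤∨> x y with em {x ≤ y}
  ... | yes p = inj₁ p
  ... | no ¬p = inj₂ (≰⇒> ¬p)

  <⇒≤ : ∀ {x y} → x < y → x ≤ y
  <⇒≤ x<y = ¬¬-elim λ x≰y → <⇒≱ x<y (≤-from> (≰⇒> x≰y))
    where
    ≤-from> : ∀ {x y} → x < y → x ≤ y
    ≤-from> {x} {y} x<y@(mk< g g>0 (N , p)) = mk≤ λ ε ε>0 → N , λ n le →
      ℚ.<-trans (subst (ℚ._< seq x n ℚ.+ g) (ℚ.+-identityʳ (seq x n)) (ℚ.+-monoʳ-< (seq x n) g>0))
        (ℚ.<-trans (p n le) (subst (ℚ._< seq y n ℚ.+ ε) (ℚ.+-identityʳ (seq y n)) (ℚ.+-monoʳ-< (seq y n) ε>0)))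

  ≤-<-trans : ∀ {x y z} → x ≤ y → y < z → x < z
  ≤-<-trans x≤y y<z = ≰⇒> λ z≤x → <⇒≱ y<z (≤-trans z≤x x≤y)

  <-≤-trans : ∀ {x y z} → x < y → y ≤ z → x < z
  <-≤-trans x<y y≤z = ≰⇒> λ z≤x → <⇒≱ x<y (≤-trans y≤z z≤x)

  +-cancelʳ-≤ : ∀ {x y} z → x + z ≤ y + z → x ≤ y
  +-cancelʳ-≤ {x} {y} z le = ≤-resp (cancel x) (cancel y) (+-mono-≤ le (≤-refl {ℚ.- 1ℚ · z}))
    where
    cancel : ∀ x → x + z + ℚ.- 1ℚ · z ≈ x
    cancel x = pointwise λ n → solve 2 (λ x z → x :+ z :+ con (ℚ.- 1ℚ) :* z := x) refl (seq x n) (seq z n)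

  +-monoˡ-< : ∀ {x y} z → x < y → x + z < y + z
  +-monoˡ-< z x<y = ≰⇒> λ le → <⇒≱ x<y (+-cancelʳ-≤ z le)

  <-resp : ∀ {x x′ y y′} → x ≈ x′ → y ≈ y′ → x < y → x′ < y′
  <-resp x≈ y≈ x<y = ≤-<-trans (≈⇒≤ (≈-sym x≈)) (<-≤-trans x<y (≈⇒≤ y≈))

  -- From `N` on, the sequence stays below `p`, which exceeds its value at `N` by 1.
  integer-bound : ∀ x → ∃[ N ] (x ≤ fromℤ (+ N))
  integer-bound x = ℤ.∣ ℚ.↥ p ∣ , ≤-trans x≤p (fromℚ-mono-≤ (≤-ι∣numerator∣ p))
    where
    N : ℕ
    N = proj₁ (cauchy x 1ℚ (ℚ.positive⁻¹ 1ℚ))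
    p : ℚ
    p = seq x N ℚ.+ 1ℚ
    x≤p : x ≤ fromℚ p
    x≤p = mk≤ λ ε ε>0 → N , λ n le →
      ℚ.<-trans (∣p-q∣<ε⇒p<q+ε (seq x n) (seq x N) (proj₂ (cauchy x 1ℚ (ℚ.positive⁻¹ 1ℚ)) n N le ℕ.≤-refl))
        (subst (ℚ._< p ℚ.+ ε) (ℚ.+-identityʳ p) (ℚ.+-monoʳ-< p ε>0))

  -- Linear search upwards from `l`; `k` counts the steps that are left.
  floor-between : ∀ k x l → fromℤ l ≤ x → x < fromℤ (l ℤ.+ + k) →
                  ∃[ z ] (fromℤ z ≤ x × x < fromℤ (z ℤ.+ + 1))
  floor-between zero x l l≤x x<l = contradiction
    (subst (λ i → fromℤ i ≤ x) (sym (ℤ.+-identityʳ l)) l≤x) (<⇒≱ x<l)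
  floor-between (suc k) x l l≤x x<l+k with ≤∨> (fromℤ (l ℤ.+ + 1)) x
  ... | inj₂ x<l+1 = l , l≤x , x<l+1
  ... | inj₁ l+1≤x = floor-between k x (l ℤ.+ + 1) l+1≤x
                       (subst (λ i → x < fromℤ i) (sym (ℤ.+-assoc l (+ 1) (+ k))) x<l+k)

  floor : ∀ x → ∃[ z ] (fromℤ z ≤ x × x < fromℤ (z ℤ.+ + 1))
  -- The search runs from `- N` to `M + 1`: `x` may equal `M`, and the upper end has to be strict.
  floor x = floor-between (suc (N ℕ.+ M)) x (ℤ.- + N)
      (≤-resp (≈-sym (fromℤ-neg (+ N))) (neg-involutive x) (neg-antimono (proj₂ (integer-bound (ℚ.- 1ℚ · x)))))
      (≤-<-trans (proj₂ (integer-bound x)) (subst (λ i → fromℤ (+ M) < fromℤ i) shift M<M+1))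
    where
    M N : ℕ
    M = proj₁ (integer-bound x)
    N = proj₁ (integer-bound (ℚ.- 1ℚ · x))
    M<M+1 : fromℤ (+ M) < fromℤ (+ suc M)
    M<M+1 = ≰⇒> λ le → ℕ.1+n≰n (ℤ.drop‿+≤+ (fromℤ-cancel-≤ (+ suc M) (+ M) le))
    shift : + suc M ≡ ℤ.- + N ℤ.+ + suc (N ℕ.+ M)
    shift = sym (trans (cong (λ i → ℤ.- + N ℤ.+ + i) (sym (ℕ.+-suc N M)))
      (trans (sym (ℤ.+-assoc (ℤ.- + N) (+ N) (+ suc M)))
        (trans (cong (ℤ._+ + suc M) (ℤ.+-inverseˡ (+ N))) (ℤ.+-identityˡ (+ suc M)))))

  fractional-decomposition : ∀ x → ∃[ c ] ∃[ z ] ((0ℝ ≤ c × c < 1ℝ) × x ≈ c + fromℤ z)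
  fractional-decomposition x = x + ℚ.- 1ℚ · fromℤ z , z , (lower , upper) , ≈-sym (-+-cancel x (fromℤ z))
    where
    z : ℤ
    z = proj₁ (floor x)
    lower : 0ℝ ≤ x + ℚ.- 1ℚ · fromℤ z
    lower = ≤-resp (+-neg (fromℤ z)) ≈-refl (+-mono-≤ (proj₁ (proj₂ (floor x))) (≤-refl {ℚ.- 1ℚ · fromℤ z}))
    upper : x + ℚ.- 1ℚ · fromℤ z < 1ℝ
    upper = <-resp ≈-refl (≈-trans (+-cong {u = ℚ.- 1ℚ · fromℤ z} (fromℤ-+ z (+ 1)) ≈-refl) (+-cancel (fromℤ z) (fromℤ (+ 1))))
          (+-monoˡ-< (ℚ.- 1ℚ · fromℤ z) (proj₂ (proj₂ (floor x))))

⇔-trans : {A B C : Set} → A ⇔ B → B ⇔ C → A ⇔ C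
⇔-trans f g = mk⇔ (Equivalence.to g ∘ Equivalence.to f) (Equivalence.from f ∘ Equivalence.from g)

⇔-sym : {A B : Set} → A ⇔ B → B ⇔ A
⇔-sym f = mk⇔ (Equivalence.from f) (Equivalence.to f)

×-⇔ : {A B C D : Set} → A ⇔ B → C ⇔ D → (A × C) ⇔ (B × D)
×-⇔ f g = mk⇔ (Product.map (Equivalence.to f) (Equivalence.to g)) (Product.map (Equivalence.from f) (Equivalence.from g))

⊎-⇔ : {A B C D : Set} → A ⇔ B → C ⇔ D → (A ⊎ C) ⇔ (B ⊎ D)
⊎-⇔ f g = mk⇔ (Sum.map (Equivalence.to f) (Equivalence.to g)) (Sum.map (Equivalence.from f) (Equivalence.from g))

¬-⇔ : {A B : Set} → A ⇔ B → (¬ A) ⇔ (¬ B)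
¬-⇔ f = mk⇔ (_∘ Equivalence.from f) (_∘ Equivalence.to f)

∃-⇔ : {A : Set} {P Q : A → Set} → (∀ a → P a ⇔ Q a) → (∃[ a ] P a) ⇔ (∃[ a ] Q a)
∃-⇔ f = mk⇔ (λ (a , p) → a , Equivalence.to (f a) p) (λ (a , q) → a , Equivalence.from (f a) q)

-- Rational affine forms and their roots

module RealForms where

  open +-*-Solver using (solve; con; _:*_; _:+_; _:-_; :-_; _:=_)

  -- (a , b) stands for x ↦ a · x + b.
  ℚ-Form : ℕ → Set
  ℚ-Form n = Vector ℚ n × ℚ

  evalℝ : ∀ {n} → ℚ-Form n → Vector ℝ n → ℝ
  evalℝ (a , b) x = a ·ᵛ x + fromℚ b

  restℝ : ∀ {n} → ℚ-Form (suc n) → ℚ-Form n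
  restℝ (a , b) = tail a , b

  infixl 6 _+ᶠ_
  infixl 7 _*ᶠ_

  _+ᶠ_ : ∀ {n} → ℚ-Form n → ℚ-Form n → ℚ-Form n
  (a , b) +ᶠ (a′ , b′) = zipWith ℚ._+_ a a′ , b ℚ.+ b′

  _*ᶠ_ : ∀ {n} → ℚ → ℚ-Form n → ℚ-Form n
  r *ᶠ (a , b) = map (r ℚ.*_) a , r ℚ.* b

  constℝ : ∀ {n} → ℚ → ℚ-Form n
  constℝ r = (λ _ → 0ℚ) , r

  substℝ : ∀ {n} → ℚ-Form (suc n) → ℚ-Form n → ℚ-Form n
  substℝ f t = proj₁ f zero *ᶠ t +ᶠ restℝ f

  ·ᵛ-+ : ∀ {n} (a b : Vector ℚ n) (x : Vector ℝ n) → zipWith ℚ._+_ a b ·ᵛ x ≈ a ·ᵛ x + b ·ᵛ x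
  ·ᵛ-+ {zero}  a b x = pointwise λ _ → refl
  ·ᵛ-+ {suc n} a b x = ≈-trans (+-cong (≈-refl {(a zero ℚ.+ b zero) · x zero}) (·ᵛ-+ (tail a) (tail b) (tail x)))
    (pointwise λ k → solve 5 (λ a b x s t → (a :+ b) :* x :+ (s :+ t) := (a :* x :+ s) :+ (b :* x :+ t)) refl
      (a zero) (b zero) (seq (x zero) k) (seq (tail a ·ᵛ tail x) k) (seq (tail b ·ᵛ tail x) k))

  ·ᵛ-* : ∀ {n} r (a : Vector ℚ n) (x : Vector ℝ n) → map (r ℚ.*_) a ·ᵛ x ≈ r · (a ·ᵛ x)
  ·ᵛ-* {zero}  r a x = pointwise λ _ → sym (ℚ.*-zeroʳ r)
  ·ᵛ-* {suc n} r a x = ≈-trans (+-cong (≈-refl {(r ℚ.* a zero) · x zero}) (·ᵛ-* r (tail a) (tail x)))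
    (pointwise λ k → solve 4 (λ r a x s → r :* a :* x :+ r :* s := r :* (a :* x :+ s)) refl
      r (a zero) (seq (x zero) k) (seq (tail a ·ᵛ tail x) k))

  ·ᵛ-0 : ∀ {n} (x : Vector ℝ n) → (λ _ → 0ℚ) ·ᵛ x ≈ 0ℝ
  ·ᵛ-0 {zero}  x = ≈-refl
  ·ᵛ-0 {suc n} x = ≈-trans (+-cong (≈-refl {0ℚ · x zero}) (·ᵛ-0 (tail x)))
    (pointwise λ k → solve 1 (λ x → con 0ℚ :* x :+ con 0ℚ := con 0ℚ) refl (seq (x zero) k))

  evalℝ-+ : ∀ {n} (f g : ℚ-Form n) x → evalℝ (f +ᶠ g) x ≈ evalℝ f x + evalℝ g x
  evalℝ-+ (a , b) (a′ , b′) x = ≈-trans (+-cong (·ᵛ-+ a a′ x) (≈-refl {fromℚ (b ℚ.+ b′)}))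
    (pointwise λ k → solve 4 (λ s t b c → (s :+ t) :+ (b :+ c) := (s :+ b) :+ (t :+ c)) refl
      (seq (a ·ᵛ x) k) (seq (a′ ·ᵛ x) k) b b′)

  evalℝ-* : ∀ {n} r (f : ℚ-Form n) x → evalℝ (r *ᶠ f) x ≈ r · evalℝ f x
  evalℝ-* r (a , b) x = ≈-trans (+-cong (·ᵛ-* r a x) (≈-refl {fromℚ (r ℚ.* b)}))
    (pointwise λ k → solve 3 (λ r s b → r :* s :+ r :* b := r :* (s :+ b)) refl r (seq (a ·ᵛ x) k) b)

  evalℝ-const : ∀ {n} r (x : Vector ℝ n) → evalℝ (constℝ r) x ≈ fromℚ r
  evalℝ-const r x = ≈-trans (+-cong (·ᵛ-0 x) (≈-refl {fromℚ r})) (pointwise λ _ → ℚ.+-identityˡ r)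

  evalℝ-◂ : ∀ {n} (f : ℚ-Form (suc n)) x₀ x → evalℝ f (x₀ ◂ x) ≈ proj₁ f zero · x₀ + evalℝ (restℝ f) x
  evalℝ-◂ (a , b) x₀ x = pointwise λ k → ℚ.+-assoc (a zero ℚ.* seq x₀ k) (seq (tail a ·ᵛ x) k) b

  evalℝ-subst : ∀ {n} (f : ℚ-Form (suc n)) t x → evalℝ (substℝ f t) x ≈ evalℝ f (evalℝ t x ◂ x)
  evalℝ-subst f t x = ≈-trans (evalℝ-+ (proj₁ f zero *ᶠ t) (restℝ f) x)
    (≈-trans (+-cong (evalℝ-* (proj₁ f zero) t x) (≈-refl {evalℝ (restℝ f) x}))
      (≈-sym (evalℝ-◂ f (evalℝ t x) x)))

  average : ∀ {n} → ℚ-Form n → ℚ-Form n → ℚ-Form n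
  average f g = ½ *ᶠ (f +ᶠ g)

  evalℝ-average : ∀ {n} (f g : ℚ-Form n) x → evalℝ (average f g) x ≈ ½ · (evalℝ f x + evalℝ g x)
  evalℝ-average f g x = ≈-trans (evalℝ-* ½ (f +ᶠ g) x) (·-cong ½ (evalℝ-+ f g x))

  average-≤ : ∀ {x y z} → x ≤ z → y ≤ z → ½ · (x + y) ≤ z
  average-≤ {z = z} x≤z y≤z = ≤-trans (·-mono-≤-pos ½ (+-mono-≤ x≤z y≤z)) (≈⇒≤
    (pointwise λ k → solve 1 (λ z → con ½ :* (z :+ z) := z) refl (seq z k)))

  ≤-average : ∀ {x y z} → z ≤ x → z ≤ y → z ≤ ½ · (x + y)
  ≤-average {z = z} z≤x z≤y = ≤-trans (≈⇒≤
    (pointwise λ k → solve 1 (λ z → z := con ½ :* (z :+ z)) refl (seq z k))) (·-mono-≤-pos ½ (+-mono-≤ z≤x z≤y))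

  average-≤-left : ∀ {x y} → ½ · (x + y) ≤ x → y ≤ x
  average-≤-left {x} {y} le = ≤-resp
    (pointwise λ k → solve 2 (λ x y → (con ½ :* (x :+ y) :+ con ½ :* (x :+ y)) :+ con (ℚ.- 1ℚ) :* x := y) refl (seq x k) (seq y k))
    (pointwise λ k → solve 1 (λ x → (x :+ x) :+ con (ℚ.- 1ℚ) :* x := x) refl (seq x k))
    (+-mono-≤ (+-mono-≤ le le) (≤-refl {ℚ.- 1ℚ · x}))

  ≤-average-right : ∀ {x y} → y ≤ ½ · (x + y) → y ≤ x
  ≤-average-right {x} {y} le = ≤-resp
    (pointwise λ k → solve 1 (λ x → (x :+ x) :+ con (ℚ.- 1ℚ) :* x := x) refl (seq y k))
    (pointwise λ k → solve 2 (λ x y → (con ½ :* (x :+ y) :+ con ½ :* (x :+ y)) :+ con (ℚ.- 1ℚ) :* y := x) refl (seq x k) (seq y k))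
    (+-mono-≤ (+-mono-≤ le le) (≤-refl {ℚ.- 1ℚ · y}))

  x-y≤0⇔x≤y : ∀ x y → x + ℚ.- 1ℚ · y ≤ 0ℝ ⇔ x ≤ y
  x-y≤0⇔x≤y x y = mk⇔
    (λ le → ≤-resp (-+-cancel x y) (pointwise λ k → ℚ.+-identityˡ (seq y k)) (+-mono-≤ le (≤-refl {y})))
    (λ le → ≤-resp ≈-refl (+-neg y) (+-mono-≤ le (≤-refl {ℚ.- 1ℚ · y})))

  0≤x-y⇔y≤x : ∀ x y → 0ℝ ≤ x + ℚ.- 1ℚ · y ⇔ y ≤ x
  0≤x-y⇔y≤x x y = mk⇔
    (λ le → ≤-resp (pointwise λ k → ℚ.+-identityˡ (seq y k)) (-+-cancel x y) (+-mono-≤ le (≤-refl {y})))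
    (λ le → ≤-resp (+-neg y) ≈-refl (+-mono-≤ le (≤-refl {ℚ.- 1ℚ · y})))

  ≈⇒≤0⇔ : ∀ {x y} → x ≈ y → x ≤ 0ℝ ⇔ y ≤ 0ℝ
  ≈⇒≤0⇔ x≈y = mk⇔ (≤-trans (≈⇒≤ (≈-sym x≈y))) (≤-trans (≈⇒≤ x≈y))

  r·0 : ∀ r → r · 0ℝ ≈ 0ℝ
  r·0 r = pointwise λ _ → ℚ.*-zeroʳ r

  1/r·r· : ∀ r .{{_ : ℚ.NonZero r}} x → ℚ.1/ r · (r · x) ≈ x
  1/r·r· r x = pointwise λ k → trans (sym (ℚ.*-assoc (ℚ.1/ r) r (seq x k)))
    (trans (cong (ℚ._* seq x k) (ℚ.*-inverseˡ r)) (ℚ.*-identityˡ (seq x k)))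

  pos·x≤0 : ∀ r .{{_ : ℚ.Positive r}} x → r · x ≤ 0ℝ ⇔ x ≤ 0ℝ
  pos·x≤0 r x = mk⇔
    (λ le → ≤-resp (1/r·r· r x) (r·0 (ℚ.1/ r)) (·-mono-≤-pos (ℚ.1/ r) {{ℚ.1/pos⇒pos r}} le))
    (λ le → ≤-resp ≈-refl (r·0 r) (·-mono-≤-pos r le))
    where
    instance
      r≢0 : ℚ.NonZero r
      r≢0 = ℚ.pos⇒nonZero r

  neg·x≤0 : ∀ r .{{_ : ℚ.Negative r}} x → r · x ≤ 0ℝ ⇔ 0ℝ ≤ x
  neg·x≤0 r x = mk⇔
    (λ le → ≤-resp (r·0 (ℚ.1/ r)) (1/r·r· r x) (·-antimono-≤-neg (ℚ.1/ r) {{ℚ.1/neg⇒neg r}} le))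
    (λ le → ≤-resp ≈-refl (r·0 r) (·-antimono-≤-neg r le))
    where
    instance
      r≢0 : ℚ.NonZero r
      r≢0 = ℚ.neg⇒nonZero r

  root : ∀ {n} r .{{_ : ℚ.NonZero r}} → ℚ-Form n → ℚ-Form n
  root r f = (ℚ.- ℚ.1/ r) *ᶠ f

  rootsFrom : ∀ {n} → ℚ → ℚ-Form n → List (ℚ-Form n)
  rootsFrom (ℚ.mkℚ (+ zero) _ _)    f = []
  rootsFrom r@(ℚ.mkℚ (+ suc _) _ _) f = root r f ∷ []
  rootsFrom r@(ℚ.mkℚ -[1+ _ ] _ _)  f = root r f ∷ []

  -- 0 and 1 count as roots. They guarantee neighbours on both sides of any point of [0,1), and they
  -- confine the midpoint to the unit interval.
  roots : ∀ {n} → List (ℚ-Form (suc n)) → List (ℚ-Form n)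
  roots fs = constℝ 0ℚ ∷ constℝ 1ℚ ∷ concatMap (λ f → rootsFrom (proj₁ f zero) (restℝ f)) fs

  -- A root paired with itself gives that root, which is the test point for a variable that sits
  -- exactly on a root.
  testsℝ : ∀ {n} → List (ℚ-Form (suc n)) → List (ℚ-Form n)
  testsℝ fs = cartesianProductWith average (roots fs) (roots fs)

  r·x+f≈r·[x-root] : ∀ {n} r .{{_ : ℚ.NonZero r}} (f : ℚ-Form n) x v →
                     r · x + evalℝ f v ≈ r · (x + ℚ.- 1ℚ · evalℝ (root r f) v)
  r·x+f≈r·[x-root] r f x v = ≈-trans
    (pointwise λ k → trans (cong (r ℚ.* seq x k ℚ.+_) (sym (trans (cong (ℚ._* seq (evalℝ f v) k) (ℚ.*-inverseʳ r)) (ℚ.*-identityˡ _))))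
      (solve 4 (λ r s x f → r :* x :+ (r :* s) :* f := r :* (x :+ con (ℚ.- 1ℚ) :* ((:- s) :* f))) refl
        r (ℚ.1/ r) (seq x k) (seq (evalℝ f v) k)))
    (·-cong r (+-cong (≈-refl {x}) (·-cong (ℚ.- 1ℚ) (≈-sym (evalℝ-* (ℚ.- ℚ.1/ r) f v)))))

  -- Both comparisons are recorded because the sign of the leading coefficient decides which of them
  -- an inequality becomes.
  SameSide : ℝ → ℝ → ℝ → Set
  SameSide x y ρ = (x ≤ ρ ⇔ y ≤ ρ) × (ρ ≤ x ⇔ ρ ≤ y)

  sameSide⇒≤0⇔ : ∀ {n} r (f : ℚ-Form n) x y v → All (λ ρ → SameSide x y (evalℝ ρ v)) (rootsFrom r f) →
                  r · x + evalℝ f v ≤ 0ℝ ⇔ r · y + evalℝ f v ≤ 0ℝ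
  sameSide⇒≤0⇔ r@(ℚ.mkℚ (+ zero) _ _) f x y v _ = ≈⇒≤0⇔ (+-cong (≈-trans (vanishes x) (≈-sym (vanishes y))) (≈-refl {evalℝ f v}))
    where
    vanishes : ∀ x → r · x ≈ 0ℝ
    vanishes x = pointwise λ k → trans (cong (ℚ._* seq x k) (ℚ.↥p≡0⇒p≡0 r refl)) (ℚ.*-zeroˡ (seq x k))
  sameSide⇒≤0⇔ r@(ℚ.mkℚ (+ suc _) _ _) f x y v ((same , _) ∷ _) = ⇔-trans (side x) (⇔-trans same (⇔-sym (side y)))
    where
    side : ∀ x → r · x + evalℝ f v ≤ 0ℝ ⇔ x ≤ evalℝ (root r f) v
    side x = ⇔-trans (≈⇒≤0⇔ (r·x+f≈r·[x-root] r f x v)) (⇔-trans (pos·x≤0 r _) (x-y≤0⇔x≤y _ _))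
  sameSide⇒≤0⇔ r@(ℚ.mkℚ -[1+ _ ] _ _) f x y v ((_ , same) ∷ _) = ⇔-trans (side x) (⇔-trans same (⇔-sym (side y)))
    where
    side : ∀ x → r · x + evalℝ f v ≤ 0ℝ ⇔ evalℝ (root r f) v ≤ x
    side x = ⇔-trans (≈⇒≤0⇔ (r·x+f≈r·[x-root] r f x v)) (⇔-trans (neg·x≤0 r _) (0≤x-y⇔y≤x _ _))

open RealForms public

-- Moving a fractional part to a test point

module RealSelection (em : ExcludedMiddle 0ℓ) where

  open ClassicalOrder em

  total⇒reflexive : {X : Set} {_≲_ : X → X → Set} → Total _≲_ → ∀ x → x ≲ x
  total⇒reflexive total x with total x x
  ... | inj₁ p = p
  ... | inj₂ p = p

  -- Serves twice: for the greatest root below the point and, with the order reversed, for the least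
  -- root above it.
  best : {X : Set} (P : X → Set) (_≲_ : X → X → Set) → Total _≲_ → Transitive _≲_ → ∀ {xs} → Any P xs →
         ∃[ m ] (m ∈ xs × P m × (∀ {x} → x ∈ xs → P x → x ≲ m))
  best P _≲_ total trans′ {x ∷ xs} any with em {Any P xs}
  best P _≲_ total trans′ {x ∷ xs} (there any) | no none = contradiction any none
  best P _≲_ total trans′ {x ∷ xs} (here px) | no none = x , here refl , px , λ where
    (here refl) _ → total⇒reflexive total x
    (there y∈) py → contradiction (lose y∈ py) none
  best P _≲_ total trans′ {x ∷ xs} _ | yes any with best P _≲_ total trans′ any | em {P x}
  ... | m , m∈ , pm , max | no ¬px = m , there m∈ , pm , λ where
    (here refl) px → contradiction px ¬px
    (there y∈) py → max y∈ py
  ... | m , m∈ , pm , max | yes px with total x m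
  ...   | inj₁ x≲m = m , there m∈ , pm , λ where
    (here refl) _ → x≲m
    (there y∈) py → max y∈ py
  ...   | inj₂ m≲x = x , here refl , px , λ where
    (here refl) _ → total⇒reflexive total x
    (there y∈) py → trans′ (max y∈ py) m≲x

  ≤-total : Total _≤_
  ≤-total x y with ≤∨> x y
  ... | inj₁ x≤y = inj₁ x≤y
  ... | inj₂ y<x = inj₂ (<⇒≤ y<x)

  -- The last two hypotheses say that no `ρ` lies strictly between the neighbours `l` and `u`. If
  -- `ρ` seems to separate `d` from the midpoint, then `u ≤ l` follows, so `l`, `d`, `u` and the
  -- midpoint coincide.
  average-sameSide : ∀ {l u d ρ} → l ≤ d → d ≤ u → (ρ ≤ d → ρ ≤ l) → (d ≤ ρ → u ≤ ρ) →
                     SameSide d (½ · (l + u)) ρ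
  average-sameSide {l} {u} {d} {ρ} l≤d d≤u below above =
      mk⇔ (λ d≤ρ → average-≤ (≤-trans l≤d d≤ρ) (above d≤ρ)) left
    , mk⇔ (λ ρ≤d → ≤-average (below ρ≤d) (≤-trans ρ≤d d≤u)) right
    where
    left : ½ · (l + u) ≤ ρ → d ≤ ρ
    left m≤ρ with ≤-total d ρ
    ... | inj₁ d≤ρ = d≤ρ
    ... | inj₂ ρ≤d = ≤-trans (≤-trans d≤u (≤-average u≤l ≤-refl)) m≤ρ
      where
      u≤l : u ≤ l
      u≤l = average-≤-left (≤-trans m≤ρ (below ρ≤d))
    right : ρ ≤ ½ · (l + u) → ρ ≤ d
    right ρ≤m with ≤-total d ρ
    ... | inj₂ ρ≤d = ρ≤d
    ... | inj₁ d≤ρ = ≤-trans ρ≤m (≤-trans (average-≤ ≤-refl u≤l) l≤d)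
      where
      u≤l : u ≤ l
      u≤l = ≤-average-right (≤-trans (above d≤ρ) ρ≤m)

  selectℝ : ∀ {n} (fs : List (ℚ-Form (suc n))) v d → 0ℝ ≤ d → d < 1ℝ →
            ∃[ t ] (t ∈ testsℝ fs × 0ℝ ≤ evalℝ t v × evalℝ t v < 1ℝ ×
                    All (λ f → evalℝ f (d ◂ v) ≤ 0ℝ ⇔ evalℝ f (evalℝ t v ◂ v) ≤ 0ℝ) fs)
  selectℝ fs v d 0≤d d<1 =
      average l u
    , ∈-cartesianProductWith⁺ average l∈ u∈
    , ≤-trans (≤-average 0≤l (≤-trans 0≤l (≤-trans l≤d d≤u))) (≈⇒≤ (≈-sym avg≈))
    , ≤-<-trans (≈⇒≤ avg≈) avg<1
    , All.tabulate λ {f} f∈ → ⇔-trans (≈⇒≤0⇔ (evalℝ-◂ f d v)) (⇔-trans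
        (sameSide⇒≤0⇔ (proj₁ f zero) (restℝ f) d (evalℝ (average l u) v) v (All.tabulate λ {ρ} ρ∈ →
          sameSide-≈ (average-sameSide l≤d d≤u (below (root∈ f∈ ρ∈)) (above (root∈ f∈ ρ∈)))))
        (≈⇒≤0⇔ (≈-sym (evalℝ-◂ f (evalℝ (average l u) v) v))))
    where
    R : List (ℚ-Form _)
    R = roots fs
    value : ℚ-Form _ → ℝ
    value f = evalℝ f v
    lower : ∃[ l ] (l ∈ R × value l ≤ d × (∀ {ρ} → ρ ∈ R → value ρ ≤ d → value ρ ≤ value l))
    lower = best (λ f → value f ≤ d) (λ f g → value f ≤ value g) (λ f g → ≤-total (value f) (value g)) ≤-trans
      (here (≤-trans (≈⇒≤ (evalℝ-const 0ℚ v)) 0≤d))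
    upper : ∃[ u ] (u ∈ R × d ≤ value u × (∀ {ρ} → ρ ∈ R → d ≤ value ρ → value u ≤ value ρ))
    upper = best (λ f → d ≤ value f) (λ f g → value g ≤ value f) (λ f g → ≤-total (value g) (value f)) (flip ≤-trans)
      (there (here (≤-trans (<⇒≤ d<1) (≈⇒≤ (≈-sym (evalℝ-const 1ℚ v))))))
    l u : ℚ-Form _
    l = proj₁ lower
    u = proj₁ upper
    l∈ : l ∈ R
    l∈ = proj₁ (proj₂ lower)
    u∈ : u ∈ R
    u∈ = proj₁ (proj₂ upper)
    l≤d : value l ≤ d
    l≤d = proj₁ (proj₂ (proj₂ lower))
    d≤u : d ≤ value u
    d≤u = proj₁ (proj₂ (proj₂ upper))
    below : ∀ {ρ} → ρ ∈ R → value ρ ≤ d → value ρ ≤ value l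
    below = proj₂ (proj₂ (proj₂ lower))
    above : ∀ {ρ} → ρ ∈ R → d ≤ value ρ → value u ≤ value ρ
    above = proj₂ (proj₂ (proj₂ upper))
    avg≈ : value (average l u) ≈ ½ · (value l + value u)
    avg≈ = evalℝ-average l u v
    0≤l : 0ℝ ≤ value l
    0≤l = ≤-trans (≈⇒≤ (≈-sym (evalℝ-const 0ℚ v))) (below (here refl) (≤-trans (≈⇒≤ (evalℝ-const 0ℚ v)) 0≤d))
    u≤1 : value u ≤ 1ℝ
    u≤1 = ≤-trans (above (there (here refl)) (≤-trans (<⇒≤ d<1) (≈⇒≤ (≈-sym (evalℝ-const 1ℚ v))))) (≈⇒≤ (evalℝ-const 1ℚ v))
    -- The upper neighbour may be 1 itself. An average of at least 1 would then force `u ≤ l`, hence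
    -- 1 ≤ l ≤ d, against `d < 1`.
    avg<1 : ½ · (value l + value u) < 1ℝ
    avg<1 = ≰⇒> λ 1≤avg → <⇒≱ (≤-<-trans l≤d d<1)
      (≤-trans 1≤avg (average-≤ ≤-refl (≤-average-right (≤-trans u≤1 1≤avg))))
    root∈ : ∀ {f ρ} → f ∈ fs → ρ ∈ rootsFrom (proj₁ f zero) (restℝ f) → ρ ∈ R
    root∈ f∈ ρ∈ = there (there (∈-concatMap⁺ (λ f → rootsFrom (proj₁ f zero) (restℝ f)) (lose f∈ ρ∈)))
    sameSide-≈ : ∀ {ρ} → SameSide d (½ · (value l + value u)) ρ → SameSide d (value (average l u)) ρ
    sameSide-≈ (same , same′) =
        ⇔-trans same (mk⇔ (≤-trans (≈⇒≤ avg≈)) (≤-trans (≈⇒≤ (≈-sym avg≈))))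
      , ⇔-trans same′ (mk⇔ (λ le → ≤-trans le (≈⇒≤ (≈-sym avg≈))) (λ le → ≤-trans le (≈⇒≤ avg≈)))

-- Integer affine forms and the values tested for an integer variable

module IntegerForms where

  ℤ-Form : ℕ → Set
  ℤ-Form n = Vector ℤ n × ℤ

  dot : ∀ {n} → Vector ℤ n → Vector ℤ n → ℤ
  dot {zero}  a z = + 0
  dot {suc n} a z = a zero ℤ.* z zero ℤ.+ dot (tail a) (tail z)

  evalℤ : ∀ {n} → ℤ-Form n → Vector ℤ n → ℤ
  evalℤ (a , b) z = dot a z ℤ.+ b

  restℤ : ∀ {n} → ℤ-Form (suc n) → ℤ-Form n
  restℤ (a , b) = tail a , b

  infixl 6 _+ᶻ_
  infixl 7 _*ᶻ_

  _+ᶻ_ : ∀ {n} → ℤ-Form n → ℤ-Form n → ℤ-Form n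
  (a , b) +ᶻ (a′ , b′) = zipWith ℤ._+_ a a′ , b ℤ.+ b′

  _*ᶻ_ : ∀ {n} → ℤ → ℤ-Form n → ℤ-Form n
  r *ᶻ (a , b) = map (r ℤ.*_) a , r ℤ.* b

  constℤ : ∀ {n} → ℤ → ℤ-Form n
  constℤ r = (λ _ → + 0) , r

  -- The substitution w ↦ τ / (1 + k), multiplied by the denominator.
  substℤ : ∀ {n} → ℤ-Form (suc n) → ℤ-Form n → ℕ → ℤ-Form n
  substℤ f τ k = proj₁ f zero *ᶻ τ +ᶻ + suc k *ᶻ restℤ f

  dot-cong : ∀ {n} (a : Vector ℤ n) {x y : Vector ℤ n} → (∀ i → x i ≡ y i) → dot a x ≡ dot a y
  dot-cong {zero}  a x≡y = refl
  dot-cong {suc n} a x≡y = cong₂ (λ s t → a zero ℤ.* s ℤ.+ t) (x≡y zero) (dot-cong (tail a) (x≡y ∘ suc))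

  dot-+ : ∀ {n} (a b x : Vector ℤ n) → dot (zipWith ℤ._+_ a b) x ≡ dot a x ℤ.+ dot b x
  dot-+ {zero}  a b x = refl
  dot-+ {suc n} a b x = trans (cong (λ s → (a zero ℤ.+ b zero) ℤ.* x zero ℤ.+ s) (dot-+ (tail a) (tail b) (tail x)))
    (regroup (a zero) (b zero) (x zero) (dot (tail a) (tail x)) (dot (tail b) (tail x)))
    where
    regroup : ∀ a b x s t → (a ℤ.+ b) ℤ.* x ℤ.+ (s ℤ.+ t) ≡ (a ℤ.* x ℤ.+ s) ℤ.+ (b ℤ.* x ℤ.+ t)
    regroup = ℤ-ring

  dot-* : ∀ {n} r (a x : Vector ℤ n) → dot (map (r ℤ.*_) a) x ≡ r ℤ.* dot a x
  dot-* {zero}  r a x = sym (ℤ.*-zeroʳ r)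
  dot-* {suc n} r a x = trans (cong (λ s → r ℤ.* a zero ℤ.* x zero ℤ.+ s) (dot-* r (tail a) (tail x)))
    (regroup r (a zero) (x zero) (dot (tail a) (tail x)))
    where
    regroup : ∀ r a x s → r ℤ.* a ℤ.* x ℤ.+ r ℤ.* s ≡ r ℤ.* (a ℤ.* x ℤ.+ s)
    regroup = ℤ-ring

  dot-+ʳ : ∀ {n} (a x y : Vector ℤ n) → dot a (zipWith ℤ._+_ x y) ≡ dot a x ℤ.+ dot a y
  dot-+ʳ {zero}  a x y = refl
  dot-+ʳ {suc n} a x y = trans (cong (λ s → a zero ℤ.* (x zero ℤ.+ y zero) ℤ.+ s) (dot-+ʳ (tail a) (tail x) (tail y)))
    (regroup (a zero) (x zero) (y zero) (dot (tail a) (tail x)) (dot (tail a) (tail y)))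
    where
    regroup : ∀ a x y s t → a ℤ.* (x ℤ.+ y) ℤ.+ (s ℤ.+ t) ≡ (a ℤ.* x ℤ.+ s) ℤ.+ (a ℤ.* y ℤ.+ t)
    regroup = ℤ-ring

  dot-0 : ∀ {n} (x : Vector ℤ n) → dot (λ _ → + 0) x ≡ + 0
  dot-0 {zero}  x = refl
  dot-0 {suc n} x = cong₂ ℤ._+_ (ℤ.*-zeroˡ (x zero)) (dot-0 (tail x))

  evalℤ-+ : ∀ {n} (f g : ℤ-Form n) x → evalℤ (f +ᶻ g) x ≡ evalℤ f x ℤ.+ evalℤ g x
  evalℤ-+ (a , b) (a′ , b′) x = trans (cong (ℤ._+ (b ℤ.+ b′)) (dot-+ a a′ x)) (regroup (dot a x) (dot a′ x) b b′)
    where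
    regroup : ∀ s t b c → (s ℤ.+ t) ℤ.+ (b ℤ.+ c) ≡ (s ℤ.+ b) ℤ.+ (t ℤ.+ c)
    regroup = ℤ-ring

  evalℤ-* : ∀ {n} r (f : ℤ-Form n) x → evalℤ (r *ᶻ f) x ≡ r ℤ.* evalℤ f x
  evalℤ-* r (a , b) x = trans (cong (ℤ._+ r ℤ.* b) (dot-* r a x)) (sym (ℤ.*-distribˡ-+ r (dot a x) b))

  evalℤ-const : ∀ {n} r (x : Vector ℤ n) → evalℤ (constℤ r) x ≡ r
  evalℤ-const r x = trans (cong (ℤ._+ r) (dot-0 x)) (ℤ.+-identityˡ r)

  evalℤ-◂ : ∀ {n} (f : ℤ-Form (suc n)) w z → evalℤ f (w ◂ z) ≡ proj₁ f zero ℤ.* w ℤ.+ evalℤ (restℤ f) z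
  evalℤ-◂ (a , b) w z = ℤ.+-assoc (a zero ℤ.* w) (dot (tail a) z) b

  evalℤ-subst : ∀ {n} (f : ℤ-Form (suc n)) τ k w z → + suc k ℤ.* w ≡ evalℤ τ z →
                evalℤ (substℤ f τ k) z ≡ + suc k ℤ.* evalℤ f (w ◂ z)
  evalℤ-subst f τ k w z kw≡τ = trans (evalℤ-+ (proj₁ f zero *ᶻ τ) (+ suc k *ᶻ restℤ f) z)
    (trans (cong₂ ℤ._+_ (trans (evalℤ-* (proj₁ f zero) τ z) (cong (proj₁ f zero ℤ.*_) (sym kw≡τ)))
                        (evalℤ-* (+ suc k) (restℤ f) z))
    (trans (regroup (proj₁ f zero) (+ suc k) w (evalℤ (restℤ f) z)) (cong (+ suc k ℤ.*_) (sym (evalℤ-◂ f w z)))))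
    where
    regroup : ∀ a k w s → a ℤ.* (k ℤ.* w) ℤ.+ k ℤ.* s ≡ k ℤ.* (a ℤ.* w ℤ.+ s)
    regroup = ℤ-ring

  interval : ℕ → List ℤ
  interval B = List.map (λ i → + i) (List.upTo (suc B)) ++ List.map (λ i → ℤ.- + i) (List.upTo (suc B))

  ∈-interval : ∀ {B} s → ℤ.∣ s ∣ ℕ.≤ B → s ∈ interval B
  ∈-interval (+ n) n≤B = ∈-++⁺ˡ (∈-map⁺ (λ i → + i) (∈-upTo⁺ (ℕ.s≤s n≤B)))
  ∈-interval {B} -[1+ n ] n≤B = ∈-++⁺ʳ (List.map (λ i → + i) (List.upTo (suc B))) (∈-map⁺ (λ i → ℤ.- + i) (∈-upTo⁺ (ℕ.s≤s n≤B)))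

  -- A value s of `a w + f` determines w: `∣ a ∣ w` is `s - f` for positive `a` and `f - s` for
  -- negative `a`. All s with absolute value at most `∣ a ∣ N` are listed, and the pair `(τ , k)`
  -- encodes w = τ / (1 + k).
  testsFrom : ∀ {n} → ℕ → ℤ → ℤ-Form n → List (ℤ-Form n × ℕ)
  testsFrom N (+ zero)  f = []
  testsFrom N (+ suc k) f = List.map (λ s → constℤ s +ᶻ ℤ.- + 1 *ᶻ f , k) (interval (suc k ℕ.* N))
  testsFrom N -[1+ k ]  f = List.map (λ s → f +ᶻ constℤ (ℤ.- s) , k) (interval (suc k ℕ.* N))

  -- The form w itself is put in front, so that the descent towards 0 ends in a tested value even if
  -- no form of `fs` contains w.
  testsℤ : ∀ {n} → ℕ → List (ℤ-Form (suc n)) → List (ℤ-Form n × ℕ)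
  testsℤ N fs = concatMap (λ f → testsFrom N (proj₁ f zero) (restℤ f)) (((+ 1) ◂ (λ _ → + 0) , + 0) ∷ fs)

  testsFrom-complete : ∀ {n} N a (f : ℤ-Form n) z w → a ≢ + 0 →
                       ℤ.∣ a ℤ.* w ℤ.+ evalℤ f z ∣ ℕ.≤ ℤ.∣ a ∣ ℕ.* N →
                       Any (λ (τ , k) → + suc k ℤ.* w ≡ evalℤ τ z) (testsFrom N a f)
  testsFrom-complete N (+ zero) f z w a≢0 _ = contradiction refl a≢0
  testsFrom-complete N (+ suc k) f z w _ bound =
    lose (∈-map⁺ (λ s → constℤ s +ᶻ ℤ.- + 1 *ᶻ f , k) (∈-interval (+ suc k ℤ.* w ℤ.+ evalℤ f z) bound))
      (sym (trans (evalℤ-+ (constℤ (+ suc k ℤ.* w ℤ.+ evalℤ f z)) (ℤ.- + 1 *ᶻ f) z)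
      (trans (cong₂ ℤ._+_ (evalℤ-const (+ suc k ℤ.* w ℤ.+ evalℤ f z) z) (evalℤ-* (ℤ.- + 1) f z)) (regroup (+ suc k ℤ.* w) (evalℤ f z)))))
    where
    regroup : ∀ x f → x ℤ.+ f ℤ.+ ℤ.- + 1 ℤ.* f ≡ x
    regroup = ℤ-ring
  testsFrom-complete N -[1+ k ] f z w _ bound =
    lose (∈-map⁺ (λ s → f +ᶻ constℤ (ℤ.- s) , k) (∈-interval (-[1+ k ] ℤ.* w ℤ.+ evalℤ f z) bound))
      (sym (trans (evalℤ-+ f (constℤ (ℤ.- (-[1+ k ] ℤ.* w ℤ.+ evalℤ f z))) z)
      (trans (cong (λ s → evalℤ f z ℤ.+ s) (evalℤ-const (ℤ.- (-[1+ k ] ℤ.* w ℤ.+ evalℤ f z)) z)) (regroup (+ suc k) w (evalℤ f z)))))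
    where
    regroup : ∀ k w f → f ℤ.+ ℤ.- (ℤ.- k ℤ.* w ℤ.+ f) ≡ k ℤ.* w
    regroup = ℤ-ring

  small-shift : ∀ x y → ℤ.∣ y ∣ ℕ.< ℤ.∣ x ∣ → x ℤ.≤ + 0 ⇔ x ℤ.+ y ℤ.≤ + 0
  small-shift (+ zero) y ()
  small-shift (+ suc m) y y<x = mk⇔ (λ { (ℤ.+≤+ ()) }) (λ le → contradiction le (ℤ.<⇒≱ (positive y y<x)))
    where
    positive : ∀ y → ℤ.∣ y ∣ ℕ.< suc m → + 0 ℤ.< + suc m ℤ.+ y
    positive (+ n) _ = ℤ.+<+ (ℕ.s≤s ℕ.z≤n)
    positive -[1+ n ] (ℕ.s≤s n<m) = subst (+ 0 ℤ.<_) (sym (ℤ.⊖-≥ (ℕ.s≤s (ℕ.<⇒≤ n<m)))) (ℤ.+<+ (ℕ.m<n⇒0<n∸m n<m))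
  small-shift -[1+ m ] y y<x = mk⇔ (λ _ → negative y y<x) (λ _ → ℤ.-≤+)
    where
    negative : ∀ y → ℤ.∣ y ∣ ℕ.< suc m → -[1+ m ] ℤ.+ y ℤ.≤ + 0
    negative (+ n) (ℕ.s≤s n≤m) = subst (ℤ._≤ + 0) (sym (ℤ.⊖-≤ (ℕ.m≤n⇒m≤1+n n≤m))) ℤ.neg-≤-pos
    negative -[1+ n ] _ = ℤ.-≤+

  -- The step has length exactly `N`, against the sign of `w`; as `∣ w ∣` exceeds `N`, it does not
  -- reach 0.
  towardsZero : ∀ N w → suc N ℕ.≤ ℤ.∣ w ∣ → ∃[ δ ] (ℤ.∣ δ ∣ ≡ N × ℤ.∣ w ℤ.+ δ ∣ ≡ ℤ.∣ w ∣ ℕ.∸ N)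
  towardsZero N (+ m) N<m = ℤ.- + N , ℤ.∣-i∣≡∣i∣ (+ N) ,
    trans (cong ℤ.∣_∣ (ℤ.m-n≡m⊖n m N)) (cong ℤ.∣_∣ (ℤ.⊖-≥ (ℕ.<⇒≤ N<m)))
  towardsZero N -[1+ m ] N<m = + N , refl , ℤ.∣⊖∣-≤ (ℕ.<⇒≤ N<m)

open IntegerForms public

-- Moving an integer to a test point

module IntegerSelection (em : ExcludedMiddle 0ℓ) where

  Selected : ∀ {n} → ℕ → List (ℤ-Form (suc n)) → Vector ℤ n → ℤ → Set
  Selected {n} N fs z w = ∃[ w′ ] (
    Any (λ (τ , k) → + suc k ℤ.* w′ ≡ evalℤ τ z) (testsℤ N fs) ×
    (+ N ∣ w ℤ.- w′) ×
    All (λ f → evalℤ f (w ◂ z) ℤ.≤ + 0 ⇔ evalℤ f (w′ ◂ z) ℤ.≤ + 0) fs)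

  module _ {n} (N : ℕ) .{{_ : ℕ.NonZero N}} (fs : List (ℤ-Form (suc n))) (z : Vector ℤ n) where

    -- As long as no form of fs, nor w itself, is this close to 0, a step of length N changes no sign.
    Close : ℤ → ℤ-Form (suc n) → Set
    Close w f = proj₁ f zero ≢ + 0 ×
      ℤ.∣ proj₁ f zero ℤ.* w ℤ.+ evalℤ (restℤ f) z ∣ ℕ.≤ ℤ.∣ proj₁ f zero ∣ ℕ.* N

    identityForm : ℤ-Form (suc n)
    identityForm = (+ 1) ◂ (λ _ → + 0) , + 0

    shift-argument : ∀ a w δ s → a ℤ.* (w ℤ.+ δ) ℤ.+ s ≡ (a ℤ.* w ℤ.+ s) ℤ.+ a ℤ.* δ
    shift-argument = ℤ-ring

    shift-sign : ∀ w δ f → ℤ.∣ δ ∣ ≡ N → ¬ Close w f →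
                 evalℤ f (w ◂ z) ℤ.≤ + 0 ⇔ evalℤ f (w ℤ.+ δ ◂ z) ℤ.≤ + 0
    shift-sign w δ f ∣δ∣≡N ¬close rewrite evalℤ-◂ f w z | evalℤ-◂ f (w ℤ.+ δ) z
      | shift-argument (proj₁ f zero) w δ (evalℤ (restℤ f) z) with proj₁ f zero ℤ.≟ + 0
    ... | yes a≡0 rewrite a≡0 | ℤ.+-identityʳ (+ 0 ℤ.+ evalℤ (restℤ f) z) = mk⇔ (λ p → p) (λ p → p)
    ... | no a≢0 = small-shift _ _ (subst (ℕ._< _)
        (sym (trans (ℤ.abs-* (proj₁ f zero) δ) (cong (ℤ.∣ proj₁ f zero ∣ ℕ.*_) ∣δ∣≡N)))
        (ℕ.≰⇒> λ le → ¬close (a≢0 , le)))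

    +N∣ : ∀ δ → ℤ.∣ δ ∣ ≡ N → + N ∣ δ
    +N∣ δ ∣δ∣≡N = subst (λ m → + m ∣ δ) ∣δ∣≡N ∣.∣m∣∣m

    close⇒tested : ∀ {w gs} → Any (Close w) gs →
                   Any (λ (τ , k) → + suc k ℤ.* w ≡ evalℤ τ z) (concatMap (λ f → testsFrom N (proj₁ f zero) (restℤ f)) gs)
    close⇒tested {w} = Any.concatMap⁺ (λ f → testsFrom N (proj₁ f zero) (restℤ f))
      ∘ Any.map λ {f} (a≢0 , bound) → testsFrom-complete N (proj₁ f zero) (restℤ f) z w a≢0 bound

    ¬close⇒large : ∀ w → ¬ Close w identityForm → suc N ℕ.≤ ℤ.∣ w ∣
    ¬close⇒large w ¬close = ℕ.≰⇒> λ ∣w∣≤N → ¬close ((λ ()) , subst₂ ℕ._≤_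
        (cong ℤ.∣_∣ (sym (trans (cong₂ ℤ._+_ (ℤ.*-identityˡ w) (evalℤ-const (+ 0) z)) (ℤ.+-identityʳ w))))
        (sym (ℕ.*-identityˡ N)) ∣w∣≤N)

    -- Either some form is close to 0 at `w`, and then `w` is a tested value, or a step of length
    -- `N` towards 0 keeps all signs and the residue modulo `N`. Since `N` is nonzero, `∣ w ∣`
    -- decreases.
    descend : ∀ w → Acc ℕ._<_ ℤ.∣ w ∣ → Selected N fs z w
    descend w (acc smaller) with em {Any (Close w) (identityForm ∷ fs)}
    ... | yes close = w , close⇒tested close , divides (+ 0) (ℤ.+-inverseʳ w) , All.tabulate (λ _ → mk⇔ (λ p → p) (λ p → p))
    ... | no ¬close with towardsZero N w (¬close⇒large w (¬close ∘ here))
    ...   | δ , ∣δ∣≡N , ∣w+δ∣≡ with descend (w ℤ.+ δ) (smaller (subst (ℕ._< ℤ.∣ w ∣) (sym ∣w+δ∣≡)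
              (ℕ.∸-monoʳ-< (ℕ.>-nonZero⁻¹ N) (ℕ.<⇒≤ (¬close⇒large w (¬close ∘ here))))))
    ...     | w′ , tested , N∣ , same = w′ , tested
              , subst (+ N ∣_) (regroup w δ w′) (∣.∣m∣n⇒∣m-n N∣ (+N∣ δ ∣δ∣≡N))
              , All.tabulate λ {f} f∈ → ⇔-trans (shift-sign w δ f ∣δ∣≡N (λ close → ¬close (there (lose f∈ close))))
                  (All.lookup same f∈)
      where
      regroup : ∀ w δ w′ → w ℤ.+ δ ℤ.- w′ ℤ.- δ ≡ w ℤ.- w′
      regroup = ℤ-ring

  selectℤ : ∀ {n} N .{{_ : ℕ.NonZero N}} (fs : List (ℤ-Form (suc n))) z w → Selected N fs z w
  selectℤ N fs z w = descend N fs z w (<-wellFounded ℤ.∣ w ∣)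

-- Quantifier-free formulas with separated variables, and elimination

module QuantifierFree where

  infixr 4 _∧ᵠ_

  -- Formulas about a point c ⊕ z, in which the fractional parts c and the integer parts z
  -- occur in separate atoms.  The modulus of dividesᵠ d is 1 + d.
  data QF (n : ℕ) : Set where
    realᵠ    : ℚ-Form n → QF n
    intᵠ     : ℤ-Form n → QF n
    dividesᵠ : ℕ → ℤ-Form n → QF n
    _∧ᵠ_     : QF n → QF n → QF n
    ¬ᵠ_      : QF n → QF n

  Sat : ∀ {n} → Vector ℝ n → Vector ℤ n → QF n → Set
  Sat c z (realᵠ f)      = evalℝ f c ≤ 0ℝ
  Sat c z (intᵠ f)       = evalℤ f z ℤ.≤ + 0
  Sat c z (dividesᵠ d f) = + suc d ∣ evalℤ f z
  Sat c z (φ ∧ᵠ ψ)       = Sat c z φ × Sat c z ψ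
  Sat c z (¬ᵠ φ)         = ¬ Sat c z φ

  realForms : ∀ {n} → QF n → List (ℚ-Form n)
  realForms (realᵠ f)      = f ∷ []
  realForms (intᵠ f)       = []
  realForms (dividesᵠ d f) = []
  realForms (φ ∧ᵠ ψ)       = realForms φ ++ realForms ψ
  realForms (¬ᵠ φ)         = realForms φ

  intForms : ∀ {n} → QF n → List (ℤ-Form n)
  intForms (realᵠ f)      = []
  intForms (intᵠ f)       = f ∷ []
  intForms (dividesᵠ d f) = []
  intForms (φ ∧ᵠ ψ)       = intForms φ ++ intForms ψ
  intForms (¬ᵠ φ)         = intForms φ

  -- A common multiple of the moduli; a product is simpler to handle than the least one.
  modulus : ∀ {n} → QF n → ℕ
  modulus (realᵠ f)      = 1
  modulus (intᵠ f)       = 1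
  modulus (dividesᵠ d f) = suc d
  modulus (φ ∧ᵠ ψ)       = modulus φ ℕ.* modulus ψ
  modulus (¬ᵠ φ)         = modulus φ

  modulus≢0 : ∀ {n} (φ : QF n) → ℕ.NonZero (modulus φ)
  modulus≢0 (realᵠ f)      = _
  modulus≢0 (intᵠ f)       = _
  modulus≢0 (dividesᵠ d f) = _
  modulus≢0 (φ ∧ᵠ ψ)       = ℕ.m*n≢0 (modulus φ) (modulus ψ) {{modulus≢0 φ}} {{modulus≢0 ψ}}
  modulus≢0 (¬ᵠ φ)         = modulus≢0 φ

  ∣dot-dot : ∀ {n k} (a x y : Vector ℤ n) → (∀ i → k ∣ x i ℤ.- y i) → k ∣ dot a x ℤ.- dot a y
  ∣dot-dot {zero}  a x y k∣ = divides (+ 0) refl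
  ∣dot-dot {suc n} {k} a x y k∣ = subst (k ∣_) (regroup (a zero) (x zero) (y zero) _ _)
    (∣.∣m∣n⇒∣m+n (∣.∣n⇒∣m*n (a zero) (k∣ zero)) (∣dot-dot (tail a) (tail x) (tail y) (k∣ ∘ suc)))
    where
    regroup : ∀ a x y s t → a ℤ.* (x ℤ.- y) ℤ.+ (s ℤ.- t) ≡ a ℤ.* x ℤ.+ s ℤ.- (a ℤ.* y ℤ.+ t)
    regroup = ℤ-ring

  ∣evalℤ : ∀ {n k} (f : ℤ-Form n) {x y} → (∀ i → k ∣ x i ℤ.- y i) → k ∣ evalℤ f x ⇔ k ∣ evalℤ f y
  ∣evalℤ {k = k} (a , b) {x} {y} k∣ = mk⇔
    (λ p → subst (k ∣_) (regroup (dot a x) (dot a y) b) (∣.∣m∣n⇒∣m-n p (∣dot-dot a x y k∣)))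
    (λ p → subst (k ∣_) (regroup′ (dot a x) (dot a y) b) (∣.∣m∣n⇒∣m+n p (∣dot-dot a x y k∣)))
    where
    regroup : ∀ s t b → s ℤ.+ b ℤ.- (s ℤ.- t) ≡ t ℤ.+ b
    regroup = ℤ-ring
    regroup′ : ∀ s t b → t ℤ.+ b ℤ.+ (s ℤ.- t) ≡ s ℤ.+ b
    regroup′ = ℤ-ring

  m∣+m*n : ∀ m n → + m ∣ + (m ℕ.* n)
  m∣+m*n m n = divides (+ n) (trans (cong +_ (ℕ.*-comm m n)) (ℤ.pos-* n m))

  n∣+m*n : ∀ m n → + n ∣ + (m ℕ.* n)
  n∣+m*n m n = divides (+ m) (ℤ.pos-* m n)

  -- Truth depends only on the signs of the forms and on the residues of the integer parts, the data
  -- that the two selections preserve.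
  Sat-invariant : ∀ {n} (φ : QF n) {c c′ z z′} →
    All (λ f → evalℝ f c ≤ 0ℝ ⇔ evalℝ f c′ ≤ 0ℝ) (realForms φ) →
    All (λ f → evalℤ f z ℤ.≤ + 0 ⇔ evalℤ f z′ ℤ.≤ + 0) (intForms φ) →
    (∀ i → + modulus φ ∣ z i ℤ.- z′ i) → Sat c z φ ⇔ Sat c′ z′ φ
  Sat-invariant (realᵠ f) (same ∷ _) _ _ = same
  Sat-invariant (intᵠ f) _ (same ∷ _) _ = same
  Sat-invariant (dividesᵠ d f) _ _ d∣ = ∣evalℤ f d∣
  Sat-invariant (φ ∧ᵠ ψ) rs is N∣ = mk⇔
      (λ (p , q) → Equivalence.to satφ p , Equivalence.to satψ q)
      (λ (p , q) → Equivalence.from satφ p , Equivalence.from satψ q)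
    where
    satφ = Sat-invariant φ (All.++⁻ˡ (realForms φ) rs) (All.++⁻ˡ (intForms φ) is)
             (λ i → ∣.∣-trans (m∣+m*n (modulus φ) (modulus ψ)) (N∣ i))
    satψ = Sat-invariant ψ (All.++⁻ʳ (realForms φ) rs) (All.++⁻ʳ (intForms φ) is)
             (λ i → ∣.∣-trans (n∣+m*n (modulus φ) (modulus ψ)) (N∣ i))
  Sat-invariant (¬ᵠ φ) rs is N∣ = mk⇔ (_∘ Equivalence.from sat) (_∘ Equivalence.to sat)
    where
    sat = Sat-invariant φ rs is N∣

  -- (t , τ , k) stands for the real number with fractional part t and integer part τ / (1 + k).
  Candidate : ℕ → Set
  Candidate n = ℚ-Form n × ℤ-Form n × ℕ

  substᵠ : ∀ {n} → QF (suc n) → Candidate n → QF n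
  substᵠ (realᵠ f)      (t , τ , k) = realᵠ (substℝ f t)
  substᵠ (intᵠ f)       (t , τ , k) = intᵠ (substℤ f τ k)
  -- `substℤ` multiplies the form by `1 + k`, so the modulus becomes `(1 + d)(1 + k)`, which is
  -- stored as its predecessor.
  substᵠ (dividesᵠ d f) (t , τ , k) = dividesᵠ (k ℕ.+ d ℕ.* suc k) (substℤ f τ k)
  substᵠ (φ ∧ᵠ ψ)       e           = substᵠ φ e ∧ᵠ substᵠ ψ e
  substᵠ (¬ᵠ φ)         e           = ¬ᵠ substᵠ φ e

  Sat-subst : ∀ {n} (φ : QF (suc n)) ((t , τ , k) : Candidate n) {c z w} → + suc k ℤ.* w ≡ evalℤ τ z →
              Sat c z (substᵠ φ (t , τ , k)) ⇔ Sat (evalℝ t c ◂ c) (w ◂ z) φ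
  Sat-subst (realᵠ f) (t , τ , k) {c} _ = ≈⇒≤0⇔ (evalℝ-subst f t c)
  Sat-subst (intᵠ f) (t , τ , k) {c} {z} {w} kw≡τ rewrite evalℤ-subst f τ k w z kw≡τ = mk⇔
    (λ le → ℤ.*-cancelˡ-≤-pos _ _ (+ suc k) (subst (+ suc k ℤ.* evalℤ f (w ◂ z) ℤ.≤_) (sym (ℤ.*-zeroʳ (+ suc k))) le))
    (λ le → subst (+ suc k ℤ.* evalℤ f (w ◂ z) ℤ.≤_) (ℤ.*-zeroʳ (+ suc k)) (ℤ.*-monoˡ-≤-nonNeg (+ suc k) le))
  Sat-subst (dividesᵠ d f) (t , τ , k) {c} {z} {w} kw≡τ
    rewrite evalℤ-subst f τ k w z kw≡τ | ℤ.*-comm (+ suc k) (evalℤ f (w ◂ z)) = mk⇔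
    (∣.*-cancelʳ-∣ (+ suc k)) (∣.*-monoˡ-∣ (+ suc k))
  Sat-subst (φ ∧ᵠ ψ) e kw≡τ = mk⇔
      (λ (p , q) → Equivalence.to (Sat-subst φ e kw≡τ) p , Equivalence.to (Sat-subst ψ e kw≡τ) q)
      (λ (p , q) → Equivalence.from (Sat-subst φ e kw≡τ) p , Equivalence.from (Sat-subst ψ e kw≡τ) q)
  Sat-subst (¬ᵠ φ) e kw≡τ = mk⇔ (_∘ Equivalence.from (Sat-subst φ e kw≡τ)) (_∘ Equivalence.to (Sat-subst φ e kw≡τ))

  infixr 3 _∨ᵠ_

  ⊥ᵠ : ∀ {n} → QF n
  ⊥ᵠ = intᵠ (constℤ (+ 1))

  _∨ᵠ_ : ∀ {n} → QF n → QF n → QF n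
  φ ∨ᵠ ψ = ¬ᵠ (¬ᵠ φ ∧ᵠ ¬ᵠ ψ)

  ⋁ᵠ : ∀ {n} → List (QF n) → QF n
  ⋁ᵠ = foldr _∨ᵠ_ ⊥ᵠ

  candidates : ∀ {n} → QF (suc n) → List (Candidate n)
  candidates φ = cartesianProduct (testsℝ (realForms φ)) (testsℤ (modulus φ) (intForms φ))

  -- The candidate denotes a decomposed real only if 0 ≤ t, t < 1 and `1 + k` divides τ.
  validᵠ : ∀ {n} → Candidate n → QF n
  validᵠ (t , τ , k) = realᵠ (ℚ.- 1ℚ *ᶠ t) ∧ᵠ ¬ᵠ realᵠ (constℝ 1ℚ +ᶠ ℚ.- 1ℚ *ᶠ t) ∧ᵠ dividesᵠ k τ

  eliminate : ∀ {n} → QF (suc n) → QF n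
  eliminate φ = ⋁ᵠ (List.map (λ e → validᵠ e ∧ᵠ substᵠ φ e) (candidates φ))

open QuantifierFree public

-- Correctness of quantifier elimination

module Elimination (em : ExcludedMiddle 0ℓ) where

  open ClassicalOrder em
  open RealSelection em
  open IntegerSelection em

  Sat-∨ : ∀ {n} {c : Vector ℝ n} {z} φ ψ → Sat c z (φ ∨ᵠ ψ) ⇔ (Sat c z φ ⊎ Sat c z ψ)
  Sat-∨ φ ψ = mk⇔ (λ p → ¬¬-elim λ ¬s → p (¬s ∘ inj₁ , ¬s ∘ inj₂))
    λ { (inj₁ p) (¬p , _) → ¬p p ; (inj₂ q) (_ , ¬q) → ¬q q }

  Sat-⋁ : ∀ {n} {c : Vector ℝ n} {z} φs → Sat c z (⋁ᵠ φs) ⇔ Any (Sat c z) φs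
  Sat-⋁ {z = z} [] = mk⇔ (λ le → contradiction (subst (ℤ._≤ + 0) (evalℤ-const (+ 1) z) le) λ { (ℤ.+≤+ ()) }) λ ()
  Sat-⋁ (φ ∷ φs) = mk⇔ (Any.fromSum ∘ right ∘ Equivalence.to (Sat-∨ φ (⋁ᵠ φs)))
                        (Equivalence.from (Sat-∨ φ (⋁ᵠ φs)) ∘ left ∘ Any.toSum)
    where
    right : ∀ {A} → A ⊎ _ → A ⊎ _
    right (inj₁ p) = inj₁ p
    right (inj₂ q) = inj₂ (Equivalence.to (Sat-⋁ φs) q)
    left : ∀ {A} → A ⊎ _ → A ⊎ _
    left (inj₁ p) = inj₁ p
    left (inj₂ q) = inj₂ (Equivalence.from (Sat-⋁ φs) q)

  Selects : ∀ {n} → QF (suc n) → Vector ℝ n → Vector ℤ n → Candidate n → Set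
  Selects φ c z (t , τ , k) = ∃[ w ] (0ℝ ≤ evalℝ t c × evalℝ t c < 1ℝ ×
    + suc k ℤ.* w ≡ evalℤ τ z × Sat (evalℝ t c ◂ c) (w ◂ z) φ)

  -- Kept apart from `Sat-eliminate` because it names the candidate that satisfies the formula; the
  -- values of a definable function are read off from it.
  select : ∀ {n} (φ : QF (suc n)) c z d w → 0ℝ ≤ d → d < 1ℝ → Sat (d ◂ c) (w ◂ z) φ →
           Any (Selects φ c z) (candidates φ)
  select φ c z d w 0≤d d<1 sat =
    let t , t∈ , 0≤t , t<1 , sameℝ = selectℝ (realForms φ) c d 0≤d d<1
        w′ , tested , N∣ , sameℤ   = selectℤ (modulus φ) {{modulus≢0 φ}} (intForms φ) z w
        (τ , k) , τ∈ , kw≡τ        = find tested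
    in lose (∈-cartesianProduct⁺ t∈ τ∈) (w′ , 0≤t , t<1 , kw≡τ ,
         Equivalence.to (Sat-invariant φ sameℝ sameℤ (congruent w′ N∣)) sat)
    where
    congruent : ∀ w′ → + modulus φ ∣ w ℤ.- w′ → ∀ i → + modulus φ ∣ (w ◂ z) i ℤ.- (w′ ◂ z) i
    congruent w′ N∣ zero = N∣
    congruent w′ N∣ (suc i) = divides (+ 0) (ℤ.+-inverseʳ (z i))

  -x≤0⇔0≤x : ∀ {n} (t : ℚ-Form n) c → evalℝ (ℚ.- 1ℚ *ᶠ t) c ≤ 0ℝ ⇔ 0ℝ ≤ evalℝ t c
  -x≤0⇔0≤x t c = ⇔-trans (≈⇒≤0⇔ (evalℝ-* (ℚ.- 1ℚ) t c)) (neg·x≤0 (ℚ.- 1ℚ) (evalℝ t c))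

  1-x≤0⇔1≤x : ∀ {n} (t : ℚ-Form n) c → evalℝ (constℝ 1ℚ +ᶠ ℚ.- 1ℚ *ᶠ t) c ≤ 0ℝ ⇔ 1ℝ ≤ evalℝ t c
  1-x≤0⇔1≤x t c = ⇔-trans (≈⇒≤0⇔ (≈-trans (evalℝ-+ (constℝ 1ℚ) (ℚ.- 1ℚ *ᶠ t) c)
    (+-cong (evalℝ-const 1ℚ c) (evalℝ-* (ℚ.- 1ℚ) t c)))) (x-y≤0⇔x≤y 1ℝ (evalℝ t c))

  Sat-valid : ∀ {n} (φ : QF (suc n)) ((t , τ , k) : Candidate n) {c z} →
              Sat c z (validᵠ (t , τ , k) ∧ᵠ substᵠ φ (t , τ , k)) ⇔ Selects φ c z (t , τ , k)
  Sat-valid φ e@(t , τ , k) {c} {z} = mk⇔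
    (λ ((0≤t , t<1 , divides w τ≡) , sat) → w
      , Equivalence.to (-x≤0⇔0≤x t c) 0≤t
      , ≰⇒> (t<1 ∘ Equivalence.from (1-x≤0⇔1≤x t c))
      , trans (ℤ.*-comm (+ suc k) w) (sym τ≡)
      , Equivalence.to (Sat-subst φ e (trans (ℤ.*-comm (+ suc k) w) (sym τ≡))) sat)
    (λ (w , 0≤t , t<1 , kw≡τ , sat) →
      ( Equivalence.from (-x≤0⇔0≤x t c) 0≤t
      , <⇒≱ t<1 ∘ Equivalence.to (1-x≤0⇔1≤x t c)
      , divides w (trans (sym kw≡τ) (ℤ.*-comm (+ suc k) w)))
      , Equivalence.from (Sat-subst φ e kw≡τ) sat)

  Sat-eliminate : ∀ {n} (φ : QF (suc n)) {c z} →
    Sat c z (eliminate φ) ⇔ (∃[ d ] ∃[ w ] (0ℝ ≤ d × d < 1ℝ × Sat (d ◂ c) (w ◂ z) φ))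
  Sat-eliminate φ {c} {z} = mk⇔
    (λ sat → witness (Any.satisfied (Any.map⁻
      (Equivalence.to (Sat-⋁ {c = c} {z} (List.map (λ e → validᵠ e ∧ᵠ substᵠ φ e) (candidates φ))) sat))))
    (λ (d , w , 0≤d , d<1 , sat) → Equivalence.from (Sat-⋁ {c = c} {z} (List.map (λ e → validᵠ e ∧ᵠ substᵠ φ e) (candidates φ)))
      (Any.map⁺ (Any.map (λ {e} → Equivalence.from (Sat-valid φ e)) (select φ c z d w 0≤d d<1 sat))))
    where
    witness : ∃[ e ] Sat c z (validᵠ e ∧ᵠ substᵠ φ e) → ∃[ d ] ∃[ w ] (0ℝ ≤ d × d < 1ℝ × Sat (d ◂ c) (w ◂ z) φ)
    witness (e , sat) = let w , 0≤t , t<1 , _ , sat′ = Equivalence.to (Sat-valid φ e) sat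
                        in evalℝ (proj₁ e) c , w , 0≤t , t<1 , sat′

-- From first-order formulas to separated ones

module Terms where

  open +-*-Solver using (solve; con; _:*_; _:+_; _:-_; :-_; _:=_)

  ·ᵛ-congˡ : ∀ {n} {a b : Vector ℚ n} (x : Vector ℝ n) → (∀ i → a i ≡ b i) → a ·ᵛ x ≈ b ·ᵛ x
  ·ᵛ-congˡ {zero} x a≡b = ≈-refl
  ·ᵛ-congˡ {suc n} x a≡b = +-cong (pointwise λ k → cong (ℚ._* seq (x zero) k) (a≡b zero)) (·ᵛ-congˡ (tail x) (a≡b ∘ suc))

  ·ᵛ-+ʳ : ∀ {n} (a : Vector ℚ n) (x y : Vector ℝ n) → a ·ᵛ zipWith _+_ x y ≈ a ·ᵛ x + a ·ᵛ y
  ·ᵛ-+ʳ {zero}  a x y = pointwise λ _ → refl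
  ·ᵛ-+ʳ {suc n} a x y = ≈-trans (+-cong (≈-refl {a zero · (x zero + y zero)}) (·ᵛ-+ʳ (tail a) (tail x) (tail y)))
    (pointwise λ k → solve 5 (λ a x y s t → a :* (x :+ y) :+ (s :+ t) := (a :* x :+ s) :+ (a :* y :+ t)) refl
      (a zero) (seq (x zero) k) (seq (y zero) k) (seq (tail a ·ᵛ tail x) k) (seq (tail a ·ᵛ tail y) k))

  ι·fromℤ : ∀ x y → ι x · fromℤ y ≈ fromℤ (x ℤ.* y)
  ι·fromℤ x y = pointwise λ _ → sym (ι-* x y)

  infix 8 _∙ᵛ_
  _∙ᵛ_ : ∀ {n} → Vector ℤ n → Vector ℝ n → ℝ
  a ∙ᵛ x = (ι ∘ a) ·ᵛ x

  ∙ᵛ-fromℤ : ∀ {n} (a z : Vector ℤ n) → a ∙ᵛ map fromℤ z ≈ fromℤ (dot a z)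
  ∙ᵛ-fromℤ {zero}  a z = ≈-refl
  ∙ᵛ-fromℤ {suc n} a z = ≈-trans (+-cong (ι·fromℤ (a zero) (z zero)) (∙ᵛ-fromℤ (tail a) (tail z)))
    (≈-sym (fromℤ-+ (a zero ℤ.* z zero) (dot (tail a) (tail z))))

  ∙ᵛ-⊕ : ∀ {n} (a z : Vector ℤ n) c → a ∙ᵛ (c ⊕ z) ≈ a ∙ᵛ c + fromℤ (dot a z)
  ∙ᵛ-⊕ a z c = ≈-trans (·ᵛ-+ʳ (ι ∘ a) c (map fromℤ z)) (+-cong (≈-refl {a ∙ᵛ c}) (∙ᵛ-fromℤ a z))

  unit : ∀ {n} → Fin n → Vector ℤ n
  unit zero    = (+ 1) ◂ (λ _ → + 0)
  unit (suc i) = (+ 0) ◂ unit i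

  coefficients : ∀ {m} → Term m → Vector ℤ m
  coefficients (var i) = unit i
  coefficients (s ⊞ t) = zipWith ℤ._+_ (coefficients s) (coefficients t)

  unit-∙ᵛ : ∀ {n} (i : Fin n) x → unit i ∙ᵛ x ≈ x i
  unit-∙ᵛ zero x = ≈-trans (+-cong (≈-refl {1ℚ · x zero}) (·ᵛ-0 (tail x)))
    (pointwise λ k → solve 1 (λ x → con 1ℚ :* x :+ con 0ℚ := x) refl (seq (x zero) k))
  unit-∙ᵛ (suc i) x = ≈-trans (+-cong (≈-refl {0ℚ · x zero}) (unit-∙ᵛ i (tail x)))
    (pointwise λ k → solve 2 (λ x y → con 0ℚ :* x :+ y := y) refl (seq (x zero) k) (seq (x (suc i)) k))

  ∙ᵛ-+ : ∀ {n} (a b : Vector ℤ n) x → zipWith ℤ._+_ a b ∙ᵛ x ≈ a ∙ᵛ x + b ∙ᵛ x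
  ∙ᵛ-+ a b x = ≈-trans (·ᵛ-congˡ x λ i → ι-+ (a i) (b i)) (·ᵛ-+ (ι ∘ a) (ι ∘ b) x)

  ⟦⟧≈coefficients : ∀ {m} (t : Term m) v → ⟦ t ⟧ v ≈ coefficients t ∙ᵛ v
  ⟦⟧≈coefficients (var i) v = ≈-sym (unit-∙ᵛ i v)
  ⟦⟧≈coefficients (s ⊞ t) v = ≈-trans (+-cong (⟦⟧≈coefficients s v) (⟦⟧≈coefficients t v))
    (≈-sym (∙ᵛ-+ (coefficients s) (coefficients t) v))

  negate : ∀ {n} → Vector ℤ n → Vector ℤ n
  negate a i = ℤ.- a i

  ∙ᵛ-negate : ∀ {n} (a : Vector ℤ n) x → negate a ∙ᵛ x ≈ ℚ.- 1ℚ · (a ∙ᵛ x)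
  ∙ᵛ-negate a x = ≈-trans (·ᵛ-congˡ x λ i → trans (ι-neg (a i)) (neg≡ (ι (a i)))) (·ᵛ-* (ℚ.- 1ℚ) (ι ∘ a) x)
    where
    neg≡ : ∀ p → ℚ.- p ≡ ℚ.- 1ℚ ℚ.* p
    neg≡ = solve 1 (λ p → :- p := con (ℚ.- 1ℚ) :* p) refl

  difference : ∀ {m} → Term m → Term m → Vector ℤ m
  difference s t = zipWith ℤ._+_ (coefficients s) (negate (coefficients t))

  ⟦⟧≤⟦⟧⇔difference≤0 : ∀ {m} (s t : Term m) v → ⟦ s ⟧ v ≤ ⟦ t ⟧ v ⇔ difference s t ∙ᵛ v ≤ 0ℝ
  ⟦⟧≤⟦⟧⇔difference≤0 s t v = ⇔-trans (⇔-sym (x-y≤0⇔x≤y (⟦ s ⟧ v) (⟦ t ⟧ v))) (≈⇒≤0⇔ (≈-sym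
    (≈-trans (∙ᵛ-+ (coefficients s) (negate (coefficients t)) v)
      (+-cong (≈-sym (⟦⟧≈coefficients s v))
        (≈-trans (∙ᵛ-negate (coefficients t) v) (·-cong (ℚ.- 1ℚ) (≈-sym (⟦⟧≈coefficients t v))))))))

  -- The ℓ¹ norm. It bounds the values of `a` on the unit cube, and later it measures the descent in
  -- a cone.
  size : ∀ {n} → Vector ℤ n → ℕ
  size {zero}  a = 0
  size {suc n} a = ℤ.∣ a zero ∣ ℕ.+ size (tail a)

  size-negate : ∀ {n} (a : Vector ℤ n) → size (negate a) ≡ size a
  size-negate {zero}  a = refl
  size-negate {suc n} a = cong₂ ℕ._+_ (ℤ.∣-i∣≡∣i∣ (a zero)) (size-negate (tail a))

  ι-pos : ∀ n → ℚ.Positive (ι (+ suc n))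
  ι-pos n = ℚ.normalize-pos (suc n) 1

  ι-neg-1 : ∀ n x → ι -[1+ n ] · x ≈ ℚ.- 1ℚ · (ι (+ suc n) · x)
  ι-neg-1 n x = pointwise λ k → trans (cong (ℚ._* seq x k) (ι-neg (+ suc n)))
    (solve 2 (λ p x → (:- p) :* x := con (ℚ.- 1ℚ) :* (p :* x)) refl (ι (+ suc n)) (seq x k))

  ι·c≤∣ι∣ : ∀ x {c} → 0ℝ ≤ c → c ≤ 1ℝ → ι x · c ≤ fromℤ (+ ℤ.∣ x ∣)
  ι·c≤∣ι∣ (+ zero) {c} _ _ = ≈⇒≤ (pointwise λ k → ℚ.*-zeroˡ (seq c k))
  ι·c≤∣ι∣ (+ suc n) 0≤c c≤1 = ≤-trans (·-mono-≤-pos (ι (+ suc n)) {{ι-pos n}} c≤1)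
    (≈⇒≤ (pointwise λ _ → ℚ.*-identityʳ (ι (+ suc n))))
  ι·c≤∣ι∣ -[1+ n ] {c} 0≤c c≤1 = ≤-trans (≈⇒≤ (ι-neg-1 n c))
    (≤-trans (neg-antimono (·-mono-≤-pos (ι (+ suc n)) {{ι-pos n}} 0≤c))
      (≤-trans (≈⇒≤ (pointwise λ _ → trans (cong (ℚ.- 1ℚ ℚ.*_) (ℚ.*-zeroʳ (ι (+ suc n)))) (ℚ.*-zeroʳ (ℚ.- 1ℚ))))
        (fromℤ-mono-≤ (+ 0) (+ suc n) (ℤ.+≤+ ℕ.z≤n))))

  ∙ᵛ≤size : ∀ {n} (a : Vector ℤ n) {c} → (∀ i → 0ℝ ≤ c i × c i ≤ 1ℝ) → a ∙ᵛ c ≤ fromℤ (+ size a)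
  ∙ᵛ≤size {zero}  a c∈ = ≤-refl
  ∙ᵛ≤size {suc n} a c∈ = ≤-trans (+-mono-≤ (ι·c≤∣ι∣ (a zero) (proj₁ (c∈ zero)) (proj₂ (c∈ zero))) (∙ᵛ≤size (tail a) (c∈ ∘ suc)))
    (≈⇒≤ (≈-sym (fromℤ-+ (+ ℤ.∣ a zero ∣) (+ size (tail a)))))

  -size≤∙ᵛ : ∀ {n} (a : Vector ℤ n) {c} → (∀ i → 0ℝ ≤ c i × c i ≤ 1ℝ) → fromℤ (ℤ.- + size a) ≤ a ∙ᵛ c
  -size≤∙ᵛ a {c} c∈ = ≤-trans (≈⇒≤ (fromℤ-neg (+ size a)))
    (≤-trans (neg-antimono (subst (λ m → negate a ∙ᵛ c ≤ fromℤ (+ m)) (size-negate a) (∙ᵛ≤size (negate a) c∈)))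
      (≈⇒≤ (≈-trans (·-cong (ℚ.- 1ℚ) (∙ᵛ-negate a c)) (neg-involutive (a ∙ᵛ c)))))

  -- The first two atoms force `a · z = j`. Then the sum `a · c + a · z` has `j` in place of its
  -- integer part, and the third atom bounds it.
  sliceᵠ : ∀ {n} → Vector ℤ n → ℤ → QF n
  sliceᵠ a j = intᵠ (a , ℤ.- j) ∧ᵠ intᵠ (negate a , j) ∧ᵠ realᵠ (ι ∘ a , ι j)

  -- On the unit cube ∣ a · c ∣ ≤ size a.  Hence a · c + a · z ≤ 0 holds if a · z ≤ - size a, and
  -- otherwise a · z must be one of the finitely many integers j with ∣ j ∣ ≤ size a.
  nonpositiveᵠ : ∀ {n} → Vector ℤ n → QF n
  nonpositiveᵠ a = intᵠ (a , + size a) ∨ᵠ ⋁ᵠ (List.map (sliceᵠ a) (interval (size a)))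

  fractionᵠ : ∀ {n} → Vector ℤ n → ℤ → QF n
  fractionᵠ a j = realᵠ (ι ∘ a , ι (ℤ.- j)) ∧ᵠ realᵠ (ι ∘ negate a , ι j)

  -- As `a · z` is an integer, only `a · c` has to be one, and on the unit cube it can only be one
  -- of absolute value at most `size a`.
  integralᵠ : ∀ {n} → Vector ℤ n → QF n
  integralᵠ a = ⋁ᵠ (List.map (fractionᵠ a) (interval (size a)))

  translate : ∀ {m} → Formula m → QF m
  translate (s ≤ᶠ t) = nonpositiveᵠ (difference s t)
  translate (s ≈ᶠ t) = nonpositiveᵠ (difference s t) ∧ᵠ nonpositiveᵠ (difference t s)
  translate (isℤ t)  = integralᵠ (coefficients t)
  translate (¬ᶠ φ)   = ¬ᵠ translate φ
  translate (φ ∧ᶠ ψ) = translate φ ∧ᵠ translate ψ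
  translate (φ ∨ᶠ ψ) = translate φ ∨ᵠ translate ψ
  translate (∀ᶠ φ)   = ¬ᵠ eliminate (¬ᵠ translate φ)
  translate (∃ᶠ φ)   = eliminate (translate φ)

  ⟦⟧-cong : ∀ {m} (t : Term m) {v w} → v ≋ w → ⟦ t ⟧ v ≈ ⟦ t ⟧ w
  ⟦⟧-cong (var i) v≋w = v≋w i
  ⟦⟧-cong (s ⊞ t) v≋w = +-cong (⟦⟧-cong s v≋w) (⟦⟧-cong t v≋w)

  ◂-cong : ∀ {m x y} {v w : Vector ℝ m} → x ≈ y → v ≋ w → (x ◂ v) ≋ (y ◂ w)
  ◂-cong x≈y v≋w zero    = x≈y
  ◂-cong x≈y v≋w (suc i) = v≋w i

  ⊨-resp : ∀ {m} (φ : Formula m) {v w} → v ≋ w → v ⊨ φ → w ⊨ φ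
  ⊨-resp (s ≤ᶠ t) v≋w p = ≤-resp (⟦⟧-cong s v≋w) (⟦⟧-cong t v≋w) p
  ⊨-resp (s ≈ᶠ t) v≋w p = ≈-trans (⟦⟧-cong s (≋-sym v≋w)) (≈-trans p (⟦⟧-cong t v≋w))
  ⊨-resp (isℤ t) v≋w (z , p) = z , ≈-trans (⟦⟧-cong t (≋-sym v≋w)) p
  ⊨-resp (¬ᶠ φ) v≋w p = p ∘ ⊨-resp φ (≋-sym v≋w)
  ⊨-resp (φ ∧ᶠ ψ) v≋w (p , q) = ⊨-resp φ v≋w p , ⊨-resp ψ v≋w q
  ⊨-resp (φ ∨ᶠ ψ) v≋w = Sum.map (⊨-resp φ v≋w) (⊨-resp ψ v≋w)
  ⊨-resp (∀ᶠ φ) v≋w p x = ⊨-resp φ (◂-cong ≈-refl v≋w) (p x)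
  ⊨-resp (∃ᶠ φ) v≋w (x , p) = x , ⊨-resp φ (◂-cong ≈-refl v≋w) p

  ◂-⊕ : ∀ {m} d w (c : Vector ℝ m) z → (d + fromℤ w ◂ c ⊕ z) ≋ ((d ◂ c) ⊕ (w ◂ z))
  ◂-⊕ d w c z zero    = ≈-refl
  ◂-⊕ d w c z (suc i) = ≈-refl

open Terms public

-- Correctness of the translation

module Translation (em : ExcludedMiddle 0ℓ) where

  open ClassicalOrder em
  open Elimination em
  open +-*-Solver using (solve; con; _:*_; _:+_; _:-_; :-_; _:=_)

  cube⇒closed : ∀ {n} {c : Vector ℝ n} → InUnitCube c → ∀ i → 0ℝ ≤ c i × c i ≤ 1ℝ
  cube⇒closed c∈ i = proj₁ (c∈ i) , <⇒≤ (proj₂ (c∈ i))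

  i+j≤0⇒i≤-j : ∀ i j → i ℤ.+ j ℤ.≤ + 0 → i ℤ.≤ ℤ.- j
  i+j≤0⇒i≤-j i j le = subst₂ ℤ._≤_ (cancel i j) (ℤ.+-identityˡ (ℤ.- j)) (ℤ.+-monoˡ-≤ (ℤ.- j) le)
    where
    cancel : ∀ i j → i ℤ.+ j ℤ.+ ℤ.- j ≡ i
    cancel = ℤ-ring

  i≤-j⇒i+j≤0 : ∀ i j → i ℤ.≤ ℤ.- j → i ℤ.+ j ℤ.≤ + 0
  i≤-j⇒i+j≤0 i j le = subst (i ℤ.+ j ℤ.≤_) (ℤ.+-inverseˡ j) (ℤ.+-monoˡ-≤ j le)

  ∣i∣≤ : ∀ i A → ℤ.- + A ℤ.≤ i → i ℤ.≤ + A → ℤ.∣ i ∣ ℕ.≤ A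
  ∣i∣≤ (+ n) A _ le = ℤ.drop‿+≤+ le
  ∣i∣≤ -[1+ n ] (suc A) (ℤ.-≤- n≤A) _ = ℕ.s≤s n≤A

  dot-negate : ∀ {n} (a z : Vector ℤ n) → dot (negate a) z ≡ ℤ.- dot a z
  dot-negate {zero}  a z = refl
  dot-negate {suc n} a z = trans (cong (λ s → ℤ.- a zero ℤ.* z zero ℤ.+ s) (dot-negate (tail a) (tail z)))
    (regroup (a zero) (z zero) (dot (tail a) (tail z)))
    where
    regroup : ∀ a z s → ℤ.- a ℤ.* z ℤ.+ ℤ.- s ≡ ℤ.- (a ℤ.* z ℤ.+ s)
    regroup = ℤ-ring

  Sat-slice : ∀ {n} (a : Vector ℤ n) j {c z} → Sat c z (sliceᵠ a j) ⇔ (dot a z ≡ j × a ∙ᵛ c + fromℤ j ≤ 0ℝ)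
  Sat-slice a j {c} {z} = mk⇔
    (λ (below , above , le) → ℤ.≤-antisym
        (subst (dot a z ℤ.≤_) (ℤ.neg-involutive j) (i+j≤0⇒i≤-j (dot a z) (ℤ.- j) below))
        (subst₂ ℤ._≤_ (ℤ.neg-involutive j) (ℤ.neg-involutive (dot a z))
          (ℤ.neg-mono-≤ (i+j≤0⇒i≤-j _ j (subst (λ s → s ℤ.+ j ℤ.≤ + 0) (dot-negate a z) above)))) , le)
    (λ { (refl , le) → ℤ.≤-reflexive (ℤ.+-inverseʳ (dot a z))
       , ℤ.≤-reflexive (trans (cong (ℤ._+ dot a z) (dot-negate a z)) (ℤ.+-inverseˡ (dot a z))) , le })

  Sat-nonpositive : ∀ {n} (a : Vector ℤ n) {c z} → InUnitCube c →
                    Sat c z (nonpositiveᵠ a) ⇔ a ∙ᵛ c + fromℤ (dot a z) ≤ 0ℝ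
  Sat-nonpositive a {c} {z} c∈ = ⇔-trans (Sat-∨ {c = c} {z} (intᵠ (a , + size a)) (⋁ᵠ (List.map (sliceᵠ a) (interval (size a)))))
      (mk⇔ sound complete)
    where
    A : ℕ
    A = size a
    s : ℤ
    s = dot a z
    slices : List (QF _)
    slices = List.map (sliceᵠ a) (interval A)
    sound-slice : ∃[ j ] Sat c z (sliceᵠ a j) → a ∙ᵛ c + fromℤ s ≤ 0ℝ
    sound-slice (j , sat) = subst (λ j → a ∙ᵛ c + fromℤ j ≤ 0ℝ) (sym (proj₁ (Equivalence.to (Sat-slice a j {c} {z}) sat)))
      (proj₂ (Equivalence.to (Sat-slice a j {c} {z}) sat))
    sound : Sat c z (intᵠ (a , + A)) ⊎ Sat c z (⋁ᵠ slices) → a ∙ᵛ c + fromℤ s ≤ 0ℝ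
    sound (inj₁ s+A≤0) = ≤-trans (+-mono-≤ (∙ᵛ≤size a (cube⇒closed c∈)) (≤-refl {fromℤ s}))
      (≤-trans (≈⇒≤ (≈-sym (fromℤ-+ (+ A) s)))
        (fromℤ-mono-≤ (+ A ℤ.+ s) (+ 0) (subst (ℤ._≤ + 0) (ℤ.+-comm s (+ A)) s+A≤0)))
    sound (inj₂ sat) = sound-slice (Any.satisfied (Any.map⁻ (Equivalence.to (Sat-⋁ {c = c} {z} slices) sat)))
    s≤A : a ∙ᵛ c + fromℤ s ≤ 0ℝ → s ℤ.≤ + A
    s≤A le = ℤ.≤-trans (i+j≤0⇒i≤-j s (ℤ.- + A) (subst (ℤ._≤ + 0) (ℤ.+-comm (ℤ.- + A) s)
      (fromℤ-cancel-≤ (ℤ.- + A ℤ.+ s) (+ 0) (≤-trans (≈⇒≤ (fromℤ-+ (ℤ.- + A) s))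
        (≤-trans (+-mono-≤ (-size≤∙ᵛ a (cube⇒closed c∈)) (≤-refl {fromℤ s})) le)))))
      (ℤ.≤-reflexive (ℤ.neg-involutive (+ A)))
    complete : a ∙ᵛ c + fromℤ s ≤ 0ℝ → Sat c z (intᵠ (a , + A)) ⊎ Sat c z (⋁ᵠ slices)
    complete le = Sum.map (i≤-j⇒i+j≤0 s (+ A))
      (λ -A≤s → Equivalence.from (Sat-⋁ {c = c} {z} slices) (Any.map⁺ (lose (∈-interval s (∣i∣≤ s A -A≤s (s≤A le)))
        (Equivalence.from (Sat-slice a s {c} {z}) (refl , le)))))
      (ℤ.≤-total s (ℤ.- + A))

  Sat-fraction : ∀ {n} (a : Vector ℤ n) j {c z} → Sat c z (fractionᵠ a j) ⇔ a ∙ᵛ c ≈ fromℤ j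
  Sat-fraction a j {c} = mk⇔
    (λ (below , above) → ≤-antisym
      (Equivalence.to (⇔-trans (≈⇒≤0⇔ lower≈) (x-y≤0⇔x≤y (a ∙ᵛ c) (fromℤ j))) below)
      (Equivalence.to (⇔-trans (≈⇒≤0⇔ upper≈) (x-y≤0⇔x≤y (fromℤ j) (a ∙ᵛ c))) above))
    (λ e → Equivalence.from (⇔-trans (≈⇒≤0⇔ lower≈) (x-y≤0⇔x≤y (a ∙ᵛ c) (fromℤ j))) (≈⇒≤ e)
         , Equivalence.from (⇔-trans (≈⇒≤0⇔ upper≈) (x-y≤0⇔x≤y (fromℤ j) (a ∙ᵛ c))) (≈⇒≤ (≈-sym e)))
    where
    +-comm : ∀ x y → x + y ≈ y + x
    +-comm x y = pointwise λ k → ℚ.+-comm (seq x k) (seq y k)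
    lower≈ : a ∙ᵛ c + fromℤ (ℤ.- j) ≈ a ∙ᵛ c + ℚ.- 1ℚ · fromℤ j
    lower≈ = +-cong (≈-refl {a ∙ᵛ c}) (fromℤ-neg j)
    upper≈ : negate a ∙ᵛ c + fromℤ j ≈ fromℤ j + ℚ.- 1ℚ · (a ∙ᵛ c)
    upper≈ = ≈-trans (+-comm (negate a ∙ᵛ c) (fromℤ j)) (+-cong (≈-refl {fromℤ j}) (∙ᵛ-negate a c))

  Sat-integral : ∀ {n} (a : Vector ℤ n) {c z} → InUnitCube c →
                 Sat c z (integralᵠ a) ⇔ (∃[ m ] (a ∙ᵛ c + fromℤ (dot a z) ≈ fromℤ m))
  Sat-integral a {c} {z} c∈ = ⇔-trans (Sat-⋁ {c = c} {z} fractions) (mk⇔ sound complete)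
    where
    A : ℕ
    A = size a
    s : ℤ
    s = dot a z
    fractions : List (QF _)
    fractions = List.map (fractionᵠ a) (interval A)
    sound-fraction : ∃[ j ] Sat c z (fractionᵠ a j) → ∃[ m ] (a ∙ᵛ c + fromℤ s ≈ fromℤ m)
    sound-fraction (j , sat) = j ℤ.+ s ,
      ≈-trans (+-cong (Equivalence.to (Sat-fraction a j {c} {z}) sat) (≈-refl {fromℤ s})) (≈-sym (fromℤ-+ j s))
    sound : Any (Sat c z) fractions → ∃[ m ] (a ∙ᵛ c + fromℤ s ≈ fromℤ m)
    sound any = sound-fraction (Any.satisfied (Any.map⁻ {f = fractionᵠ a} {xs = interval A} any))
    shift : ∀ m → a ∙ᵛ c + fromℤ s ≈ fromℤ m → a ∙ᵛ c ≈ fromℤ (m ℤ.+ ℤ.- s)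
    shift m e = ≈-trans (pointwise λ k → solve 2 (λ x s → x := (x :+ s) :+ (con (ℚ.- 1ℚ) :* s)) refl (seq (a ∙ᵛ c) k) (ι s))
      (≈-trans (+-cong e (≈-sym (fromℤ-neg s))) (≈-sym (fromℤ-+ m (ℤ.- s))))
    bounded-by-A : ∀ j → a ∙ᵛ c ≈ fromℤ j → ℤ.∣ j ∣ ℕ.≤ A
    bounded-by-A j e = ∣i∣≤ j A
      (fromℤ-cancel-≤ (ℤ.- + A) j (≤-trans (-size≤∙ᵛ a (cube⇒closed c∈)) (≈⇒≤ e)))
      (fromℤ-cancel-≤ j (+ A) (≤-trans (≈⇒≤ (≈-sym e)) (∙ᵛ≤size a (cube⇒closed c∈))))
    complete : ∃[ m ] (a ∙ᵛ c + fromℤ s ≈ fromℤ m) → Any (Sat c z) fractions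
    complete (m , e) = Any.map⁺ (lose (∈-interval (m ℤ.+ ℤ.- s) (bounded-by-A (m ℤ.+ ℤ.- s) (shift m e)))
      (Equivalence.from (Sat-fraction a (m ℤ.+ ℤ.- s) {c} {z}) (shift m e)))

  ◂-cube : ∀ {m d} {c : Vector ℝ m} → 0ℝ ≤ d → d < 1ℝ → InUnitCube c → InUnitCube (d ◂ c)
  ◂-cube 0≤d d<1 c∈ zero    = 0≤d , d<1
  ◂-cube 0≤d d<1 c∈ (suc i) = c∈ i

  -- Agreement is asked for only on the unit cube, where the bound by `size` holds; every point has
  -- a decomposition with its fractional part there.
  Translates : ∀ {m} → Formula m → QF m → Set
  Translates φ ψ = ∀ {c z} → InUnitCube c → (c ⊕ z ⊨ φ) ⇔ Sat c z ψ

  ≤-translates : ∀ {m} (s t : Term m) → Translates (s ≤ᶠ t) (nonpositiveᵠ (difference s t))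
  ≤-translates s t {c} {z} c∈ = ⇔-trans (⟦⟧≤⟦⟧⇔difference≤0 s t (c ⊕ z))
    (⇔-trans (≈⇒≤0⇔ (∙ᵛ-⊕ (difference s t) z c)) (⇔-sym (Sat-nonpositive (difference s t) {c} {z} c∈)))

  -- A real quantifier splits into one over [0,1) and one over the integers, and `eliminate` removes
  -- both at once.
  ∃-translates : ∀ {m} {φ : Formula (suc m)} {ψ} → Translates φ ψ → Translates (∃ᶠ φ) (eliminate ψ)
  ∃-translates {φ = φ} {ψ} φ⇔ψ {c} {z} c∈ = ⇔-trans (mk⇔ to from) (⇔-sym (Sat-eliminate ψ {c} {z}))
    where
    to : c ⊕ z ⊨ ∃ᶠ φ → ∃[ d ] ∃[ w ] (0ℝ ≤ d × d < 1ℝ × Sat (d ◂ c) (w ◂ z) ψ)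
    to (x , p) = let d , w , (0≤d , d<1) , x≈ = fractional-decomposition x
      in d , w , 0≤d , d<1 , Equivalence.to (φ⇔ψ (◂-cube 0≤d d<1 c∈))
           (⊨-resp φ (≋-trans (◂-cong x≈ (≋-refl {x = c ⊕ z})) (◂-⊕ d w c z)) p)
    from : ∃[ d ] ∃[ w ] (0ℝ ≤ d × d < 1ℝ × Sat (d ◂ c) (w ◂ z) ψ) → c ⊕ z ⊨ ∃ᶠ φ
    from (d , w , 0≤d , d<1 , sat) = d + fromℤ w ,
      ⊨-resp φ (≋-sym (◂-⊕ d w c z)) (Equivalence.from (φ⇔ψ (◂-cube 0≤d d<1 c∈)) sat)

  ¬-translates : ∀ {m} {φ : Formula m} {ψ} → Translates φ ψ → Translates (¬ᶠ φ) (¬ᵠ ψ)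
  ¬-translates φ⇔ψ c∈ = mk⇔ (_∘ Equivalence.from (φ⇔ψ c∈)) (_∘ Equivalence.to (φ⇔ψ c∈))

  ∀⇔¬∃¬ : ∀ {m} (φ : Formula (suc m)) v → (v ⊨ ∀ᶠ φ) ⇔ (v ⊨ ¬ᶠ ∃ᶠ ¬ᶠ φ)
  ∀⇔¬∃¬ φ v = mk⇔ (λ p (x , ¬q) → ¬q (p x)) (λ ¬∃ x → ¬¬-elim λ ¬q → ¬∃ (x , ¬q))

  translate-correct : ∀ {m} (φ : Formula m) → Translates φ (translate φ)
  translate-correct (s ≤ᶠ t) {c} {z} = ≤-translates s t {c} {z}
  translate-correct (s ≈ᶠ t) {c} {z} c∈ = mk⇔
    (λ e → Equivalence.to (≤-translates s t {c} {z} c∈) (≈⇒≤ e)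
         , Equivalence.to (≤-translates t s {c} {z} c∈) (≈⇒≤ (≈-sym e)))
    (λ (p , q) → ≤-antisym (Equivalence.from (≤-translates s t {c} {z} c∈) p)
                           (Equivalence.from (≤-translates t s {c} {z} c∈) q))
  translate-correct (isℤ t) {c} {z} c∈ = ⇔-trans
    (mk⇔ (λ (m , e) → m , ≈-trans (≈-sym t≈) e) (λ (m , e) → m , ≈-trans t≈ e))
    (⇔-sym (Sat-integral (coefficients t) {c} {z} c∈))
    where
    t≈ : ⟦ t ⟧ (c ⊕ z) ≈ coefficients t ∙ᵛ c + fromℤ (dot (coefficients t) z)
    t≈ = ≈-trans (⟦⟧≈coefficients t (c ⊕ z)) (∙ᵛ-⊕ (coefficients t) z c)
  translate-correct (¬ᶠ φ) = ¬-translates {φ = φ} (translate-correct φ)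
  translate-correct (φ ∧ᶠ ψ) {c} {z} c∈ = mk⇔
    (λ (p , q) → Equivalence.to (translate-correct φ {c} {z} c∈) p , Equivalence.to (translate-correct ψ {c} {z} c∈) q)
    (λ (p , q) → Equivalence.from (translate-correct φ {c} {z} c∈) p , Equivalence.from (translate-correct ψ {c} {z} c∈) q)
  translate-correct (φ ∨ᶠ ψ) {c} {z} c∈ = ⇔-trans
    (mk⇔ (Sum.map (Equivalence.to (translate-correct φ {c} {z} c∈)) (Equivalence.to (translate-correct ψ {c} {z} c∈)))
         (Sum.map (Equivalence.from (translate-correct φ {c} {z} c∈)) (Equivalence.from (translate-correct ψ {c} {z} c∈))))
    (⇔-sym (Sat-∨ {c = c} {z} (translate φ) (translate ψ)))
  translate-correct (∀ᶠ φ) {c} {z} c∈ = ⇔-trans (∀⇔¬∃¬ φ (c ⊕ z))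
    (¬-translates {φ = ∃ᶠ ¬ᶠ φ} (∃-translates {φ = ¬ᶠ φ} (¬-translates {φ = φ} (translate-correct φ))) c∈)
  translate-correct (∃ᶠ φ) = ∃-translates {φ = φ} (translate-correct φ)

-- Integer cones

module Cones where

  -- Comparing both parts compares integers within one sign: a vector below another in all parts
  -- lies coordinatewise between 0 and it.
  positivePart negativePart : ℤ → ℕ
  positivePart (+ n)    = n
  positivePart -[1+ n ] = 0
  negativePart (+ n)    = 0
  negativePart -[1+ n ] = suc n

  subtract : ∀ {n} → Vector ℤ n → Vector ℤ n → Vector ℤ n
  subtract = zipWith ℤ._-_

  -- The hypotheses place `j` between 0 and `i`, so there is no cancellation.
  ∣i-j∣+∣j∣ : ∀ i j → positivePart j ℕ.≤ positivePart i → negativePart j ℕ.≤ negativePart i →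
             ℤ.∣ i ℤ.- j ∣ ℕ.+ ℤ.∣ j ∣ ≡ ℤ.∣ i ∣
  ∣i-j∣+∣j∣ (+ b) (+ a) a≤b _ = trans
    (cong (λ k → ℤ.∣ k ∣ ℕ.+ a) (trans (ℤ.m-n≡m⊖n b a) (ℤ.⊖-≥ a≤b))) (ℕ.m∸n+n≡m a≤b)
  ∣i-j∣+∣j∣ -[1+ b ] (+ zero) _ _ = ℕ.+-identityʳ (suc b)
  ∣i-j∣+∣j∣ -[1+ b ] -[1+ a ] _ a≤b = trans
    (cong (ℕ._+ suc a) (ℤ.∣⊖∣-≤ a≤b)) (ℕ.m∸n+n≡m a≤b)

  size-subtract : ∀ {n} (x y : Vector ℤ n) →
                  (∀ i → positivePart (y i) ℕ.≤ positivePart (x i) × negativePart (y i) ℕ.≤ negativePart (x i)) →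
                  size (subtract x y) ℕ.+ size y ≡ size x
  size-subtract {zero}  x y y≤x = refl
  size-subtract {suc n} x y y≤x = trans
    (regroup ℤ.∣ x zero ℤ.- y zero ∣ (size (subtract (tail x) (tail y))) ℤ.∣ y zero ∣ (size (tail y)))
    (cong₂ ℕ._+_ (∣i-j∣+∣j∣ (x zero) (y zero) (proj₁ (y≤x zero)) (proj₂ (y≤x zero)))
                 (size-subtract (tail x) (tail y) (y≤x ∘ suc)))
    where
    regroup : ∀ a b c d → (a ℕ.+ b) ℕ.+ (c ℕ.+ d) ≡ (a ℕ.+ c) ℕ.+ (b ℕ.+ d)
    regroup a b c d = trans (ℕ.+-assoc a b (c ℕ.+ d)) (trans (cong (a ℕ.+_)
      (trans (sym (ℕ.+-assoc b c d)) (trans (cong (ℕ._+ d) (ℕ.+-comm b c)) (ℕ.+-assoc c b d))))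
      (sym (ℕ.+-assoc a c (b ℕ.+ d))))

  size>0 : ∀ {n} (x : Vector ℤ n) i → x i ≢ + 0 → 0 ℕ.< size x
  size>0 x zero x≢0 = ℕ.<-≤-trans (ℕ.n≢0⇒n>0 (x≢0 ∘ ℤ.∣i∣≡0⇒i≡0)) (ℕ.m≤m+n ℤ.∣ x zero ∣ (size (tail x)))
  size>0 x (suc i) x≢0 = ℕ.<-≤-trans (size>0 (tail x) i x≢0) (ℕ.m≤n+m (size (tail x)) ℤ.∣ x zero ∣)

  -- Lets the absolute value of a nonpositive form serve as a natural-number measure in Dickson's
  -- lemma.
  ∣i∣≤∣j∣⇒j≤i : ∀ {i j} → i ℤ.≤ + 0 → j ℤ.≤ + 0 → ℤ.∣ i ∣ ℕ.≤ ℤ.∣ j ∣ → j ℤ.≤ i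
  ∣i∣≤∣j∣⇒j≤i {+ zero}   {j}      _ j≤0 _ = j≤0
  ∣i∣≤∣j∣⇒j≤i { -[1+ m ]} {+ zero} _ _ ()
  ∣i∣≤∣j∣⇒j≤i { -[1+ m ]} { -[1+ n ]} _ _ (ℕ.s≤s m≤n) = ℤ.-≤- m≤n
  ∣i∣≤∣j∣⇒j≤i { -[1+ m ]} {+ suc n} _ (ℤ.+≤+ ()) _
  ∣i∣≤∣j∣⇒j≤i {+ suc m} (ℤ.+≤+ ()) _ _

  dot-subtract : ∀ {n} (a x y : Vector ℤ n) → dot a (subtract x y) ≡ dot a x ℤ.- dot a y
  dot-subtract {zero}  a x y = refl
  dot-subtract {suc n} a x y = trans (cong (λ s → a zero ℤ.* (x zero ℤ.- y zero) ℤ.+ s) (dot-subtract (tail a) (tail x) (tail y)))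
    (regroup (a zero) (x zero) (y zero) (dot (tail a) (tail x)) (dot (tail a) (tail y)))
    where
    regroup : ∀ a x y s t → a ℤ.* (x ℤ.- y) ℤ.+ (s ℤ.- t) ≡ (a ℤ.* x ℤ.+ s) ℤ.- (a ℤ.* y ℤ.+ t)
    regroup = ℤ-ring

  evalℤ-shift : ∀ {n} (f : ℤ-Form n) {x y m : Vector ℤ n} → (∀ i → x i ≡ y i ℤ.+ m i) →
                evalℤ f x ≡ evalℤ f y ℤ.+ dot (proj₁ f) m
  evalℤ-shift (a , b) {x} {y} {m} x≡y+m = trans (cong (ℤ._+ b) (trans (dot-cong a x≡y+m) (dot-+ʳ a y m)))
    (regroup (dot a y) (dot a m) b)
    where
    regroup : ∀ s t b → s ℤ.+ t ℤ.+ b ≡ s ℤ.+ b ℤ.+ t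
    regroup = ℤ-ring

  -- The monoid of the directions along which ⋀ { f ≤ 0 ∣ f ∈ fs } and all congruences modulo N persist.
  Cone : ∀ {n} → List (ℤ-Form n) → ℕ → Vector ℤ n → Set
  Cone fs N m = All (λ f → dot (proj₁ f) m ℤ.≤ + 0) fs × (∀ i → + N ∣ m i)

  cone-resp : ∀ {n} {fs : List (ℤ-Form n)} {N x y} → (∀ i → x i ≡ y i) → Cone fs N x → Cone fs N y
  cone-resp x≡y (nonpos , N∣) =
    All.map (λ {f} → subst (ℤ._≤ + 0) (dot-cong (proj₁ f) x≡y)) nonpos , λ i → subst (_ ∣_) (x≡y i) (N∣ i)

  cone-0 : ∀ {n} {fs : List (ℤ-Form n)} {N} → Cone fs N (replicate n (+ 0))
  cone-0 = All.tabulate (λ {f} _ → ℤ.≤-reflexive (dot-zeroʳ (proj₁ f))) , λ _ → divides (+ 0) refl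
    where
    dot-zeroʳ : ∀ {n} (a : Vector ℤ n) → dot a (replicate n (+ 0)) ≡ + 0
    dot-zeroʳ {zero}  a = refl
    dot-zeroʳ {suc n} a = cong₂ ℤ._+_ (ℤ.*-zeroʳ (a zero)) (dot-zeroʳ (tail a))

  cone-+ : ∀ {n} {fs : List (ℤ-Form n)} {N x y} → Cone fs N x → Cone fs N y → Cone fs N (zipWith ℤ._+_ x y)
  cone-+ {x = x} {y} (nonpos , N∣) (nonpos′ , N∣′) =
    All.tabulate (λ {f} f∈ → subst (ℤ._≤ + 0) (sym (dot-+ʳ (proj₁ f) x y)) (ℤ.+-mono-≤ (All.lookup nonpos f∈) (All.lookup nonpos′ f∈)))
    , λ i → ∣.∣m∣n⇒∣m+n (N∣ i) (N∣′ i)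

  ∈*⇒cone : ∀ {n} {fs : List (ℤ-Form n)} {N P m} → All (Cone fs N) P → m ∈* P → Cone fs N m
  ∈*⇒cone {fs = fs} {N} {P} P⊆ (ps , ps⊆P , m≡) = cone-resp {fs = fs} (sym ∘ m≡) (sum-cone ps ps⊆P)
    where
    sum-cone : ∀ ps → All (_∈ P) ps → Cone fs N (foldr (zipWith ℤ._+_) (replicate _ (+ 0)) ps)
    sum-cone [] [] = cone-0 {fs = fs}
    sum-cone (p ∷ ps) (p∈ ∷ ps⊆P) = cone-+ {fs = fs} {x = p} (All.lookup P⊆ p∈) (sum-cone ps ps⊆P)

  same-residue⇒∣ : ∀ N .{{_ : ℕ.NonZero N}} x y → x ℤ.%ℕ N ≡ y ℤ.%ℕ N → + N ∣ x ℤ.- y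
  same-residue⇒∣ N x y x%≡y% = divides ((x ℤ./ℕ N) ℤ.- (y ℤ./ℕ N))
    (trans (cong₂ ℤ._-_ (ℤ.a≡a%ℕn+[a/ℕn]*n x N) (trans (ℤ.a≡a%ℕn+[a/ℕn]*n y N) (cong (λ r → + r ℤ.+ (y ℤ./ℕ N) ℤ.* + N) (sym x%≡y%))))
      (regroup (+ (x ℤ.%ℕ N)) (x ℤ./ℕ N) (y ℤ./ℕ N) (+ N)))
    where
    regroup : ∀ r p q N → (r ℤ.+ p ℤ.* N) ℤ.- (r ℤ.+ q ℤ.* N) ≡ (p ℤ.- q) ℤ.* N
    regroup = ℤ-ring

open Cones public

-- Dickson's lemma and finite generation

module SemiLinear (em : ExcludedMiddle 0ℓ) where

  Dominates : {X : Set} → List (X → ℕ) → X → X → Set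
  Dominates gs y x = All (λ g → g x ℕ.≤ g y) gs

  -- Induction on the measures. Let `F₀` work for `gs` alone. If `g s` reaches the bound `B` of `g`
  -- on `F₀`, an element of `F₀` below `s` for `gs` is below it for `g` too. The remaining `s` lie
  -- on the finitely many levels `g s < B`, and each level has its own finite list.
  dickson : {X : Set} (gs : List (X → ℕ)) (S : X → Set) →
            ∃[ F ] (All S F × (∀ s → S s → Any (Dominates gs s) F))
  dickson {X} [] S with em {∃[ s ] S s}
  ... | yes (s , Ss) = s ∷ [] , Ss ∷ [] , λ _ _ → here []
  ... | no none = [] , [] , λ s Ss → contradiction (s , Ss) none
  dickson {X} (g ∷ gs) S = F , S-F , dominated
    where
    level : ℕ → X → Set
    level v s = S s × g s ≡ v
    F₀ : List X
    F₀ = proj₁ (dickson gs S)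
    levels : ℕ → List X
    levels v = proj₁ (dickson gs (level v))
    B : ℕ
    -- The sum serves as an upper bound of all `g f` with `f` in `F₀`.
    B = ℕ.sum (List.map g F₀)
    F : List X
    F = F₀ ++ concatMap levels (List.upTo B)
    S-F : All S F
    S-F = All.++⁺ (proj₁ (proj₂ (dickson gs S))) (All.concat⁺ (All.map⁺ {f = levels} (All.tabulate {xs = List.upTo B} λ {v} _ →
      All.map proj₁ (proj₁ (proj₂ (dickson gs (level v)))))))
    g≤B : ∀ {f fs} → f ∈ fs → g f ℕ.≤ ℕ.sum (List.map g fs)
    g≤B {fs = f ∷ fs} (here refl) = ℕ.m≤m+n (g f) _
    g≤B {fs = f ∷ fs} (there f∈) = ℕ.≤-trans (g≤B f∈) (ℕ.m≤n+m _ (g f))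
    dominated : ∀ s → S s → Any (Dominates (g ∷ gs) s) F
    dominated s Ss with ℕ.<-≤-connex (g s) B
    ... | inj₂ B≤gs = Any.++⁺ˡ (lose f∈ (ℕ.≤-trans (g≤B f∈) B≤gs ∷ proj₂ (proj₂ found)))
      where
      found = find (proj₂ (proj₂ (dickson gs S)) s Ss)
      f∈ = proj₁ (proj₂ found)
    ... | inj₁ gs<B = Any.++⁺ʳ F₀ (Any.concatMap⁺ levels (lose (∈-upTo⁺ gs<B) (lose f∈
        (ℕ.≤-reflexive (proj₂ (All.lookup (proj₁ (proj₂ (dickson gs (level (g s))))) f∈)) ∷ proj₂ (proj₂ found)))))
      where
      found = find (proj₂ (proj₂ (dickson gs (level (g s)))) s (Ss , refl))
      f∈ = proj₁ (proj₂ found)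

  module _ {n} (fs : List (ℤ-Form n)) (N : ℕ) where

    -- If `y` is below `x` in these measures, the first kind keeps `x - y` in the cone, and the
    -- signed parts make the size of `x - y` equal to the difference of the sizes.
    coneMeasures : List (Vector ℤ n → ℕ)
    coneMeasures = List.map (λ f m → ℤ.∣ dot (proj₁ f) m ∣) fs
      ++ List.map (λ i m → positivePart (m i)) (List.allFin n)
      ++ List.map (λ i m → negativePart (m i)) (List.allFin n)

    NonzeroCone : Vector ℤ n → Set
    NonzeroCone m = Cone fs N m × ∃[ i ] (m i ≢ + 0)

    generators : List (Vector ℤ n)
    generators = proj₁ (dickson coneMeasures NonzeroCone)

    generators⊆ : All NonzeroCone generators
    generators⊆ = proj₁ (proj₂ (dickson coneMeasures NonzeroCone))

    cone-subtract : ∀ {x y} → Cone fs N x → Cone fs N y → Dominates coneMeasures x y →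
                    Cone fs N (subtract x y) × size (subtract x y) ℕ.+ size y ≡ size x
    cone-subtract {x} {y} (x≤0 , N∣x) (y≤0 , N∣y) y≤x =
        (All.tabulate (λ {f} f∈ → subst (ℤ._≤ + 0) (sym (dot-subtract (proj₁ f) x y))
          (ℤ.i≤j⇒i-j≤0 (∣i∣≤∣j∣⇒j≤i (All.lookup y≤0 f∈) (All.lookup x≤0 f∈)
            (All.lookup (All.map⁻ (All.++⁻ˡ slacks y≤x)) f∈))))
        , λ i → ∣.∣m∣n⇒∣m-n (N∣x i) (N∣y i))
      , size-subtract x y (λ i →
          All.lookup (All.map⁻ (All.++⁻ˡ positives parts)) (∈-allFin i)
        , All.lookup (All.map⁻ (All.++⁻ʳ positives parts)) (∈-allFin i))
      where
      slacks positives : List (Vector ℤ n → ℕ)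
      slacks = List.map (λ f m → ℤ.∣ dot (proj₁ f) m ∣) fs
      positives = List.map (λ i m → positivePart (m i)) (List.allFin n)
      parts = All.++⁻ʳ slacks y≤x

    -- Gordan's lemma: a nonzero `m` lies above some generator, and the difference is a smaller
    -- element of the cone.
    cone⇒∈* : ∀ m → Acc ℕ._<_ (size m) → Cone fs N m → m ∈* generators
    cone⇒∈* m (acc smaller) m∈ with em {∃[ i ] (m i ≢ + 0)}
    ... | no none = [] , [] , λ i → decided i
      where
      decided : ∀ i → m i ≡ + 0
      decided i with m i ℤ.≟ + 0
      ... | yes m≡0 = m≡0
      ... | no m≢0 = contradiction (i , m≢0) none
    ... | yes nonzero with find (proj₂ (proj₂ (dickson coneMeasures NonzeroCone)) m (m∈ , nonzero))
    ...   | p , p∈ , p≤m with All.lookup generators⊆ p∈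
    ...     | p∈cone , i , pi≢0 with cone-subtract m∈ p∈cone p≤m
    ...       | m-p∈ , size≡ with cone⇒∈* (subtract m p)
                  (smaller (subst (size (subtract m p) ℕ.<_) size≡ (ℕ.m<m+n (size (subtract m p)) (size>0 p i pi≢0)))) m-p∈
    ...         | ps , ps⊆ , m-p≡ = p ∷ ps , p∈ ∷ ps⊆ , λ j →
                  trans (regroup (m j) (p j)) (cong (λ s → p j ℤ.+ s) (m-p≡ j))
      where
      regroup : ∀ x y → x ≡ y ℤ.+ (x ℤ.- y)
      regroup = ℤ-ring

    cone⇔∈* : ∀ m → Cone fs N m ⇔ m ∈* generators
    cone⇔∈* m = mk⇔ (cone⇒∈* m (<-wellFounded (size m))) (∈*⇒cone {fs = fs} (All.map proj₁ generators⊆))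

    module _ .{{_ : ℕ.NonZero N}} (Z : Vector ℤ n → Set) where

      -- A residue r and its complement `N - r` are both measured, so that domination forces equal
      -- residues.
      baseMeasures : List (Vector ℤ n → ℕ)
      baseMeasures = List.map (λ f z → ℤ.∣ evalℤ f z ∣) fs
        ++ List.map (λ i z → z i ℤ.%ℕ N) (List.allFin n)
        ++ List.map (λ i z → N ℕ.∸ z i ℤ.%ℕ N) (List.allFin n)

      bases : List (Vector ℤ n)
      bases = proj₁ (dickson baseMeasures Z)

      _∈base+cone_ : Vector ℤ n → List (Vector ℤ n) → Set
      z ∈base+cone bs = Any (λ b → ∃[ m ] (m ∈* generators × (∀ i → z i ≡ b i ℤ.+ m i))) bs

      cone-difference : ∀ {z b} → All (λ f → evalℤ f z ℤ.≤ + 0) fs → All (λ f → evalℤ f b ℤ.≤ + 0) fs →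
                        Dominates baseMeasures z b → Cone fs N (subtract z b)
      cone-difference {z} {b} z≤0 b≤0 b≤z =
          All.tabulate (λ {f} f∈ → subst (ℤ._≤ + 0) (sym (form-difference f))
            (ℤ.i≤j⇒i-j≤0 (∣i∣≤∣j∣⇒j≤i (All.lookup b≤0 f∈) (All.lookup z≤0 f∈)
              (All.lookup (All.map⁻ (All.++⁻ˡ slacks b≤z)) f∈))))
        , λ i → same-residue⇒∣ N (z i) (b i) (sym (ℕ.≤-antisym
            (All.lookup (All.map⁻ (All.++⁻ˡ residues parts)) (∈-allFin i))
            (ℕ.∸-cancelʳ-≤ (ℕ.<⇒≤ (ℤ.n%ℕd<d (z i) N))
              (All.lookup (All.map⁻ (All.++⁻ʳ residues parts)) (∈-allFin i)))))
        where
        slacks residues : List (Vector ℤ n → ℕ)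
        slacks = List.map (λ f z → ℤ.∣ evalℤ f z ∣) fs
        residues = List.map (λ i z → z i ℤ.%ℕ N) (List.allFin n)
        parts = All.++⁻ʳ slacks b≤z
        form-difference : ∀ f → dot (proj₁ f) (subtract z b) ≡ evalℤ f z ℤ.- evalℤ f b
        form-difference (a , k) = trans (dot-subtract a z b) (regroup (dot a z) (dot a b) k)
          where
          regroup : ∀ s t k → s ℤ.- t ≡ s ℤ.+ k ℤ.- (t ℤ.+ k)
          regroup = ℤ-ring

      -- Each `z` of `Z` lies above some base `b`, again by Dickson's lemma. By the choice of
      -- measures, `z - b` satisfies the homogeneous inequalities and is divisible by `N`, so it is
      -- in the cone.
      semilinear : (∀ {z} → Z z → All (λ f → evalℤ f z ℤ.≤ + 0) fs) →
                   (∀ {z b m} → Z b → Cone fs N m → (∀ i → z i ≡ b i ℤ.+ m i) → Z z) →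
                   ∀ z → Z z ⇔ z ∈base+cone bases
      semilinear Z⊆ Z-closed z = mk⇔
        (λ Zz → let b , b∈ , b≤z = find (proj₂ (proj₂ (dickson baseMeasures Z)) z Zz)
                    Zb = All.lookup (proj₁ (proj₂ (dickson baseMeasures Z))) b∈
                in lose b∈ (subtract z b
                     , Equivalence.to (cone⇔∈* (subtract z b)) (cone-difference (Z⊆ Zz) (Z⊆ Zb) b≤z)
                     , λ i → regroup (z i) (b i)))
        (λ any → let b , b∈ , m , m∈ , z≡ = find any
                 in Z-closed (All.lookup (proj₁ (proj₂ (dickson baseMeasures Z))) b∈)
                      (Equivalence.from (cone⇔∈* m) m∈) z≡)
        where
        regroup : ∀ x y → x ≡ y ℤ.+ (x ℤ.- y)
        regroup = ℤ-ring

-- Disjunctive normal form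

module NormalForm where

  open +-*-Solver using (solve; con; _:*_; _:+_; _:-_; :-_; _:=_)

  -- Real and integer atoms are collected apart, so the solutions are the product of a polyhedron
  -- and a set of integer points. The Boolean is `false` for a negated congruence, which is as
  -- periodic as a positive one.
  record Conjunction (n : ℕ) : Set where
    constructor mkConjunction
    field
      constraints  : PolyhedralConvex n
      inequalities : List (ℤ-Form n)
      congruences  : List (Bool × ℕ × ℤ-Form n)

  open Conjunction

  Congruence : ∀ {n} → Vector ℤ n → Bool × ℕ × ℤ-Form n → Set
  Congruence z (true  , d , f) = + suc d ∣ evalℤ f z
  Congruence z (false , d , f) = ¬ + suc d ∣ evalℤ f z

  SatInteger : ∀ {n} → Vector ℤ n → Conjunction n → Set
  SatInteger z K = All (λ f → evalℤ f z ℤ.≤ + 0) (inequalities K) × All (Congruence z) (congruences K)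

  SatConjunction : ∀ {n} → Vector ℝ n → Vector ℤ n → Conjunction n → Set
  SatConjunction c z K = c ∈ᶜ constraints K × SatInteger z K

  _⋏_ : ∀ {n} → Conjunction n → Conjunction n → Conjunction n
  mkConjunction cs is ds ⋏ mkConjunction cs′ is′ ds′ = mkConjunction (cs ++ cs′) (is ++ is′) (ds ++ ds′)

  dnf dnf¬ : ∀ {n} → QF n → List (Conjunction n)
  dnf (realᵠ (a , b))  = mkConjunction (mkConstraint a Comparison.le (ℚ.- b) ∷ []) [] [] ∷ []
  dnf (intᵠ f)         = mkConjunction [] (f ∷ []) [] ∷ []
  dnf (dividesᵠ d f)   = mkConjunction [] [] ((true , d , f) ∷ []) ∷ []
  dnf (φ ∧ᵠ ψ)         = cartesianProductWith _⋏_ (dnf φ) (dnf ψ)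
  dnf (¬ᵠ φ)           = dnf¬ φ
  dnf¬ (realᵠ (a , b)) = mkConjunction (mkConstraint a Comparison.gt (ℚ.- b) ∷ []) [] [] ∷ []
  -- Over the integers, f > 0 is the weak inequality 1 - f ≤ 0.
  dnf¬ (intᵠ f)        = mkConjunction [] (constℤ (+ 1) +ᶻ ℤ.- + 1 *ᶻ f ∷ []) [] ∷ []
  dnf¬ (dividesᵠ d f)  = mkConjunction [] [] ((false , d , f) ∷ []) ∷ []
  dnf¬ (φ ∧ᵠ ψ)        = dnf¬ φ ++ dnf¬ ψ
  dnf¬ (¬ᵠ φ)          = dnf φ

  Sat-⋏ : ∀ {n} {c : Vector ℝ n} {z} K K′ →
          SatConjunction c z (K ⋏ K′) ⇔ (SatConjunction c z K × SatConjunction c z K′)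
  Sat-⋏ K K′ = mk⇔
    (λ (cs , is , ds) → (All.++⁻ˡ (constraints K) cs , All.++⁻ˡ (inequalities K) is , All.++⁻ˡ (congruences K) ds)
                      , (All.++⁻ʳ (constraints K) cs , All.++⁻ʳ (inequalities K) is , All.++⁻ʳ (congruences K) ds))
    (λ ((cs , is , ds) , (cs′ , is′ , ds′)) → All.++⁺ cs cs′ , All.++⁺ is is′ , All.++⁺ ds ds′)

  a·c≤-b⇔ : ∀ {n} ((a , b) : ℚ-Form n) c → a ·ᵛ c ≤ fromℚ (ℚ.- b) ⇔ evalℝ (a , b) c ≤ 0ℝ
  a·c≤-b⇔ (a , b) c = ⇔-trans (⇔-sym (x-y≤0⇔x≤y (a ·ᵛ c) (fromℚ (ℚ.- b)))) (≈⇒≤0⇔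
    (pointwise λ k → solve 2 (λ x b → x :+ con (ℚ.- 1ℚ) :* (:- b) := x :+ b) refl (seq (a ·ᵛ c) k) b))

  lowerBound upperBound : ∀ {n} → Fin n → Constraint n
  lowerBound i = mkConstraint (ι ∘ unit i) Comparison.ge 0ℚ
  upperBound i = mkConstraint (ι ∘ unit i) Comparison.lt 1ℚ

  cubeConstraints : ∀ n → PolyhedralConvex n
  cubeConstraints n = List.map lowerBound (List.allFin n) ++ List.map upperBound (List.allFin n)

  modulusOf : ∀ {n} → List (Bool × ℕ × ℤ-Form n) → ℕ
  modulusOf []                = 1
  modulusOf ((_ , d , _) ∷ ds) = suc d ℕ.* modulusOf ds

  modulusOf≢0 : ∀ {n} (ds : List (Bool × ℕ × ℤ-Form n)) → ℕ.NonZero (modulusOf ds)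
  modulusOf≢0 []                = _
  modulusOf≢0 ((_ , d , _) ∷ ds) = ℕ.m*n≢0 (suc d) (modulusOf ds) {{_}} {{modulusOf≢0 ds}}

  congruences-periodic : ∀ {n} (ds : List (Bool × ℕ × ℤ-Form n)) {x y} →
    (∀ i → + modulusOf ds ∣ x i ℤ.- y i) → All (Congruence y) ds → All (Congruence x) ds
  congruences-periodic [] _ [] = []
  congruences-periodic ((sign , d , f) ∷ ds) {x} {y} N∣ (p ∷ ps) =
      periodic sign p ∷ congruences-periodic ds (λ i → ∣.∣-trans (n∣+m*n (suc d) (modulusOf ds)) (N∣ i)) ps
    where
    same : + suc d ∣ evalℤ f x ⇔ + suc d ∣ evalℤ f y
    same = ∣evalℤ f λ i → ∣.∣-trans (m∣+m*n (suc d) (modulusOf ds)) (N∣ i)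
    periodic : ∀ sign → Congruence y (sign , d , f) → Congruence x (sign , d , f)
    periodic true  p  = Equivalence.from same p
    periodic false ¬p = ¬p ∘ Equivalence.to same

open NormalForm public

-- Definable sets are semi-polinear

module SemiPolinearSets (em : ExcludedMiddle 0ℓ) where

  open ClassicalOrder em
  open Translation em
  open SemiLinear em
  open Conjunction

  ≰⇔> : ∀ {x y} → (¬ x ≤ y) ⇔ (y < x)
  ≰⇔> = mk⇔ ≰⇒> <⇒≱

  f≰0⇒1-f≤0 : ∀ {n} (f : ℤ-Form n) z → (¬ evalℤ f z ℤ.≤ + 0) ⇔ (evalℤ (constℤ (+ 1) +ᶻ ℤ.- + 1 *ᶻ f) z ℤ.≤ + 0)
  f≰0⇒1-f≤0 f z rewrite trans (evalℤ-+ (constℤ (+ 1)) (ℤ.- + 1 *ᶻ f) z)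
      (cong₂ ℤ._+_ (evalℤ-const (+ 1) z) (trans (evalℤ-* (ℤ.- + 1) f z) (ℤ.-1*i≡-i (evalℤ f z)))) = mk⇔
    (λ f≰0 → ℤ.i≤j⇒i-j≤0 (ℤ.i<j⇒suc[i]≤j (ℤ.≰⇒> f≰0)))
    (λ 1-f≤0 → ℤ.<⇒≱ (ℤ.suc[i]≤j⇒i<j (ℤ.i-j≤0⇒i≤j 1-f≤0)))

  dnf-correct  : ∀ {n} (φ : QF n) {c z} → Sat c z φ ⇔ Any (SatConjunction c z) (dnf φ)
  dnf¬-correct : ∀ {n} (φ : QF n) {c z} → (¬ Sat c z φ) ⇔ Any (SatConjunction c z) (dnf¬ φ)
  dnf-correct (realᵠ f) {c} {z} = mk⇔
    (λ p → here (Equivalence.from (a·c≤-b⇔ f c) p ∷ [] , [] , []))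
    (λ { (here (p ∷ [] , _)) → Equivalence.to (a·c≤-b⇔ f c) p })
  dnf-correct (intᵠ f) = mk⇔ (λ p → here ([] , p ∷ [] , [])) (λ { (here (_ , p ∷ [] , _)) → p })
  dnf-correct (dividesᵠ d f) = mk⇔ (λ p → here ([] , [] , p ∷ [])) (λ { (here (_ , _ , p ∷ [])) → p })
  dnf-correct (φ ∧ᵠ ψ) {c} {z} = mk⇔
    (λ (p , q) → Any.cartesianProductWith⁺ _⋏_ (λ {K} {K′} p q → Equivalence.from (Sat-⋏ {c = c} {z} K K′) (p , q))
      (Equivalence.to (dnf-correct φ) p) (Equivalence.to (dnf-correct ψ) q))
    (λ any → Product.map (Equivalence.from (dnf-correct φ)) (Equivalence.from (dnf-correct ψ))
      (Any.cartesianProductWith⁻ _⋏_ (λ {K} {K′} → Equivalence.to (Sat-⋏ {c = c} {z} K K′)) (dnf φ) (dnf ψ) any))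
  dnf-correct (¬ᵠ φ) = dnf¬-correct φ
  dnf¬-correct (realᵠ f) {c} {z} = ⇔-trans (¬-⇔ (⇔-sym (a·c≤-b⇔ f c))) (⇔-trans ≰⇔>
    (mk⇔ (λ p → here (p ∷ [] , [] , [])) (λ { (here (p ∷ [] , _)) → p })))
  dnf¬-correct (intᵠ f) {c} {z} = ⇔-trans (f≰0⇒1-f≤0 f z)
    (mk⇔ (λ p → here ([] , p ∷ [] , [])) (λ { (here (_ , p ∷ [] , _)) → p }))
  dnf¬-correct (dividesᵠ d f) = mk⇔ (λ p → here ([] , [] , p ∷ [])) (λ { (here (_ , _ , p ∷ [])) → p })
  dnf¬-correct (φ ∧ᵠ ψ) {c} {z} = mk⇔
    (λ ¬pq → Sum.[ Any.++⁺ˡ ∘ Equivalence.to (dnf¬-correct φ) , Any.++⁺ʳ (dnf¬ φ) ∘ Equivalence.to (dnf¬-correct ψ) ]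
      (¬×⇒¬⊎¬ ¬pq))
    (λ any (p , q) → Sum.[ (λ p′ → Equivalence.from (dnf¬-correct φ) p′ p) , (λ q′ → Equivalence.from (dnf¬-correct ψ) q′ q) ]
      (Any.++⁻ (dnf¬ φ) any))
    where
    ¬×⇒¬⊎¬ : {A B : Set} → ¬ (A × B) → ¬ A ⊎ ¬ B
    ¬×⇒¬⊎¬ {A} ¬ab with em {A}
    ... | yes a = inj₂ λ b → ¬ab (a , b)
    ... | no ¬a = inj₁ ¬a
  dnf¬-correct (¬ᵠ φ) {c} {z} = ⇔-trans (mk⇔ ¬¬-elim contradiction) (dnf-correct φ)

  ∈cube⇔ : ∀ {n} (c : Vector ℝ n) → c ∈ᶜ cubeConstraints n ⇔ InUnitCube c
  ∈cube⇔ {n} c = mk⇔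
    (λ c∈ i → ≤-trans (All.lookup (All.map⁻ (All.++⁻ˡ (List.map lowerBound (List.allFin n)) c∈)) (∈-allFin i)) (≈⇒≤ (unit-∙ᵛ i c))
            , ≤-<-trans (≈⇒≤ (≈-sym (unit-∙ᵛ i c))) (All.lookup (All.map⁻ (All.++⁻ʳ (List.map lowerBound (List.allFin n)) c∈)) (∈-allFin i)))
    (λ c∈ → All.++⁺
      (All.map⁺ {f = lowerBound} (All.tabulate {xs = List.allFin n} λ {i} _ → ≤-trans (proj₁ (c∈ i)) (≈⇒≤ (≈-sym (unit-∙ᵛ i c)))))
      (All.map⁺ {f = upperBound} (All.tabulate {xs = List.allFin n} λ {i} _ → ≤-<-trans (≈⇒≤ (unit-∙ᵛ i c)) (proj₂ (c∈ i)))))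

  module _ {n} (K : Conjunction n) where

    -- The cube is imposed explicitly because a polinear set requires its polyhedron to lie in it.
    cell : PolyhedralConvex n
    cell = cubeConstraints n ++ constraints K

    N : ℕ
    N = modulusOf (congruences K)

    P : List (Vector ℤ n)
    P = generators (inequalities K) N

    instance
      N≢0 : ℕ.NonZero N
      N≢0 = modulusOf≢0 (congruences K)

    B : List (Vector ℤ n)
    B = bases (inequalities K) N (λ z → SatInteger z K)

    SatInteger⇔ : ∀ z → SatInteger z K ⇔ Any (λ b → ∃[ m ] (m ∈* P × (∀ i → z i ≡ b i ℤ.+ m i))) B
    SatInteger⇔ = semilinear (inequalities K) N (λ z → SatInteger z K) proj₁
      λ {z} {b} {m} (b≤0 , congruent) (m≤0 , N∣m) z≡b+m →
        All.tabulate (λ {f} f∈ → subst (ℤ._≤ + 0) (sym (evalℤ-shift f {z} {b} {m} z≡b+m))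
          (ℤ.+-mono-≤ (All.lookup b≤0 f∈) (All.lookup m≤0 f∈)))
        , congruences-periodic (congruences K)
            (λ i → subst (+ N ∣_) (sym (trans (cong (ℤ._- b i) (z≡b+m i)) (cancel (b i) (m i)))) (N∣m i)) congruent
      where
      cancel : ∀ b m → b ℤ.+ m ℤ.- b ≡ m
      cancel = ℤ-ring

    polinear : ∃[ c ] c ∈ᶜ cell → Vector ℤ n → Polinear n
    polinear nonEmpty b = record
      { C        = cell
      ; C⊆cube   = λ c c∈ → Equivalence.to (∈cube⇔ c) (All.++⁻ˡ (cubeConstraints n) c∈)
      ; nonEmpty = nonEmpty
      ; b        = b
      ; P        = P
      }

    -- A polinear set requires a non-empty polyhedron. An empty cell contributes no points, hence no
    -- polinear sets; otherwise each base of the integer part gives one.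
    polinears : Dec (∃[ c ] c ∈ᶜ cell) → SemiPolinear n
    polinears (no _)         = []
    polinears (yes nonEmpty) = List.map (polinear nonEmpty) B

    Occupied : Vector ℝ n → Set
    Occupied x = ∃[ c ] ∃[ z ] (InUnitCube c × x ≋ c ⊕ z × SatConjunction c z K)

    ∈polinears⇔ : ∀ nonEmpty? x → x ∈ˢ polinears nonEmpty? ⇔ Occupied x
    ∈polinears⇔ (no empty) x = mk⇔ (λ ()) λ (c , z , c∈ , _ , cs , _) →
      contradiction (c , All.++⁺ (Equivalence.from (∈cube⇔ c) c∈) cs) empty
    ∈polinears⇔ (yes nonEmpty) x = mk⇔
      (occupied ∘ find ∘ Any.map⁻)
      (λ (c , z , c∈ , x≋ , cs , sat) → Any.map⁺ (Any.map
        (λ z∈ → c , z , All.++⁺ (Equivalence.from (∈cube⇔ c) c∈) cs , z∈ , x≋)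
        (Equivalence.to (SatInteger⇔ z) sat)))
      where
      occupied : ∃[ b ] (b ∈ B × x ∈ᵖ polinear nonEmpty b) → Occupied x
      occupied (b , b∈ , c , z , c∈ , z∈ , x≋) =
        c , z , Equivalence.to (∈cube⇔ c) (All.++⁻ˡ (cubeConstraints n) c∈) , x≋
        , All.++⁻ʳ (cubeConstraints n) c∈ , Equivalence.from (SatInteger⇔ z) (lose b∈ z∈)

  SatPoint : ∀ {n} → QF n → Pred (Vector ℝ n) 0ℓ
  SatPoint φ x = ∃[ c ] ∃[ z ] (InUnitCube c × x ≋ c ⊕ z × Sat c z φ)

  QF⇒semiPolinear : ∀ {n} (φ : QF n) → IsSemiPolinear (SatPoint φ)
  QF⇒semiPolinear φ = concatMap (λ K → polinears K em) (dnf φ) , λ x → mk⇔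
    (λ (c , z , c∈ , x≋ , sat) → Any.concatMap⁺ (λ K → polinears K em) (Any.map
      (λ {K} satK → Equivalence.from (∈polinears⇔ K em x) (c , z , c∈ , x≋ , satK))
      (Equivalence.to (dnf-correct φ {c} {z}) sat)))
    (λ any → let K , K∈ , x∈ = find (Any.concatMap⁻ (λ K → polinears K em) any)
                 c , z , c∈ , x≋ , satK = Equivalence.to (∈polinears⇔ K em x) x∈
             in c , z , c∈ , x≋ , Equivalence.from (dnf-correct φ {c} {z}) (lose K∈ satK))

  decompose : ∀ {n} (x : Vector ℝ n) → ∃[ c ] ∃[ z ] (InUnitCube c × x ≋ c ⊕ z)
  decompose x =
      (λ i → proj₁ (fractional-decomposition (x i)))
    , (λ i → proj₁ (proj₂ (fractional-decomposition (x i))))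
    , (λ i → proj₁ (proj₂ (proj₂ (fractional-decomposition (x i)))))
    , (λ i → proj₂ (proj₂ (proj₂ (fractional-decomposition (x i)))))

  definable⇒semiPolinear : ∀ {n} {S : Pred (Vector ℝ n) 0ℓ} → DefinableSet S → IsSemiPolinear S
  definable⇒semiPolinear {S = S} (φ , S⇔φ) = proj₁ semi , λ x → ⇔-trans (S⇔point x) (proj₂ semi x)
    where
    semi : IsSemiPolinear (SatPoint (translate φ))
    semi = QF⇒semiPolinear (translate φ)
    S⇔point : ∀ x → S x ⇔ SatPoint (translate φ) x
    S⇔point x = mk⇔
      (λ s → let c , z , c∈ , x≋ = decompose x
             in c , z , c∈ , x≋ , Equivalence.to (translate-correct φ {c} {z} c∈) (⊨-resp φ x≋ (Equivalence.to (S⇔φ x) s)))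
      (λ (c , z , c∈ , x≋ , sat) → Equivalence.from (S⇔φ x)
        (⊨-resp φ (≋-sym x≋) (Equivalence.from (translate-correct φ {c} {z} c∈) sat)))

-- Closure properties of definability

module Definability where

  renameᵗ : ∀ {m k} → (Fin m → Fin k) → Term m → Term k
  renameᵗ r (var i) = var (r i)
  renameᵗ r (s ⊞ t) = renameᵗ r s ⊞ renameᵗ r t

  lift : ∀ {m k} → (Fin m → Fin k) → Fin (suc m) → Fin (suc k)
  lift r zero    = zero
  lift r (suc i) = suc (r i)

  rename : ∀ {m k} → (Fin m → Fin k) → Formula m → Formula k
  rename r (s ≤ᶠ t) = renameᵗ r s ≤ᶠ renameᵗ r t
  rename r (s ≈ᶠ t) = renameᵗ r s ≈ᶠ renameᵗ r t
  rename r (isℤ t)  = isℤ (renameᵗ r t)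
  rename r (¬ᶠ φ)   = ¬ᶠ rename r φ
  rename r (φ ∧ᶠ ψ) = rename r φ ∧ᶠ rename r ψ
  rename r (φ ∨ᶠ ψ) = rename r φ ∨ᶠ rename r ψ
  rename r (∀ᶠ φ)   = ∀ᶠ rename (lift r) φ
  rename r (∃ᶠ φ)   = ∃ᶠ rename (lift r) φ

  ⟦renameᵗ⟧ : ∀ {m k} (r : Fin m → Fin k) t {v w} → w ≋ v ∘ r → ⟦ t ⟧ w ≈ ⟦ renameᵗ r t ⟧ v
  ⟦renameᵗ⟧ r (var i) w≋ = w≋ i
  ⟦renameᵗ⟧ r (s ⊞ t) w≋ = +-cong (⟦renameᵗ⟧ r s w≋) (⟦renameᵗ⟧ r t w≋)

  ≋-lift : ∀ {m k} (r : Fin m → Fin k) {v w} x → w ≋ v ∘ r → (x ◂ w) ≋ (x ◂ v) ∘ lift r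
  ≋-lift r x w≋ zero    = ≈-refl
  ≋-lift r x w≋ (suc i) = w≋ i

  ⊨-rename : ∀ {m k} (r : Fin m → Fin k) φ {v w} → w ≋ v ∘ r → (w ⊨ φ) ⇔ (v ⊨ rename r φ)
  ⊨-rename r (s ≤ᶠ t) w≋ = mk⇔ (≤-resp (⟦renameᵗ⟧ r s w≋) (⟦renameᵗ⟧ r t w≋))
    (≤-resp (≈-sym (⟦renameᵗ⟧ r s w≋)) (≈-sym (⟦renameᵗ⟧ r t w≋)))
  ⊨-rename r (s ≈ᶠ t) w≋ = mk⇔
    (λ e → ≈-trans (≈-sym (⟦renameᵗ⟧ r s w≋)) (≈-trans e (⟦renameᵗ⟧ r t w≋)))
    (λ e → ≈-trans (⟦renameᵗ⟧ r s w≋) (≈-trans e (≈-sym (⟦renameᵗ⟧ r t w≋))))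
  ⊨-rename r (isℤ t) w≋ = mk⇔ (λ (z , e) → z , ≈-trans (≈-sym (⟦renameᵗ⟧ r t w≋)) e)
    (λ (z , e) → z , ≈-trans (⟦renameᵗ⟧ r t w≋) e)
  ⊨-rename r (¬ᶠ φ) w≋ = ¬-⇔ (⊨-rename r φ w≋)
  ⊨-rename r (φ ∧ᶠ ψ) w≋ = ×-⇔ (⊨-rename r φ w≋) (⊨-rename r ψ w≋)
  ⊨-rename r (φ ∨ᶠ ψ) w≋ = ⊎-⇔ (⊨-rename r φ w≋) (⊨-rename r ψ w≋)
  ⊨-rename r (∀ᶠ φ) w≋ = mk⇔ (λ p x → Equivalence.to (⊨-rename (lift r) φ (≋-lift r x w≋)) (p x))
    (λ p x → Equivalence.from (⊨-rename (lift r) φ (≋-lift r x w≋)) (p x))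
  ⊨-rename r (∃ᶠ φ) w≋ = ∃-⇔ λ x → ⊨-rename (lift r) φ (≋-lift r x w≋)

  -- Definability of a predicate on an arbitrary type of environments, each of which provides
  -- the values of the free variables.
  Def : {E : Set} {m : ℕ} → (E → Vector ℝ m) → (E → Set) → Set
  Def ρ S = ∃[ φ ] (∀ e → S e ⇔ (ρ e ⊨ φ))

  infixl 5 _▸_
  -- New variables come in front, where `exists k` binds them.
  _▸_ : {E : Set} {m : ℕ} → (E → Vector ℝ m) → ∀ k → E × Vector ℝ k → Vector ℝ (k ℕ.+ m)
  (ρ ▸ k) (e , u) = u ⧺ ρ e

  exists : ∀ k {m} → Formula (k ℕ.+ m) → Formula m
  exists zero    φ = φ
  exists (suc k) φ = exists k (∃ᶠ φ)

  ⧺-◂ : ∀ {k m} (u : Vector ℝ (suc k)) (v : Vector ℝ m) → (u ⧺ v) ≋ (u zero ◂ (tail u ⧺ v))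
  ⧺-◂ u v zero = ≈-refl
  ⧺-◂ {k} u v (suc i) with splitAt k i
  ... | inj₁ _ = ≈-refl
  ... | inj₂ _ = ≈-refl

  ⊨-exists : ∀ k {m} (φ : Formula (k ℕ.+ m)) v → (∃[ u ] (u ⧺ v ⊨ φ)) ⇔ (v ⊨ exists k φ)
  ⊨-exists zero    φ v = mk⇔ proj₂ (λ p → (λ ()) , p)
  ⊨-exists (suc k) φ v = ⇔-trans (mk⇔
      (λ (u , p) → tail u , u zero , ⊨-resp φ (⧺-◂ u v) p)
      (λ (u , x , p) → x ◂ u , ⊨-resp φ (≋-sym (⧺-◂ (x ◂ u) v)) p))
    (⊨-exists k (∃ᶠ φ) v)

  module _ {E : Set} {m : ℕ} {ρ : E → Vector ℝ m} where

    def-⇔ : {S T : E → Set} → (∀ e → T e ⇔ S e) → Def ρ S → Def ρ T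
    def-⇔ T⇔S (φ , S⇔φ) = φ , λ e → ⇔-trans (T⇔S e) (S⇔φ e)

    def-× : {S T : E → Set} → Def ρ S → Def ρ T → Def ρ (λ e → S e × T e)
    def-× (φ , S⇔φ) (ψ , T⇔ψ) = (φ ∧ᶠ ψ) , λ e → ×-⇔ (S⇔φ e) (T⇔ψ e)

    def-⊎ : {S T : E → Set} → Def ρ S → Def ρ T → Def ρ (λ e → S e ⊎ T e)
    def-⊎ (φ , S⇔φ) (ψ , T⇔ψ) = (φ ∨ᶠ ψ) , λ e → ⊎-⇔ (S⇔φ e) (T⇔ψ e)

    def-¬ : {S : E → Set} → Def ρ S → Def ρ (λ e → ¬ S e)
    def-¬ (φ , S⇔φ) = ¬ᶠ φ , λ e → ¬-⇔ (S⇔φ e)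

    -- The signature has no constants, so truth is stated with a bound variable, which exists also
    -- when `m` is 0.
    def-⊤ : Def ρ (λ _ → ⊤)
    def-⊤ = ∀ᶠ (var zero ≤ᶠ var zero) , λ e → mk⇔ (λ _ x → ≤-refl) _

    def-∀Fin : ∀ {k} {S : Fin k → E → Set} → (∀ i → Def ρ (S i)) → Def ρ (λ e → ∀ i → S i e)
    def-∀Fin {zero} _ = def-⇔ (λ e → mk⇔ _ (λ _ ())) def-⊤
    def-∀Fin {suc k} S-def = def-⇔
      (λ e → mk⇔ (λ s → s zero , s ∘ suc) λ { (s , _) zero → s ; (_ , s) (suc i) → s i })
      (def-× (S-def zero) (def-∀Fin (S-def ∘ suc)))

    def-∃Fin : ∀ {k} {S : Fin k → E → Set} → (∀ i → Def ρ (S i)) → Def ρ (λ e → ∃[ i ] S i e)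
    def-∃Fin {zero} _ = def-⇔ (λ e → mk⇔ (λ ()) (λ ¬⊤ → contradiction tt ¬⊤)) (def-¬ def-⊤)
    def-∃Fin {suc k} S-def = def-⇔
      (λ e → mk⇔ (λ { (zero , s) → inj₁ s ; (suc i , s) → inj₂ (i , s) })
                 (λ { (inj₁ s) → zero , s ; (inj₂ (i , s)) → suc i , s }))
      (def-⊎ (S-def zero) (def-∃Fin (S-def ∘ suc)))

    def-All : {X : Set} {S : X → E → Set} (xs : List X) → (∀ x → Def ρ (S x)) → Def ρ (λ e → All (λ x → S x e) xs)
    def-All [] _ = def-⇔ (λ e → mk⇔ _ (λ _ → [])) def-⊤
    def-All (x ∷ xs) S-def = def-⇔ (λ e → mk⇔ All.uncons (λ (s , ss) → s ∷ ss)) (def-× (S-def x) (def-All xs S-def))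

    def-Any : {X : Set} {S : X → E → Set} (xs : List X) → (∀ x → Def ρ (S x)) → Def ρ (λ e → Any (λ x → S x e) xs)
    def-Any [] _ = def-⇔ (λ e → mk⇔ (λ ()) (λ ¬⊤ → contradiction tt ¬⊤)) (def-¬ def-⊤)
    def-Any (x ∷ xs) S-def = def-⇔ (λ e → mk⇔ Any.toSum Any.fromSum) (def-⊎ (S-def x) (def-Any xs S-def))

    def-∃ : ∀ {k} {S : E × Vector ℝ k → Set} → Def (ρ ▸ k) S → Def ρ (λ e → ∃[ u ] S (e , u))
    def-∃ {k} (φ , S⇔φ) = exists k φ , λ e → ⇔-trans (∃-⇔ λ u → S⇔φ (e , u)) (⊨-exists k φ (ρ e))

  def-rename : {E E′ : Set} {m m′ : ℕ} {ρ : E → Vector ℝ m} {ρ′ : E′ → Vector ℝ m′} {S : E → Set}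
               (h : E′ → E) (r : Fin m → Fin m′) → (∀ e → ρ (h e) ≋ ρ′ e ∘ r) → Def ρ S → Def ρ′ (S ∘ h)
  def-rename h r ρh≋ (φ , S⇔φ) = rename r φ , λ e → ⇔-trans (S⇔φ (h e)) (⊨-rename r φ (ρh≋ e))

  ⧺-↑ˡ : ∀ {k m} (u : Vector ℝ k) (v : Vector ℝ m) → u ≋ (u ⧺ v) ∘ (_↑ˡ m)
  ⧺-↑ˡ {k} {m} u v i rewrite splitAt-↑ˡ k i m = ≈-refl

  ⧺-↑ʳ : ∀ {k m} (u : Vector ℝ k) (v : Vector ℝ m) → v ≋ (u ⧺ v) ∘ (k ↑ʳ_)
  ⧺-↑ʳ {k} {m} u v i rewrite splitAt-↑ʳ k m i = ≈-refl

  def-weaken : {E : Set} {m k : ℕ} {ρ : E → Vector ℝ m} {S : E → Set} → Def ρ S → Def (ρ ▸ k) (S ∘ proj₁)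
  def-weaken {k = k} {ρ} = def-rename proj₁ (k ↑ʳ_) (λ (e , u) → ⧺-↑ʳ u (ρ e))

  def-new : {E : Set} {m k : ℕ} {ρ : E → Vector ℝ m} {S : Vector ℝ k → Set} → Def id S → Def (ρ ▸ k) (S ∘ proj₂)
  def-new {m = m} {ρ = ρ} = def-rename proj₂ (_↑ˡ m) (λ (e , u) → ⧺-↑ˡ u (ρ e))

  def-isℤ : {E : Set} {m k : ℕ} {ρ : E → Vector ℝ m} (i : Fin k) → Def (ρ ▸ k) (λ (e , u) → ∃[ z ] (u i ≈ fromℤ z))
  def-isℤ i = def-new (isℤ (var i) , λ u → mk⇔ id id)

open Definability public

-- Rational affine functions as differences of terms

module AffineFunctions where

  open +-*-Solver using (solve; con; _:*_; _:+_; _:-_; :-_; _:=_)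

  -- Terms have no subtraction; a pair of terms stands for a signed integer combination.
  net : ∀ {m} → Term m × Term m → Vector ℝ m → ℝ
  net (s , t) v = ⟦ s ⟧ v + ℚ.- 1ℚ · ⟦ t ⟧ v

  addᵗ : ∀ {m} → Term m × Term m → Term m × Term m → Term m × Term m
  addᵗ (s , t) (s′ , t′) = s ⊞ s′ , t ⊞ t′

  scaleℕ : ∀ {m} → ℕ → Term (suc m) × Term (suc m) → Term (suc m) × Term (suc m)
  -- There is no term for 0, so zero is a variable minus itself.
  scaleℕ zero    st = var zero , var zero
  scaleℕ (suc n) st = addᵗ st (scaleℕ n st)

  scaleℤ : ∀ {m} → ℤ → Term (suc m) × Term (suc m) → Term (suc m) × Term (suc m)
  scaleℤ (+ n)    st = scaleℕ n st
  scaleℤ -[1+ n ] st = scaleℕ (suc n) (swap st)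

  net-add : ∀ {m} (p q : Term m × Term m) v → net (addᵗ p q) v ≈ net p v + net q v
  net-add (s , t) (s′ , t′) v = pointwise λ k → solve 4 (λ s t s′ t′ →
      (s :+ s′) :+ con (ℚ.- 1ℚ) :* (t :+ t′) := (s :+ con (ℚ.- 1ℚ) :* t) :+ (s′ :+ con (ℚ.- 1ℚ) :* t′)) refl
    (seq (⟦ s ⟧ v) k) (seq (⟦ t ⟧ v) k) (seq (⟦ s′ ⟧ v) k) (seq (⟦ t′ ⟧ v) k)

  net-swap : ∀ {m} (p : Term m × Term m) v → net (swap p) v ≈ ℚ.- 1ℚ · net p v
  net-swap (s , t) v = pointwise λ k → solve 2 (λ s t →
      t :+ con (ℚ.- 1ℚ) :* s := con (ℚ.- 1ℚ) :* (s :+ con (ℚ.- 1ℚ) :* t)) refl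
    (seq (⟦ s ⟧ v) k) (seq (⟦ t ⟧ v) k)

  0·x≈0 : ∀ x → 0ℝ ≈ 0ℚ · x
  0·x≈0 x = pointwise λ k → sym (ℚ.*-zeroˡ (seq x k))

  ι-suc· : ∀ n x → x + ι (+ n) · x ≈ ι (+ suc n) · x
  ι-suc· n x = pointwise λ k → trans (solve 2 (λ n x → x :+ n :* x := (con 1ℚ :+ n) :* x) refl (ι (+ n)) (seq x k))
    (cong (ℚ._* seq x k) (sym (ι-+ (+ 1) (+ n))))

  net-scaleℕ : ∀ {m} n (p : Term (suc m) × Term (suc m)) v → net (scaleℕ n p) v ≈ ι (+ n) · net p v
  net-scaleℕ zero p v = ≈-trans (+-neg (v zero)) (0·x≈0 (net p v))
  net-scaleℕ (suc n) p v = ≈-trans (net-add p (scaleℕ n p) v)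
    (≈-trans (+-cong (≈-refl {net p v}) (net-scaleℕ n p v)) (ι-suc· n (net p v)))

  net-scaleℤ : ∀ {m} n (p : Term (suc m) × Term (suc m)) v → net (scaleℤ n p) v ≈ ι n · net p v
  net-scaleℤ (+ n) p v = net-scaleℕ n p v
  net-scaleℤ -[1+ n ] p v = ≈-trans (net-scaleℕ (suc n) (swap p) v)
    (≈-trans (·-cong (ι (+ suc n)) (net-swap p v)) (≈-trans commute (≈-sym (ι-neg-1 n (net p v)))))
    where
    commute : ι (+ suc n) · (ℚ.- 1ℚ · net p v) ≈ ℚ.- 1ℚ · (ι (+ suc n) · net p v)
    commute = pointwise λ k → solve 2 (λ a x → a :* (con (ℚ.- 1ℚ) :* x) := con (ℚ.- 1ℚ) :* (a :* x)) refl
      (ι (+ suc n)) (seq (net p v) k)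

  -- Up to the denominator 1 + d, an affine function of the variables is a difference of two terms
  -- in these variables and the constant 1.
  Affine : {E : Set} {m : ℕ} → (E → Vector ℝ m) → (E → ℝ) → Set
  Affine ρ g = ∃[ d ] ∃[ p ] (∀ e → ι (+ suc d) · g e ≈ net p (1ℝ ◂ ρ e))

  denominator-* : ∀ r → ι (ℚ.↧ r) ℚ.* r ≡ ι (ℚ.↥ r)
  denominator-* r@(ℚ.mkℚ n d _) = ℚ.toℚᵘ-injective (ℚᵘ.≃-trans (ℚ.toℚᵘ-homo-* (ι (+ suc d)) r)
    (ℚᵘ.≃-trans (ℚᵘ.*-cong (ℚ.toℚᵘ-fromℚᵘ (ℚᵘ.mkℚᵘ (+ suc d) 0)) (ℚᵘ.≃-refl {ℚ.toℚᵘ r}))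
    (ℚᵘ.≃-trans (ℚᵘ.*≡* (cross (+ suc d) n))
    (ℚᵘ.≃-sym (ℚ.toℚᵘ-fromℚᵘ (ℚᵘ.mkℚᵘ n 0))))))
    where
    cross : ∀ d n → (d ℤ.* n) ℤ.* + 1 ≡ n ℤ.* (+ 1 ℤ.* d)
    cross = ℤ-ring

  module _ {E : Set} {m : ℕ} {ρ : E → Vector ℝ m} where

    affine-≈ : {g h : E → ℝ} → (∀ e → h e ≈ g e) → Affine ρ g → Affine ρ h
    affine-≈ h≈g (d , p , e) = d , p , λ x → ≈-trans (·-cong (ι (+ suc d)) (h≈g x)) (e x)

    affine-var : ∀ i → Affine ρ (λ e → ρ e i)
    -- The variable is written as (1 + x) - 1, for lack of a term that denotes 0; the leading
    -- variable holds 1.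
    affine-var i = 0 , (var zero ⊞ var (suc i) , var zero) , λ e →
      pointwise λ k → solve 1 (λ x → con 1ℚ :* x := (con 1ℚ :+ x) :+ con (ℚ.- 1ℚ) :* con 1ℚ) refl (seq (ρ e i) k)

    affine-1 : Affine ρ (λ _ → 1ℝ)
    affine-1 = 0 , (var zero ⊞ var zero , var zero) , λ e → pointwise λ k → refl

    affine-· : ∀ r {g : E → ℝ} → Affine ρ g → Affine ρ (λ e → r · g e)
    -- The stored number is the predecessor of the product `(1 + d)(1 + q)` of the denominators.
    affine-· r@(ℚ.mkℚ n q _) {g} (d , p , g≈) = q ℕ.+ d ℕ.* suc q , scaleℤ n p , λ e → ≈-trans
      (pointwise λ k → trans (cong (ℚ._* (r ℚ.* seq (g e) k)) (trans (cong ι (ℤ.pos-* (suc d) (suc q))) (ι-* (+ suc d) (+ suc q))))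
        (trans (solve 4 (λ d q r x → (d :* q) :* (r :* x) := (q :* r) :* (d :* x)) refl (ι (+ suc d)) (ι (+ suc q)) r (seq (g e) k))
          (cong (ℚ._* (ι (+ suc d) ℚ.* seq (g e) k)) (denominator-* r))))
      (≈-trans (·-cong (ι n) (g≈ e)) (≈-sym (net-scaleℤ n p (1ℝ ◂ ρ e))))

    affine-+ : {g h : E → ℝ} → Affine ρ g → Affine ρ h → Affine ρ (λ e → g e + h e)
    affine-+ {g} {h} (d , p , g≈) (d′ , p′ , h≈) = d′ ℕ.+ d ℕ.* suc d′ , addᵗ (scaleℤ (+ suc d′) p) (scaleℤ (+ suc d) p′) , λ e → ≈-trans
      (pointwise λ k → trans (cong (ℚ._* (seq (g e) k ℚ.+ seq (h e) k)) (trans (cong ι (ℤ.pos-* (suc d) (suc d′))) (ι-* (+ suc d) (+ suc d′))))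
        (solve 4 (λ d d′ x y → (d :* d′) :* (x :+ y) := d′ :* (d :* x) :+ d :* (d′ :* y)) refl
          (ι (+ suc d)) (ι (+ suc d′)) (seq (g e) k) (seq (h e) k)))
      (≈-trans (+-cong (≈-trans (·-cong (ι (+ suc d′)) (g≈ e)) (≈-sym (net-scaleℤ (+ suc d′) p (1ℝ ◂ ρ e))))
                       (≈-trans (·-cong (ι (+ suc d)) (h≈ e)) (≈-sym (net-scaleℤ (+ suc d) p′ (1ℝ ◂ ρ e)))))
        (≈-sym (net-add (scaleℤ (+ suc d′) p) (scaleℤ (+ suc d) p′) (1ℝ ◂ ρ e))))

    affine-ℚ : ∀ r → Affine ρ (λ _ → fromℚ r)
    affine-ℚ r = affine-≈ (λ e → pointwise λ k → sym (ℚ.*-identityʳ r)) (affine-· r affine-1)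

    affine-sum : ∀ {k} {g : E → Vector ℝ k} → (∀ i → Affine ρ (λ e → g e i)) → Affine ρ (λ e → sum (g e))
    affine-sum {zero}  _     = affine-ℚ 0ℚ
    affine-sum {suc k} g-aff = affine-+ (g-aff zero) (affine-sum (g-aff ∘ suc))

  affine-rename : {E E′ : Set} {m m′ : ℕ} {ρ : E → Vector ℝ m} {ρ′ : E′ → Vector ℝ m′} {g : E → ℝ}
                  (h : E′ → E) (r : Fin m → Fin m′) → (∀ e → ρ (h e) ≋ ρ′ e ∘ r) → Affine ρ g → Affine ρ′ (g ∘ h)
  affine-rename {ρ = ρ} {ρ′} h r ρh≋ (d , (s , t) , g≈) = d , (renameᵗ (lift r) s , renameᵗ (lift r) t) , λ e →
    ≈-trans (g≈ (h e)) (+-cong (⟦renameᵗ⟧ (lift r) s (≋-lift r {ρ′ e} 1ℝ (ρh≋ e)))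
      (·-cong (ℚ.- 1ℚ) (⟦renameᵗ⟧ (lift r) t (≋-lift r {ρ′ e} 1ℝ (ρh≋ e)))))

  affine-weaken : {E : Set} {m k : ℕ} {ρ : E → Vector ℝ m} {g : E → ℝ} → Affine ρ g → Affine (ρ ▸ k) (g ∘ proj₁)
  affine-weaken {k = k} {ρ} = affine-rename proj₁ (k ↑ʳ_) (λ (e , u) → ⧺-↑ʳ u (ρ e))

  affine-new : {E : Set} {m k : ℕ} {ρ : E → Vector ℝ m} (i : Fin k) → Affine (ρ ▸ k) (λ (e , u) → u i)
  affine-new {m = m} {ρ = ρ} i = affine-≈ (λ (e , u) → ⧺-↑ˡ u (ρ e) i) (affine-var (i ↑ˡ m))

open AffineFunctions public

-- Defining the number 1 and rational affine inequalities

module DefinableOrder (em : ExcludedMiddle 0ℓ) where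

  open ClassicalOrder em
  open +-*-Solver using (solve; con; _:*_; _:+_; _:-_; :-_; _:=_)

  -- 1 is the least positive integer, and x is positive unless x + x ≤ x.
  positiveᶠ isOneᶠ : ∀ {m} → Formula (suc m)
  positiveᶠ = ¬ᶠ (var zero ⊞ var zero ≤ᶠ var zero)
  isOneᶠ = (isℤ (var zero) ∧ᶠ positiveᶠ) ∧ᶠ ∀ᶠ (¬ᶠ (isℤ (var zero) ∧ᶠ positiveᶠ) ∨ᶠ var (suc zero) ≤ᶠ var zero)

  x+x≤x⇔x≤0 : ∀ x → x + x ≤ x ⇔ x ≤ 0ℝ
  x+x≤x⇔x≤0 x = mk⇔
    (λ le → ≤-resp (+-cancel x x) (+-neg x) (+-mono-≤ le (≤-refl {ℚ.- 1ℚ · x})))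
    (λ le → ≤-resp ≈-refl (pointwise λ k → ℚ.+-identityʳ (seq x k)) (+-mono-≤ (≤-refl {x}) le))

  ⊨positive : ∀ {m} x (v : Vector ℝ m) → (x ◂ v ⊨ positiveᶠ) ⇔ (0ℝ < x)
  ⊨positive x v = ⇔-trans (¬-⇔ (x+x≤x⇔x≤0 x)) (mk⇔ ≰⇒> <⇒≱)

  positive-integer-≥1 : ∀ {x} → ∃[ z ] (x ≈ fromℤ z) → 0ℝ < x → 1ℝ ≤ x
  positive-integer-≥1 (z , x≈z) 0<x = ≤-resp ≈-refl (≈-sym x≈z) (fromℤ-mono-≤ (+ 1) z
    (ℤ.i<j⇒suc[i]≤j (ℤ.≰⇒> λ z≤0 → <⇒≱ 0<x (≤-resp (≈-sym x≈z) ≈-refl (fromℤ-mono-≤ z (+ 0) z≤0)))))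

  0<1 : 0ℝ < 1ℝ
  0<1 = fromℚ-mono-< (ℚ.positive⁻¹ 1ℚ)

  ⊨isOne : ∀ {m} x (v : Vector ℝ m) → (x ◂ v ⊨ isOneᶠ) ⇔ (x ≈ 1ℝ)
  ⊨isOne x v = mk⇔
    (λ ((integer , pos) , least) → ≤-antisym
      (Sum.[ (λ ¬p → contradiction ((+ 1 , ≈-refl) , Equivalence.from (⊨positive 1ℝ (x ◂ v)) 0<1) ¬p) , id ] (least 1ℝ))
      (positive-integer-≥1 integer (Equivalence.to (⊨positive x v) pos)))
    (λ x≈1 → ((+ 1 , x≈1) , Equivalence.from (⊨positive x v) (<-≤-trans 0<1 (≈⇒≤ (≈-sym x≈1)))) , λ y → minimal x≈1 y em)
    where
    minimal : x ≈ 1ℝ → ∀ y → Dec (y ◂ x ◂ v ⊨ isℤ (var zero) ∧ᶠ positiveᶠ) →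
              y ◂ x ◂ v ⊨ (¬ᶠ (isℤ (var zero) ∧ᶠ positiveᶠ) ∨ᶠ var (suc zero) ≤ᶠ var zero)
    minimal x≈1 y (no ¬p) = inj₁ ¬p
    minimal x≈1 y (yes (integer , pos)) = inj₂ (≤-resp (≈-sym x≈1) ≈-refl
      (positive-integer-≥1 integer (Equivalence.to (⊨positive y (x ◂ v)) pos)))

  module _ {E : Set} {m : ℕ} {ρ : E → Vector ℝ m} where

    -- The positive denominator does not affect the sign, and the constant 1 in the terms is
    -- supplied by a quantified variable that `isOneᶠ` pins down.
    def-≤0 : {g : E → ℝ} → Affine ρ g → Def ρ (λ e → g e ≤ 0ℝ)
    def-≤0 {g} (d , (s , t) , g≈) = ∃ᶠ (isOneᶠ ∧ᶠ s ≤ᶠ t) , λ e → ⇔-trans (≤0⇔ e) (mk⇔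
      (λ le → 1ℝ , Equivalence.from (⊨isOne 1ℝ (ρ e)) ≈-refl , le)
      (λ (x , one , le) → ⊨-resp (s ≤ᶠ t) (◂-cong (Equivalence.to (⊨isOne x (ρ e)) one) (≋-refl {x = ρ e})) le))
      where
      ≤0⇔ : ∀ e → g e ≤ 0ℝ ⇔ ⟦ s ⟧ (1ℝ ◂ ρ e) ≤ ⟦ t ⟧ (1ℝ ◂ ρ e)
      ≤0⇔ e = ⇔-trans (⇔-sym (pos·x≤0 (ι (+ suc d)) {{ι-pos d}} (g e)))
        (⇔-trans (≈⇒≤0⇔ (g≈ e)) (x-y≤0⇔x≤y (⟦ s ⟧ (1ℝ ◂ ρ e)) (⟦ t ⟧ (1ℝ ◂ ρ e))))

    def-≤ : {g h : E → ℝ} → Affine ρ g → Affine ρ h → Def ρ (λ e → g e ≤ h e)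
    def-≤ {g} {h} g-aff h-aff = def-⇔ (λ e → ⇔-sym (x-y≤0⇔x≤y (g e) (h e)))
      (def-≤0 (affine-+ g-aff (affine-· (ℚ.- 1ℚ) h-aff)))

    def-≈ : {g h : E → ℝ} → Affine ρ g → Affine ρ h → Def ρ (λ e → g e ≈ h e)
    def-≈ g-aff h-aff = def-⇔ (λ e → mk⇔ (λ e → ≈⇒≤ e , ≈⇒≤ (≈-sym e)) (λ (p , q) → ≤-antisym p q))
      (def-× (def-≤ g-aff h-aff) (def-≤ h-aff g-aff))

    def-< : {g h : E → ℝ} → Affine ρ g → Affine ρ h → Def ρ (λ e → g e < h e)
    def-< g-aff h-aff = def-⇔ (λ e → mk⇔ <⇒≱ ≰⇒>) (def-¬ (def-≤ h-aff g-aff))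

    def-compare : ∀ # {g h : E → ℝ} → Affine ρ g → Affine ρ h → Def ρ (λ e → compare # (g e) (h e))
    def-compare Comparison.lt g-aff h-aff = def-< g-aff h-aff
    def-compare Comparison.le g-aff h-aff = def-≤ g-aff h-aff
    def-compare Comparison.eq g-aff h-aff = def-≈ g-aff h-aff
    def-compare Comparison.ge g-aff h-aff = def-≤ h-aff g-aff
    def-compare Comparison.gt g-aff h-aff = def-< h-aff g-aff

    def-∈ᶜ : ∀ {n} {c : E → Vector ℝ n} (C : PolyhedralConvex n) → (∀ i → Affine ρ (λ e → c e i)) →
             Def ρ (λ e → c e ∈ᶜ C)
    def-∈ᶜ C c-aff = def-All C λ (mkConstraint α # β) →
      def-compare # (affine-sum λ i → affine-· (α i) (c-aff i)) (affine-ℚ β)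

-- Monoid elements and simple functions

module SimpleTerms where

  open +-*-Solver using (solve; con; _:*_; _:+_; _:-_; :-_; _:=_)

  fromℤ-≡ : ∀ {x y} → x ≡ y → fromℤ x ≈ fromℤ y
  fromℤ-≡ refl = ≈-refl

  -- Collecting the copies of `p` replaces a list of unbounded length by one natural coefficient per
  -- generator, which a formula can quantify.
  ∈*-∷ : ∀ {n} (p : Vector ℤ n) P m →
         m ∈* (p ∷ P) ⇔ (∃[ k ] ∃[ m′ ] (m′ ∈* P × (∀ i → m i ≡ + k ℤ.* p i ℤ.+ m′ i)))
  ∈*-∷ {n} p P m = mk⇔ to from
    where
    total : List (Vector ℤ n) → Vector ℤ n
    total = foldr (zipWith ℤ._+_) (replicate _ (+ 0))
    split : ∀ ps → All (_∈ p ∷ P) ps →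
            ∃[ k ] ∃[ ps′ ] (All (_∈ P) ps′ × (∀ i → total ps i ≡ + k ℤ.* p i ℤ.+ total ps′ i))
    split [] [] = 0 , [] , [] , λ i → refl
    split (q ∷ ps) (q∈ ∷ ps∈) with split ps ps∈ | q∈
    ... | k , ps′ , ps′∈ , total≡ | here refl = suc k , ps′ , ps′∈ , λ i →
          trans (cong (λ t → p i ℤ.+ t) (total≡ i)) (regroup (p i) (+ k) (total ps′ i))
      where
      regroup : ∀ p k t → p ℤ.+ (k ℤ.* p ℤ.+ t) ≡ (+ 1 ℤ.+ k) ℤ.* p ℤ.+ t
      regroup = ℤ-ring
    ... | k , ps′ , ps′∈ , total≡ | there q∈P = k , q ∷ ps′ , q∈P ∷ ps′∈ , λ i →
          trans (cong (λ t → q i ℤ.+ t) (total≡ i)) (regroup (q i) (+ k ℤ.* p i) (total ps′ i))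
      where
      regroup : ∀ q x t → q ℤ.+ (x ℤ.+ t) ≡ x ℤ.+ (q ℤ.+ t)
      regroup = ℤ-ring
    to : m ∈* (p ∷ P) → ∃[ k ] ∃[ m′ ] (m′ ∈* P × (∀ i → m i ≡ + k ℤ.* p i ℤ.+ m′ i))
    to (ps , ps∈ , m≡) = let k , ps′ , ps′∈ , total≡ = split ps ps∈
      in k , total ps′ , (ps′ , ps′∈ , λ _ → refl) , λ i → trans (m≡ i) (total≡ i)
    from : ∃[ k ] ∃[ m′ ] (m′ ∈* P × (∀ i → m i ≡ + k ℤ.* p i ℤ.+ m′ i)) → m ∈* (p ∷ P)
    from (k , m′ , (ps , ps∈ , m′≡) , m≡) = proj₁ (copies k) , proj₁ (proj₂ (copies k)) , λ i →
        trans (m≡ i) (trans (cong (λ t → + k ℤ.* p i ℤ.+ t) (m′≡ i)) (sym (proj₂ (proj₂ (copies k)) i)))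
      where
      regroup : ∀ p k t → p ℤ.+ (k ℤ.* p ℤ.+ t) ≡ (+ 1 ℤ.+ k) ℤ.* p ℤ.+ t
      regroup = ℤ-ring
      copies : ∀ k → ∃[ qs ] (All (_∈ p ∷ P) qs × (∀ i → total qs i ≡ + k ℤ.* p i ℤ.+ total ps i))
      copies zero = ps , All.map there ps∈ , λ i → sym (ℤ.+-identityˡ (total ps i))
      copies (suc k) = let qs , qs∈ , total≡ = copies k
        in p ∷ qs , here refl ∷ qs∈ , λ i → trans (cong (λ t → p i ℤ.+ t) (total≡ i)) (regroup (p i) (+ k) (total ps i))

  sum-cong : ∀ {n} {x y : Vector ℝ n} → x ≋ y → sum x ≈ sum y
  sum-cong {zero}  x≋y = ≈-refl
  sum-cong {suc n} x≋y = +-cong (x≋y zero) (sum-cong (x≋y ∘ suc))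

  sum-+ : ∀ {n} (x y : Vector ℝ n) → sum (zipWith _+_ x y) ≈ sum x + sum y
  sum-+ {zero}  x y = pointwise λ _ → refl
  sum-+ {suc n} x y = ≈-trans (+-cong (≈-refl {x zero + y zero}) (sum-+ (tail x) (tail y)))
    (pointwise λ k → solve 4 (λ a b s t → (a :+ b) :+ (s :+ t) := (a :+ s) :+ (b :+ t)) refl
      (seq (x zero) k) (seq (y zero) k) (seq (sum (tail x)) k) (seq (sum (tail y)) k))

  SimpleTerm : ℕ → Set
  SimpleTerm n = ℚ × Vector ℚ n × Vector ℚ n

  -- The integer part is taken as a real vector, since the variables of a formula range over reals.
  simpleValue : ∀ {n} → SimpleTerm n → Vector ℝ n → Vector ℝ n → ℝ
  simpleValue (α , a , b) c w = fromℚ α + sum (λ i → a i · c i + b i · w i)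

  simpleValue-cong : ∀ {n} (τ : SimpleTerm n) {c c′ w w′} → c ≋ c′ → w ≋ w′ → simpleValue τ c w ≈ simpleValue τ c′ w′
  simpleValue-cong (α , a , b) c≋ w≋ = +-cong (≈-refl {fromℚ α})
    (sum-cong λ i → +-cong (·-cong (a i) (c≋ i)) (·-cong (b i) (w≋ i)))

  SimpleGraph : ∀ {n} → SimpleTerm n → Vector ℝ n → ℝ → Set
  SimpleGraph τ x y = ∃[ c ] ∃[ z ] (InUnitCube c × x ≋ c ⊕ z × y ≈ simpleValue τ c (map fromℤ z))

  reciprocal : ℕ → ℚ
  reciprocal k = (ℚ.1/ ι (+ suc k)) {{ℚ.pos⇒nonZero (ι (+ suc k)) {{ι-pos k}}}}

  -- Sorts a · c + α + (b · z + β) / (1 + k) into its constant, its coefficients of c and its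
  -- coefficients of z.
  toSimple : ∀ {n} → Candidate n → SimpleTerm n
  toSimple ((a , α) , (b , β) , k) = α ℚ.+ reciprocal k ℚ.* ι β , a , λ i → reciprocal k ℚ.* ι (b i)

  toSimple-value : ∀ {n} ((t , τ , k) : Candidate n) c z w → + suc k ℤ.* w ≡ evalℤ τ z →
                   evalℝ t c + fromℤ w ≈ simpleValue (toSimple (t , τ , k)) c (map fromℤ z)
  toSimple-value ((a , α) , (b , β) , k) c z w kw≡ = ≈-trans
    (+-cong (≈-refl {evalℝ (a , α) c}) w≈)
    (≈-trans (pointwise λ j → solve 5 (λ x α r y β → (x :+ α) :+ r :* (y :+ β) := (α :+ r :* β) :+ (x :+ r :* y)) refl
        (seq (a ·ᵛ c) j) α r (seq (b ∙ᵛ map fromℤ z) j) (ι β))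
      (+-cong (≈-refl {fromℚ (α ℚ.+ r ℚ.* ι β)}) (≈-trans
        (+-cong (≈-refl {a ·ᵛ c}) (≈-sym (·ᵛ-* r (ι ∘ b) (map fromℤ z))))
        (≈-sym (sum-+ (λ i → a i · c i) (λ i → (r ℚ.* ι (b i)) · fromℤ (z i)))))))
    where
    r : ℚ
    r = reciprocal k
    w≈ : fromℤ w ≈ r · (b ∙ᵛ map fromℤ z + fromℤ β)
    w≈ = ≈-trans (≈-sym (1/r·r· (ι (+ suc k)) {{ℚ.pos⇒nonZero (ι (+ suc k)) {{ι-pos k}}}} (fromℤ w)))
      (·-cong r (≈-trans (ι·fromℤ (+ suc k) w) (≈-trans (fromℤ-≡ kw≡)
        (≈-trans (fromℤ-+ (dot b z) β) (+-cong (≈-sym (∙ᵛ-fromℤ b z)) (≈-refl {fromℤ β}))))))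

open SimpleTerms public

-- Formulas for semi-polinear sets and simple functions

module DefinableSemiPolinear (em : ExcludedMiddle 0ℓ) where

  open ClassicalOrder em
  open DefinableOrder em

  InMonoid : ∀ {n} → List (Vector ℤ n) → Vector ℝ n → Set
  InMonoid P u = ∃[ m ] (m ∈* P × u ≋ map fromℤ m)

  InMonoid-[] : ∀ {n} (u : Vector ℝ n) → InMonoid [] u ⇔ (∀ i → u i ≈ fromℚ 0ℚ)
  InMonoid-[] u = mk⇔ to (λ u≋0 → (λ _ → + 0) , ([] , [] , λ _ → refl) , u≋0)
    where
    to : InMonoid [] u → ∀ i → u i ≈ fromℚ 0ℚ
    to (m , ([] , [] , m≡0) , u≋m) i = ≈-trans (u≋m i) (fromℤ-≡ (m≡0 i))
    to (m , (_ ∷ _ , () ∷ _ , _) , _)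

  -- One generator is peeled off: `t` is its multiplicity, a nonnegative integer, and `u′` is the
  -- contribution of the others.
  MonoidStep : ∀ {n} → Vector ℤ n → List (Vector ℤ n) → (Vector ℝ n × Vector ℝ n) × Vector ℝ 1 → Set
  MonoidStep p P ((u , u′) , t) = (InMonoid P u′ × ∃[ z ] (t zero ≈ fromℤ z)) ×
    (fromℚ 0ℚ ≤ t zero × (∀ i → u i ≈ ι (p i) · t zero + u′ i))

  InMonoid-∷ : ∀ {n} p P (u : Vector ℝ n) → InMonoid (p ∷ P) u ⇔ (∃[ u′ ] ∃[ t ] MonoidStep p P ((u , u′) , t))
  InMonoid-∷ p P u = mk⇔ to from
    where
    step : ∀ k x y → fromℤ (k ℤ.* x ℤ.+ y) ≈ ι x · fromℤ k + fromℤ y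
    step k x y = ≈-trans (fromℤ-+ (k ℤ.* x) y)
      (+-cong (≈-trans (fromℤ-≡ (ℤ.*-comm k x)) (≈-sym (ι·fromℤ x k))) (≈-refl {fromℤ y}))
    to : InMonoid (p ∷ P) u → ∃[ u′ ] ∃[ t ] MonoidStep p P ((u , u′) , t)
    to (m , m∈ , u≋m) = let k , m′ , m′∈ , m≡ = Equivalence.to (∈*-∷ p P m) m∈
      in map fromℤ m′ , (λ _ → fromℤ (+ k)) , ((m′ , m′∈ , λ _ → ≈-refl) , + k , ≈-refl)
       , fromℤ-mono-≤ (+ 0) (+ k) (ℤ.+≤+ ℕ.z≤n)
       , λ i → ≈-trans (u≋m i) (≈-trans (fromℤ-≡ (m≡ i)) (step (+ k) (p i) (m′ i)))
    build : ∀ z m′ {u′} t → m′ ∈* P → u′ ≋ map fromℤ m′ → t ≈ fromℤ z → + 0 ℤ.≤ z →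
            (∀ i → u i ≈ ι (p i) · t + u′ i) → InMonoid (p ∷ P) u
    build (+ k) m′ t m′∈ u′≋ t≈ _ u≈ = (λ i → + k ℤ.* p i ℤ.+ m′ i)
      , Equivalence.from (∈*-∷ p P _) (k , m′ , m′∈ , λ _ → refl)
      , λ i → ≈-trans (u≈ i) (≈-trans (+-cong (·-cong (ι (p i)) t≈) (u′≋ i)) (≈-sym (step (+ k) (p i) (m′ i))))
    from : ∃[ u′ ] ∃[ t ] MonoidStep p P ((u , u′) , t) → InMonoid (p ∷ P) u
    from (u′ , t , ((m′ , m′∈ , u′≋) , z , t≈) , 0≤t , u≈) =
      build z m′ (t zero) m′∈ u′≋ t≈ (fromℤ-cancel-≤ (+ 0) z (≤-trans 0≤t (≈⇒≤ t≈))) u≈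

  def-InMonoid : ∀ {n} (P : List (Vector ℤ n)) → Def id (InMonoid P)
  def-InMonoid [] = def-⇔ InMonoid-[] (def-∀Fin λ i → def-≈ (affine-var i) (affine-ℚ 0ℚ))
  def-InMonoid {n} (p ∷ P) = def-⇔ (InMonoid-∷ p P) (def-∃ (def-∃ {S = MonoidStep p P}
    (def-× (def-× (def-weaken (def-new (def-InMonoid P))) (def-isℤ zero))
      (def-× (def-≤ (affine-ℚ 0ℚ) (affine-new zero))
        (def-∀Fin λ i → def-≈ (affine-weaken (affine-weaken (affine-var i)))
          (affine-+ (affine-· (ι (p i)) (affine-new zero)) (affine-weaken (affine-new i))))))))

  module _ {E : Set} {m n : ℕ} {ρ : E → Vector ℝ m} {X : E → Vector ℝ n} (X-affine : ∀ i → Affine ρ (λ e → X e i)) where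

    PolinearStep : Polinear n → (E × Vector ℝ n) × Vector ℝ n → Set
    PolinearStep S ((e , c) , u) = c ∈ᶜ C × InMonoid P u × (∀ i → X e i ≈ c i + (fromℚ (ι (b i)) + u i))
      where open Polinear S

    ∈ᵖ⇔ : ∀ S e → X e ∈ᵖ S ⇔ (∃[ c ] ∃[ u ] PolinearStep S ((e , c) , u))
    ∈ᵖ⇔ S e = mk⇔
      (λ (c , z , c∈ , (m , m∈ , z≡) , x≋) → c , map fromℤ m , c∈ , (m , m∈ , λ _ → ≈-refl)
        , λ i → ≈-trans (x≋ i) (+-cong (≈-refl {c i}) (≈-trans (fromℤ-≡ (z≡ i)) (fromℤ-+ (b i) (m i)))))
      (λ (c , u , c∈ , (m , m∈ , u≋) , x≈) → c , (λ i → b i ℤ.+ m i) , c∈ , (m , m∈ , λ _ → refl)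
        , λ i → ≈-trans (x≈ i) (+-cong (≈-refl {c i}) (≈-trans (+-cong (≈-refl {fromℤ (b i)}) (u≋ i)) (≈-sym (fromℤ-+ (b i) (m i))))))
      where open Polinear S

    def-∈ᵖ : ∀ S → Def ρ (λ e → X e ∈ᵖ S)
    def-∈ᵖ S = def-⇔ (∈ᵖ⇔ S) (def-∃ (def-∃ {S = PolinearStep S}
      (def-× (def-∈ᶜ C λ i → affine-weaken (affine-new i))
        (def-× (def-new (def-InMonoid P))
          (def-∀Fin λ i → def-≈ (affine-weaken (affine-weaken (X-affine i)))
            (affine-+ (affine-weaken (affine-new i)) (affine-+ (affine-ℚ (ι (b i))) (affine-new i))))))))
      where open Polinear S

    def-∈ˢ : ∀ D → Def ρ (λ e → X e ∈ˢ D)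
    def-∈ˢ D = def-Any D def-∈ᵖ

    SimpleStep : SimpleTerm n → (E → ℝ) → (E × Vector ℝ n) × Vector ℝ n → Set
    SimpleStep τ Y ((e , c) , u) = (∀ i → fromℚ 0ℚ ≤ c i × c i < fromℚ 1ℚ) × (∀ i → ∃[ z ] (u i ≈ fromℤ z)) ×
      (∀ i → X e i ≈ c i + u i) × Y e ≈ simpleValue τ c u

    SimpleGraph⇔ : ∀ τ Y e → SimpleGraph τ (X e) (Y e) ⇔ (∃[ c ] ∃[ u ] SimpleStep τ Y ((e , c) , u))
    SimpleGraph⇔ τ Y e = mk⇔
      (λ (c , z , c∈ , x≋ , y≈) → c , map fromℤ z , c∈ , (λ i → z i , ≈-refl) , x≋ , y≈)
      (λ (c , u , c∈ , integral , x≈ , y≈) → c , proj₁ ∘ integral , c∈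
        , (λ i → ≈-trans (x≈ i) (+-cong (≈-refl {c i}) (proj₂ (integral i))))
        , ≈-trans y≈ (simpleValue-cong τ (λ i → ≈-refl {c i}) (proj₂ ∘ integral)))

    def-SimpleGraph : ∀ τ {Y} → Affine ρ Y → Def ρ (λ e → SimpleGraph τ (X e) (Y e))
    def-SimpleGraph τ@(α , a , b) {Y} Y-affine = def-⇔ (SimpleGraph⇔ τ Y) (def-∃ (def-∃ {S = SimpleStep τ Y}
      (def-× (def-∀Fin λ i → def-× (def-≤ (affine-ℚ 0ℚ) (affine-weaken (affine-new i)))
                                   (def-< (affine-weaken (affine-new i)) (affine-ℚ 1ℚ)))
        (def-× (def-∀Fin λ i → def-isℤ i)
          (def-× (def-∀Fin λ i → def-≈ (affine-weaken (affine-weaken (X-affine i)))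
                                       (affine-+ (affine-weaken (affine-new i)) (affine-new i)))
            (def-≈ (affine-weaken (affine-weaken Y-affine))
              (affine-+ (affine-ℚ α) (affine-sum λ i → affine-+ (affine-· (a i) (affine-weaken (affine-new i)))
                                                                (affine-· (b i) (affine-new i)))))))))) 

  -- If z′ < z, then c′ + z′ < 1 + z′ ≤ z ≤ c + z.
  integer-part-≤ : ∀ {c c′} z z′ → 0ℝ ≤ c → c′ < 1ℝ → c + fromℤ z ≈ c′ + fromℤ z′ → z ℤ.≤ z′
  integer-part-≤ {c} {c′} z z′ 0≤c c′<1 e = ℤ.≮⇒≥ λ z′<z → <⇒≱ (+-monoˡ-< (fromℤ z′) c′<1)
    (≤-trans (≈⇒≤ (≈-sym (fromℤ-+ (+ 1) z′)))
      (≤-trans (fromℤ-mono-≤ (+ 1 ℤ.+ z′) z (ℤ.i<j⇒suc[i]≤j z′<z))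
        (≤-trans (≤-resp (pointwise λ k → ℚ.+-identityˡ (ι z)) ≈-refl (+-mono-≤ 0≤c (≤-refl {fromℤ z}))) (≈⇒≤ e))))

  decomposition-unique : ∀ {n} {c c′ : Vector ℝ n} {z z′} → InUnitCube c → InUnitCube c′ →
                         c ⊕ z ≋ c′ ⊕ z′ → (∀ i → z i ≡ z′ i) × c ≋ c′
  decomposition-unique {c = c} {c′} {z} {z′} c∈ c′∈ e = z≡z′ , c≋c′
    where
    z≡z′ : ∀ i → z i ≡ z′ i
    z≡z′ i = ℤ.≤-antisym (integer-part-≤ (z i) (z′ i) (proj₁ (c∈ i)) (proj₂ (c′∈ i)) (e i))
                         (integer-part-≤ (z′ i) (z i) (proj₁ (c′∈ i)) (proj₂ (c∈ i)) (≈-sym (e i)))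
    c≋c′ : c ≋ c′
    c≋c′ i = ≤-antisym
      (+-cancelʳ-≤ (fromℤ (z i)) (≈⇒≤ (≈-trans (e i) (+-cong (≈-refl {c′ i}) (fromℤ-≡ (sym (z≡z′ i)))))))
      (+-cancelʳ-≤ (fromℤ (z i)) (≈⇒≤ (≈-trans (+-cong (≈-refl {c′ i}) (fromℤ-≡ (z≡z′ i))) (≈-sym (e i)))))

-- Piecewise-simple functions are definable

module PiecewiseToDefinable (em : ExcludedMiddle 0ℓ) where

  open SemiPolinearSets em
  open DefinableOrder em
  open DefinableSemiPolinear em

  piecewiseSimple⇒definable : ∀ {n q} (f : ℝ^ n ⇀ℝ^ q) → PiecewiseSimple f → Definable f
  piecewiseSimple⇒definable {n} {q} f (k , D , part , simple) = def-⇔ graph⇔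
    (def-∃Fin λ j → def-× (def-∈ˢ x-affine (D j))
      (def-∀Fin λ i → def-SimpleGraph x-affine (τ j i) (affine-var (n ↑ʳ i))))
    where
    open IsPartition part
    x-affine : ∀ i → Affine id (λ v → take n v i)
    x-affine i = affine-var (i ↑ˡ q)
    τ : Fin k → Fin q → SimpleTerm n
    τ j i = let _ , α , a , b , _ = proj₂ (simple j) i in α , a , b
    value : ∀ j i c z → InUnitCube c → (x∈ : c ⊕ z ∈ˢ D j) →
            app f (c ⊕ z) (piece⊆ j x∈) i ≈ simpleValue (τ j i) c (map fromℤ z)
    value j i = let _ , _ , _ , _ , v = proj₂ (simple j) i in v
    graph⇔ : ∀ v → graph f v ⇔
             (∃[ j ] (take n v ∈ˢ D j × (∀ i → SimpleGraph (τ j i) (take n v) (drop n v i))))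
    graph⇔ v = mk⇔
      (λ (p , y≋) → let j , x∈ = Equivalence.to (covers x) p
                        c , z , c∈ , x≋ = decompose x
                        x∈′ = ∈ˢ-resp-≋ (D j) x≋ x∈
                    in j , x∈ , λ i → c , z , c∈ , x≋ ,
                         ≈-trans (y≋ i) (≈-trans (app-cong f p (piece⊆ j x∈′) x≋ i) (value j i c z c∈ x∈′)))
      -- Each coordinate brings its own decomposition of `x`, and `value` applies to each of them.
      (λ (j , x∈ , y-graph) → piece⊆ j x∈ , λ i →
        let c , z , c∈ , x≋ , y≈ = y-graph i
            x∈′ = ∈ˢ-resp-≋ (D j) x≋ x∈
        in ≈-trans y≈ (≈-trans (≈-sym (value j i c z c∈ x∈′)) (app-cong f (piece⊆ j x∈′) (piece⊆ j x∈) (≋-sym x≋) i)))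
      where
      x : Vector ℝ n
      x = take n v

-- Making a definable cover disjoint

module Partitioning (em : ExcludedMiddle 0ℓ) where

  open ClassicalOrder em
  open SemiPolinearSets em

  empty-partition : ∀ {n} {S : Pred (Vector ℝ n) 0ℓ} → (∀ x → ¬ S x) → {D : Fin 0 → SemiPolinear n} → IsPartition S D
  empty-partition {n} empty {D} = record
    { nonEmpty = λ ()
    ; covers   = λ x → mk⇔ (λ s → contradiction s (empty x)) λ ()
    ; disjoint = vacuous
    }
    where
    vacuous : ∀ {i j : Fin 0} {x : Vector ℝ n} → x ∈ˢ D i → x ∈ˢ D j → i ≡ j
    vacuous {()}

  same-partition : ∀ {n k} {S T : Pred (Vector ℝ n) 0ℓ} {D : Fin k → SemiPolinear n} →
                   (∀ x → T x ⇔ S x) → IsPartition S D → IsPartition T D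
  same-partition T⇔S part = record
    { nonEmpty = nonEmpty
    ; covers   = λ x → ⇔-trans (T⇔S x) (covers x)
    ; disjoint = disjoint
    }
    where open IsPartition part

  extend-partition : ∀ {n k} {S S₀ S₁ : Pred (Vector ℝ n) 0ℓ} {D₀} {D : Fin k → SemiPolinear n} →
                     (∀ x → S x ⇔ (S₀ x ⊎ S₁ x)) → (∀ x → S₀ x → ¬ S₁ x) → ∃[ x ] S₀ x →
                     (∀ x → S₀ x ⇔ x ∈ˢ D₀) → IsPartition S₁ D → IsPartition S (D₀ ◂ D)
  extend-partition {S₀ = S₀} {D₀ = D₀} {D} S⇔ S₀∩S₁=∅ (x₀ , x₀∈) S₀⇔ part = record
    { nonEmpty = λ { zero → x₀ , Equivalence.to (S₀⇔ x₀) x₀∈ ; (suc j) → nonEmpty j }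
    ; covers   = λ x → ⇔-trans (S⇔ x) (⇔-trans (⊎-⇔ (S₀⇔ x) (covers x)) (mk⇔
        (λ { (inj₁ x∈) → zero , x∈ ; (inj₂ (j , x∈)) → suc j , x∈ })
        (λ { (zero , x∈) → inj₁ x∈ ; (suc j , x∈) → inj₂ (j , x∈) })))
    ; disjoint = separate
    }
    where
    open IsPartition part
    separate : ∀ {i j x} → x ∈ˢ (D₀ ◂ D) i → x ∈ˢ (D₀ ◂ D) j → i ≡ j
    separate {zero} {zero} _ _ = refl
    separate {zero} {suc j} {x} x∈₀ x∈ = contradiction (Equivalence.from (covers x) (j , x∈))
      (S₀∩S₁=∅ x (Equivalence.from (S₀⇔ x) x∈₀))
    separate {suc i} {zero} {x} x∈ x∈₀ = contradiction (Equivalence.from (covers x) (i , x∈))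
      (S₀∩S₁=∅ x (Equivalence.from (S₀⇔ x) x∈₀))
    separate {suc i} {suc j} x∈ x∈′ = cong suc (disjoint x∈ x∈′)

  Refines : ∀ {n} {X : Set} → (X → Pred (Vector ℝ n) 0ℓ) → Pred (Vector ℝ n) 0ℓ → Set
  Refines {n} E S = ∃[ k ] Σ[ D ∈ (Fin k → SemiPolinear n) ] (IsPartition S D × (∀ j → ∃[ a ] (∀ x → x ∈ˢ D j → E a x)))

  -- Each cover set takes what its predecessors left over. The remainder stays definable because
  -- formulas have negation, so complements of semi-polinear sets are never computed directly. Empty
  -- pieces are skipped, as a partition requires non-empty ones.
  partition : ∀ {n} {X : Set} (E : X → Pred (Vector ℝ n) 0ℓ) (as : List X) {S : Pred (Vector ℝ n) 0ℓ} →
              DefinableSet S → (∀ a → DefinableSet (E a)) → (∀ x → S x → Any (λ a → E a x) as) → Refines E S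
  partition E [] S-def E-def S⊆ = 0 , (λ ()) , empty-partition (λ x s → contradiction (S⊆ x s) λ ()) , λ ()
  partition {n} E (a ∷ as) {S} S-def E-def S⊆ = extend em
    where
    inside outside : Pred (Vector ℝ n) 0ℓ
    inside x = S x × E a x
    outside x = S x × ¬ E a x
    S⊆′ : ∀ x → outside x → Any (λ a → E a x) as
    S⊆′ x (s , ¬e) = Any.tail ¬e (S⊆ x s)
    rest : Refines E outside
    rest = partition E as (def-× S-def (def-¬ (E-def a))) E-def S⊆′
    S⇔ : ∀ x → S x ⇔ (inside x ⊎ outside x)
    S⇔ x = mk⇔ (λ s → split s em) (λ { (inj₁ (s , _)) → s ; (inj₂ (s , _)) → s })
      where
      split : S x → Dec (E a x) → inside x ⊎ outside x
      split s (yes e) = inj₁ (s , e)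
      split s (no ¬e) = inj₂ (s , ¬e)
    extend : Dec (∃[ x ] inside x) → Refines E S
    extend (no none) = let k , D , part , D⊆ = rest in
      k , D , same-partition (λ x → ⇔-trans (S⇔ x)
        (mk⇔ (λ { (inj₁ s) → contradiction (x , s) none ; (inj₂ s) → s }) inj₂)) part , D⊆
    extend (yes some) = let k , D , part , D⊆ = rest
                            D₀ , inside⇔ = definable⇒semiPolinear (def-× S-def (E-def a)) in
      suc k , D₀ ◂ D , extend-partition S⇔ (λ x (_ , e) (_ , ¬e) → ¬e e) some inside⇔ part
        , λ { zero → a , λ x x∈ → proj₂ (Equivalence.from (inside⇔ x) x∈) ; (suc j) → D⊆ j }

-- Definable functions are piecewise-simple

module DefinableToPiecewise (em : ExcludedMiddle 0ℓ) where

  open ClassicalOrder em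
  open Elimination em
  open Translation em
  open SemiPolinearSets em
  open DefinableOrder em
  open DefinableSemiPolinear em
  open Partitioning em

  choices : ∀ {A : Set} q → (Fin q → List A) → List (Fin q → A)
  choices zero    as = (λ ()) ∷ []
  choices (suc q) as = cartesianProductWith _◂_ (as zero) (choices q (as ∘ suc))

  choices-complete : ∀ {A : Set} q {as : Fin q → List A} {P : Fin q → A → Set} →
                     (∀ j → Any (P j) (as j)) → Any (λ a → ∀ j → P j (a j)) (choices q as)
  choices-complete zero    _   = here λ ()
  choices-complete (suc q) any = Any.cartesianProductWith⁺ _◂_ (λ p ps → λ { zero → p ; (suc j) → ps j })
    (any zero) (choices-complete q (any ∘ suc))

  module _ {n q} (f : ℝ^ n ⇀ℝ^ q) (f-def : Definable f) where

    graph-⧺ : ∀ x u → graph f (x ⧺ u) ⇔ (Σ[ p ∈ dom f x ] (u ≋ app f x p))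
    graph-⧺ x u = mk⇔
      (λ (p , u≋) → let p′ = dom-resp f (≋-sym (⧺-↑ˡ x u)) p
                    in p′ , ≋-trans (⧺-↑ʳ x u) (≋-trans u≋ (app-cong f p p′ (≋-sym (⧺-↑ˡ x u)))))
      (λ (p , u≋) → let p′ = dom-resp f (⧺-↑ˡ x u) p
                    in p′ , ≋-trans (≋-sym (⧺-↑ʳ x u)) (≋-trans u≋ (app-cong f p p′ (⧺-↑ˡ x u))))

    -- In the graph the arguments precede the values, whereas a new block of variables stands in
    -- front of the old ones; the renaming exchanges the two blocks.
    def-graph : ∀ {m} (r : Fin n → Fin m) → Def (id ▸ q) (λ (v , u) → graph f ((v ∘ r) ⧺ u))
    def-graph {m} r = def-rename (λ (v , u) → (v ∘ r) ⧺ u)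
      (λ i → Sum.[ (λ j → q ↑ʳ r j) , (_↑ˡ m) ] (splitAt n i)) lookup≈ f-def
      where
      lookup≈ : ∀ ((v , u) : Vector ℝ m × Vector ℝ q) →
                ((v ∘ r) ⧺ u) ≋ (λ i → (u ⧺ v) (Sum.[ (λ j → q ↑ʳ r j) , (_↑ˡ m) ] (splitAt n i)))
      lookup≈ (v , u) i with splitAt n i
      ... | inj₁ j = ⧺-↑ʳ u v (r j)
      ... | inj₂ j = ⧺-↑ˡ u v j

    def-dom : DefinableSet (dom f)
    def-dom = def-⇔ (λ x → mk⇔
        (λ p → app f x p , Equivalence.from (graph-⧺ x (app f x p)) (p , ≋-refl {x = app f x p}))
        (λ (u , g) → proj₁ (Equivalence.to (graph-⧺ x u) g)))
      (def-∃ (def-graph id))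

    -- The value of the coordinate is put at the head, the position of the variable for which
    -- `select` finds candidates.
    CoordinateGraph : Fin q → Pred (Vector ℝ (suc n)) 0ℓ
    CoordinateGraph j w = ∃[ u ] (graph f (tail w ⧺ u) × u j ≈ w zero)

    CoordinateGraph⇔ : ∀ j {y x} → CoordinateGraph j (y ◂ x) ⇔ (Σ[ p ∈ dom f x ] (app f x p j ≈ y))
    CoordinateGraph⇔ j {y} {x} = mk⇔
      (λ (u , g , u≈y) → let p , u≋ = Equivalence.to (graph-⧺ x u) g in p , ≈-trans (≈-sym (u≋ j)) u≈y)
      (λ (p , f≈y) → app f x p , Equivalence.from (graph-⧺ x (app f x p)) (p , ≋-refl {x = app f x p}) , f≈y)

    def-CoordinateGraph : ∀ j → DefinableSet (CoordinateGraph j)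
    def-CoordinateGraph j = def-∃ (def-× (def-graph suc) (def-≈ (affine-new j) (affine-weaken (affine-var zero))))

    coordinateQF : Fin q → QF (suc n)
    coordinateQF j = translate (proj₁ (def-CoordinateGraph j))

    Sat-coordinate : ∀ j {c z d w} → InUnitCube c → 0ℝ ≤ d → d < 1ℝ →
      Sat (d ◂ c) (w ◂ z) (coordinateQF j) ⇔ CoordinateGraph j (d + fromℤ w ◂ c ⊕ z)
    Sat-coordinate j {c} {z} {d} {w} c∈ 0≤d d<1 = ⇔-trans
      (⇔-sym (translate-correct φ {d ◂ c} {w ◂ z} (◂-cube 0≤d d<1 c∈)))
      (⇔-trans (mk⇔ (⊨-resp φ (≋-sym (◂-⊕ d w c z))) (⊨-resp φ (◂-⊕ d w c z)))
        (⇔-sym (proj₂ (def-CoordinateGraph j) (d + fromℤ w ◂ c ⊕ z))))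
      where
      φ : Formula (suc n)
      φ = proj₁ (def-CoordinateGraph j)

    terms : Fin q → List (SimpleTerm n)
    terms j = List.map toSimple (candidates (coordinateQF j))

    HasValue : Vector ℝ n → Vector ℤ n → Fin q → SimpleTerm n → Set
    HasValue c z j τ = Σ[ p ∈ dom f (c ⊕ z) ] (app f (c ⊕ z) p j ≈ simpleValue τ c (map fromℤ z))

    -- Since the value at c ⊕ z is the only solution of the coordinate formula, quantifier
    -- elimination must select it.
    value-selected : ∀ j {c z} → InUnitCube c → dom f (c ⊕ z) → Any (HasValue c z j) (terms j)
    value-selected j {c} {z} c∈ p =
      let d , w , (0≤d , d<1) , y≈ = fractional-decomposition (app f (c ⊕ z) p j)
      in Any.map⁺ (Any.map (λ {e} → selected e) (select (coordinateQF j) c z d w 0≤d d<1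
           (Equivalence.from (Sat-coordinate j {c} {z} {d} {w} c∈ 0≤d d<1) (Equivalence.from (CoordinateGraph⇔ j) (p , y≈)))))
      where
      selected : ∀ e → Selects (coordinateQF j) c z e → HasValue c z j (toSimple e)
      selected e@(t , τ , k) (w , 0≤t , t<1 , kw≡τ , sat) =
        let p , f≈ = Equivalence.to (CoordinateGraph⇔ j)
                       (Equivalence.to (Sat-coordinate j {c} {z} {evalℝ t c} {w} c∈ 0≤t t<1) sat)
        in p , ≈-trans f≈ (toSimple-value e c z w kw≡τ)

    -- Coincidence with `τ` is phrased through a quantified value on the graph, which makes it
    -- first-order.
    Piece : (Fin q → SimpleTerm n) → Pred (Vector ℝ n) 0ℓ
    Piece τ x = ∃[ u ] (graph f (x ⧺ u) × (∀ j → SimpleGraph (τ j) x (u j)))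

    def-Piece : ∀ τ → DefinableSet (Piece τ)
    def-Piece τ = def-∃ (def-× (def-graph id)
      (def-∀Fin λ j → def-SimpleGraph (λ i → affine-weaken (affine-var i)) (τ j) (affine-new j)))

    dom⊆pieces : ∀ x → dom f x → Any (λ τ → Piece τ x) (choices q terms)
    dom⊆pieces x p =
      let c , z , c∈ , x≋ = decompose x
          p′ = dom-resp f x≋ p
      in Any.map (λ values → app f x p , Equivalence.from (graph-⧺ x (app f x p)) (p , ≋-refl {x = app f x p})
            , λ j → c , z , c∈ , x≋ , ≈-trans (app-cong f p (proj₁ (values j)) x≋ j) (proj₂ (values j)))
          (choices-complete q {P = HasValue c z} λ j → value-selected j {c} {z} c∈ p′)

    -- The piece provides some decomposition of `c ⊕ z`; uniqueness of fractional and integer parts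
    -- identifies it with the given one.
    piece-value : ∀ τ j {c z} → InUnitCube c → Piece τ (c ⊕ z) → (p : dom f (c ⊕ z)) →
                  app f (c ⊕ z) p j ≈ simpleValue (τ j) c (map fromℤ z)
    piece-value τ j {c} {z} c∈ (u , g , u-graph) p =
      let p′ , u≋ = Equivalence.to (graph-⧺ (c ⊕ z) u) g
          c′ , z′ , c′∈ , x≋ , u≈ = u-graph j
          z≡z′ , c≋c′ = decomposition-unique {c = c} {c′} {z} {z′} c∈ c′∈ x≋
      in ≈-trans (app-cong f p p′ (≋-refl {x = c ⊕ z}) j) (≈-trans (≈-sym (u≋ j)) (≈-trans u≈
           (simpleValue-cong (τ j) (≋-sym c≋c′) (λ i → fromℤ-≡ (sym (z≡z′ i))))))

    definable⇒piecewiseSimple : PiecewiseSimple f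
    definable⇒piecewiseSimple = k , D , part , λ j → semi j , λ i →
        semi j , proj₁ (τ j i) , proj₁ (proj₂ (τ j i)) , proj₂ (proj₂ (τ j i))
      , λ c z c∈ p → piece-value (τ j) i {c} {z} c∈ (proj₂ (proj₂ (proj₂ (proj₂ pieces)) j) (c ⊕ z) p)
          (IsPartition.piece⊆ part j p)
      where
      pieces : Refines Piece (dom f)
      pieces = partition Piece (choices q terms) def-dom def-Piece dom⊆pieces
      k : ℕ
      k = proj₁ pieces
      D : Fin k → SemiPolinear n
      D = proj₁ (proj₂ pieces)
      part : IsPartition (dom f) D
      part = proj₁ (proj₂ (proj₂ pieces))
      τ : Fin k → Fin q → SimpleTerm n
      τ j = proj₁ (proj₂ (proj₂ (proj₂ pieces)) j)
      semi : ∀ j → IsSemiPolinear (_∈ˢ D j)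
      semi j = D j , λ x → mk⇔ id id

theorem5p9 : ExcludedMiddle 0ℓ → (n q : ℕ) → n ≥ 1 → q ≥ 1 →
    (f : ℝ^ n ⇀ℝ^ q) → Definable f ⇔ PiecewiseSimple f
theorem5p9 em n q _ _ f = mk⇔ (DefinableToPiecewise.definable⇒piecewiseSimple em f)
  (PiecewiseToDefinable.piecewiseSimple⇒definable em f)
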